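{- Let $t$ be a positive integer. There exists a skew-symmetric EW matrix of order $4t+2$ if and only if there exists a tournament matrix $A$ with characteristic polynomial \[ \chi_A(x) = \left( x^3 - (2t-1)x^2 - t(4t-1) \right)\left( x^2+x+t \right)^{2t-1}. \]
   Context: $I_n$, $J_n$, $O_n$ denote the identity, all-ones and all-zeros matrices of order $n$. A $\{\pm1\}$-matrix $X$ is called skew-symmetric if $X+X^\top=2I$. An EW matrix of order $n$ is a $\{\pm1\}$-matrix $B$ of order $n$ such that \[ BB^\top = B^\top B = \begin{pmatrix} (n-2)I_{n/2}+2J_{n/2} & O_{n/2}\\ O_{n/2} & (n-2)I_{n/2}+2J_{n/2}\end{pmatrix}. \] A tournament matrix is a $\{0,1\}$-matrix $A$ with $A+A^\top=J-I$. $\chi_M(x)=\det(xI-M)$ denotes the characteristic polynomial. -}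

module Defs where

open import Data.Nat as ℕ using (ℕ; zero; suc; _∸_; _<ᵇ_)
open import Data.Integer as ℤ using (ℤ; +_; 0ℤ; 1ℤ; -1ℤ)
open import Data.Fin using (Fin; zero; suc; toℕ; punchIn)
open import Data.Fin.Properties using (_≟_)
open import Data.Bool using (Bool; true; false; if_then_else_)
open import Relation.Nullary.Decidable using (⌊_⌋)
open import Relation.Binary.PropositionalEquality using (_≡_)
open import Data.Sum using (_⊎_)
open import Data.Product using (_×_)

Mat : Set → ℕ → Set
Mat A n = Fin n → Fin n → A

transpose : ∀ {A n} → Mat A n → Mat A n
transpose M i j = M j i

_==_ : ∀ {n} → Fin n → Fin n → Bool
i == j = ⌊ i ≟ j ⌋

ΣF : ∀ {A : Set} (z : A) (_⊕_ : A → A → A) {n} → (Fin n → A) → A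
ΣF z _⊕_ {zero}  f = z
ΣF z _⊕_ {suc n} f = f zero ⊕ ΣF z _⊕_ (λ i → f (suc i))

_·_ : ∀ {n} → Mat ℤ n → Mat ℤ n → Mat ℤ n
(M · N) i k = ΣF 0ℤ ℤ._+_ (λ j → M i j ℤ.* N j k)

IsPM1Matrix : ∀ {n} → Mat ℤ n → Set
IsPM1Matrix B = ∀ i j → (B i j ≡ 1ℤ) ⊎ (B i j ≡ -1ℤ)

IsSkewSymmetric : ∀ {n} → Mat ℤ n → Set
IsSkewSymmetric X = ∀ i j → X i j ℤ.+ X j i ≡ (if i == j then + 2 else 0ℤ)

-- the matrix  diag((n-2)I_{n/2} + 2J_{n/2}, (n-2)I_{n/2} + 2J_{n/2})
-- of order n = h + h (h = n/2); index i lies in the first block iff toℕ i < h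
ewGram : (h : ℕ) → Mat ℤ (h ℕ.+ h)
ewGram h i j =
  if i == j then + (h ℕ.+ h)
  else if (toℕ i <ᵇ h) Data.Bool.∧ (toℕ j <ᵇ h) Data.Bool.∨
          (Data.Bool.not (toℕ i <ᵇ h) Data.Bool.∧ Data.Bool.not (toℕ j <ᵇ h))
       then + 2 else 0ℤ

IsEWMatrix : (h : ℕ) → Mat ℤ (h ℕ.+ h) → Set
IsEWMatrix h B =
  IsPM1Matrix B ×
  (∀ i j → (B · transpose B) i j ≡ ewGram h i j) ×
  (∀ i j → (transpose B · B) i j ≡ ewGram h i j)

IsTournamentMatrix : ∀ {n} → Mat ℤ n → Set
IsTournamentMatrix A =
  (∀ i j → (A i j ≡ 0ℤ) ⊎ (A i j ≡ 1ℤ)) ×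
  (∀ i j → A i j ℤ.+ A j i ≡ (if i == j then 0ℤ else 1ℤ))

-- Polynomials over ℤ, as coefficient sequences (coefficient of x^k)
-- equality of polynomials = equality of all coefficients (_≈ₚ_)

Poly : Set
Poly = ℕ → ℤ

infix 4 _≈ₚ_
infixl 6 _+ₚ_ _-ₚ_
infixl 7 _*ₚ_
infixr 8 _^ₚ_

_≈ₚ_ : Poly → Poly → Set
p ≈ₚ q = ∀ k → p k ≡ q k

constP : ℤ → Poly
constP c zero    = c
constP c (suc _) = 0ℤ

xP : Poly
xP 1 = 1ℤ
xP _ = 0ℤ

_+ₚ_ : Poly → Poly → Poly
(p +ₚ q) k = p k ℤ.+ q k

negP : Poly → Poly
negP p k = ℤ.- p k

_-ₚ_ : Poly → Poly → Poly
p -ₚ q = p +ₚ negP q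

conv : Poly → Poly → ℕ → ℕ → ℤ
conv p q k zero    = p 0 ℤ.* q k
conv p q k (suc m) = p (suc m) ℤ.* q (k ∸ suc m) ℤ.+ conv p q k m

_*ₚ_ : Poly → Poly → Poly
(p *ₚ q) k = conv p q k k

_^ₚ_ : Poly → ℕ → Poly
p ^ₚ zero  = constP 1ℤ
p ^ₚ suc n = p *ₚ (p ^ₚ n)

signP : ℕ → Poly → Poly
signP zero    p = p
signP (suc n) p = negP (signP n p)

det : ∀ {n} → Mat Poly n → Poly
det {zero}  M = constP 1ℤ
det {suc n} M =
  ΣF (constP 0ℤ) _+ₚ_
     (λ j → signP (toℕ j) (M zero j *ₚ det (λ r c → M (suc r) (punchIn j c))))

charPoly : ∀ {n} → Mat ℤ n → Poly
charPoly M = det (λ i j → (if i == j then xP else constP 0ℤ) -ₚ constP (M i j))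

{-# OPTIONS --safe #-}

-- Put h = 2t + 1, n = 4t + 1, let S be a skew ±1 matrix of order n + 1 = 2h with first row (0, 1, …, 1), and let S′
-- be S without its first row and column. A tournament A corresponds to such an S by 2A = J - I + S′, and with
-- y = 2x + 1 row operations on a bordered determinant give
--     2ⁿ χ_A(x) = (1 + y) χ_S′(y) - χ_S(y).
-- Here χ_S′ is odd and χ_S even, so χ_A determines both of them, and conversely. Everything is evaluated at integers;
-- coefficients are used only for degrees and for the sign of a square root.
--
-- If B is a skew EW matrix then, after switching signs, B = I + S with S Sᵀ = (4t - 1) I + 2K, where K = uuᵀ + vvᵀ,
-- u ⊥ v and |u|² = |v|² = h. With ζ = y² + 4t - 1 the determinant of (yI - S)(yI + S) = ζI + 2K gives χ_S(y)² and
-- hence χ_S(y) = ζ^2t (ζ + 2h), and the inverse of yI - S yields its principal minor χ_S′(y).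
--
-- Conversely let χ_S(y) = ζ^2t (ζ + 2h). Writing S Sᵀ = (4t - 1) I + W and reducing modulo yI - S shows that yI - S
-- divides the integer matrix ± W^2t (W - 2hI), which does not depend on y; for large y this forces it to vanish
-- (an integral Cayley-Hamilton argument). As W is symmetric, W² = 2hW. By parity W = 2K with K integral; K has unit
-- diagonal and K² = hK, so its entries are 0 or ±1 and its rows are equal, opposite or orthogonal. Thus K splits
-- the indices into two classes of size h, and sorting and switching turns I + S into an EW matrix.

module Submission where

open import Defs
open import Data.Nat as ℕ using (ℕ; zero; suc; _∸_; _<ᵇ_; s≤s; z≤n)
import Data.Nat.Properties as ℕ
import Data.Nat.Tactic.RingSolver as ℕ-Solver
import Data.Integer as ℤ
open import Data.Integer using (ℤ; 0ℤ; 1ℤ; -1ℤ; -[1+_]; ∣_∣; ≢-nonZero)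
open import Data.Integer.Properties hiding (_≟_)
open import Data.Integer.Tactic.RingSolver using (solve-∀)
open import Data.Bool using (Bool; true; false; if_then_else_; _∧_; _∨_; not)
open import Data.Fin using (Fin; zero; suc; toℕ; fromℕ<; punchIn; punchOut)
open import Data.Fin.Properties using (_≟_; any?; punchIn-punchOut; punchInᵢ≢i; punchIn-injective; suc-injective; toℕ-fromℕ<)
open import Data.Fin.Permutation using (Permutation′; _⟨$⟩ʳ_; _⟨$⟩ˡ_; inverseˡ; lift₀; insert) renaming (id to idₚ)
open import Data.Vec.Functional using (_∷_; insertAt; tail; updateAt)
open import Data.Vec.Functional.Properties using (updateAt-updates; updateAt-minimal)
open import Data.Product using (Σ; _×_; _,_; proj₁; proj₂)
open import Data.Sum using (_⊎_; inj₁; inj₂; fromInj₂; reduce)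
open import Function using (const; _∘_)
open import Function.Bundles using (_⇔_; mk⇔)
open import Relation.Nullary using (yes; no)
open import Relation.Nullary.Negation using (contradiction)
open import Relation.Binary.Definitions using (tri<; tri≈; tri>)
open import Relation.Binary.PropositionalEquality
open import Algebra.Properties.AbelianGroup +-0-abelianGroup using (inverseˡ-unique)
open import Algebra.Properties.Semiring.Sum +-*-semiring using (sum; sum-cong-≗; *-distribˡ-sum; *-distribʳ-sum; ∑-distrib-+; ∑-comm; sum-replicate-zero; sum-permute)
open import Algebra.Properties.Semiring.Sum ℕ.+-*-semiring using () renaming (sum to ℕsum; ∑-distrib-+ to ℕ∑-distrib-+; *-distribˡ-sum to ℕ*-distribˡ-sum)

-- The natural argument is spectral: a real skew matrix is normal, so its characteristic polynomial
-- fixes the eigenvalues of S Sᵀ. Over ℤ there are neither eigenvalues nor division, and three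
-- substitutes take their place. Inverses are adjugates: an identity X M = c I is compared with M
-- adj(M) = det(M) I, and scalars are cancelled at each integer separately, which is possible
-- because ζ is positive everywhere once t ≥ 1. Diagonalisability becomes positivity of squares: W
-- (W V) = 0 forces W V = 0 because |W V|² is a sum of integer squares, and this is what lowers the
-- high power of W to the first. Projections become counting: two orthogonal rows of K have disjoint
-- supports of half the total size, so they leave no index over. The substitution y = 2x + 1 makes
-- only odd y available; this suffices, since -y = 2(-1 - x) + 1 is odd again and odd numbers are
-- unbounded.

module Sums where
  open import Data.Integer using (+_; _+_; _*_)

  -- Recursion on both indices, instead of a test on `i ≟ j`, lets entries of bordered matrices,
  -- minors and unit rows reduce by computation.
  δ : ∀ {n} → Mat ℤ n
  δ zero    zero    = 1ℤ
  δ zero    (suc j) = 0ℤ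
  δ (suc i) zero    = 0ℤ
  δ (suc i) (suc j) = δ i j

  δ-diag : ∀ {n} (i : Fin n) → δ i i ≡ 1ℤ
  δ-diag zero    = refl
  δ-diag (suc i) = δ-diag i

  δ-off : ∀ {n} {i j : Fin n} → i ≢ j → δ i j ≡ 0ℤ
  δ-off {i = zero}  {zero}  i≢j = contradiction refl i≢j
  δ-off {i = zero}  {suc j} i≢j = refl
  δ-off {i = suc i} {zero}  i≢j = refl
  δ-off {i = suc i} {suc j} i≢j = δ-off (λ i≡j → i≢j (cong suc i≡j))

  -- Hands out the decision together with the value of the conditional, so that a test `i == j` can
  -- be rewritten without unfolding it at each use.
  if-== : ∀ {A : Set} {n} (i j : Fin n) (x y : A) →
          (i ≡ j × (if i == j then x else y) ≡ x) ⊎ (i ≢ j × (if i == j then x else y) ≡ y)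
  if-== i j x y with i ≟ j
  ... | yes i≡j = inj₁ (i≡j , refl)
  ... | no  i≢j = inj₂ (i≢j , refl)

  δ-sym : ∀ {n} (i j : Fin n) → δ i j ≡ δ j i
  δ-sym zero zero = refl
  δ-sym zero (suc j) = refl
  δ-sym (suc i) zero = refl
  δ-sym (suc i) (suc j) = δ-sym i j

  sum-zero : ∀ {n} {f : Fin n → ℤ} → (∀ i → f i ≡ 0ℤ) → sum f ≡ 0ℤ
  sum-zero {n} f≗0 = trans (sum-cong-≗ f≗0) (sum-replicate-zero n)

  sum-δˡ : ∀ {n} (i : Fin n) (f : Fin n → ℤ) → sum (λ k → δ i k * f k) ≡ f i
  sum-δˡ zero f = trans (cong₂ _+_ (*-identityˡ (f zero)) (sum-zero (λ k → *-zeroˡ (f (suc k))))) (+-identityʳ (f zero))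
  sum-δˡ (suc i) f = trans (cong₂ _+_ (*-zeroˡ (f zero)) (sum-δˡ i (λ k → f (suc k)))) (+-identityˡ (f (suc i)))

  sum-δʳ : ∀ {n} (i : Fin n) (f : Fin n → ℤ) → sum (λ k → f k * δ k i) ≡ f i
  sum-δʳ i f = trans (sum-cong-≗ (λ k → trans (*-comm (f k) (δ k i)) (cong (_* f k) (δ-sym k i)))) (sum-δˡ i f)

  sum-linear : ∀ {n} a b (f g : Fin n → ℤ) → sum (λ i → a * f i + b * g i) ≡ a * sum f + b * sum g
  sum-linear a b f g = trans (∑-distrib-+ (λ i → a * f i) (λ i → b * g i)) (sym (cong₂ _+_ (*-distribˡ-sum a f) (*-distribˡ-sum b g)))

open Sums

-- Determinants over ℤ from the uniqueness of alternating multilinear functions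

module Determinants where
  open import Data.Integer using (_+_; _*_; -_; _^_)
  open ≡-Reasoning

  Rows : ℕ → ℕ → Set
  Rows n m = Fin n → Fin m → ℤ

  infix 4 _≐_
  _≐_ : ∀ {n m} → Rows n m → Rows n m → Set
  M ≐ N = ∀ i j → M i j ≡ N i j

  -- Only neighbouring rows enter the axioms: in the first-row expansion a coincidence of
  -- neighbouring columns is the case where two terms cancel directly. Arbitrary equal rows follow
  -- in `equal-rows`.
  data Adjacent : ∀ {n} → Fin n → Fin n → Set where
    here  : ∀ {n} → Adjacent {suc (suc n)} zero (suc zero)
    there : ∀ {n} {i k : Fin n} → Adjacent i k → Adjacent (suc i) (suc k)

  -- The three matrices in `linear` are related entrywise, so the law applies however they are
  -- presented; `ext` makes up for the absence of function extensionality.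
  record Alternating {n m} (F : Rows n m → ℤ) : Set where
    field
      ext      : ∀ {M N} → M ≐ N → F M ≡ F N
      linear   : ∀ i a b {M M₁ M₂} → (∀ c → M i c ≡ a * M₁ i c + b * M₂ i c) →
                 (∀ r → r ≢ i → ∀ c → M r c ≡ M₁ r c × M r c ≡ M₂ r c) →
                 F M ≡ a * F M₁ + b * F M₂
      adjacent : ∀ {M i k} → Adjacent i k → (∀ c → M i c ≡ M k c) → F M ≡ 0ℤ

    zero-row : ∀ {M} i → (∀ c → M i c ≡ 0ℤ) → F M ≡ 0ℤ
    zero-row {M} i Mi≡0 = linear i 0ℤ 0ℤ {M} {M} {M} Mi≡0 (λ _ _ _ → refl , refl)

    -- Expands one row as a linear combination. With unit rows as summands it yields the Laplace
    -- expansion and the adjugate identity.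
    linear-sum : ∀ {p} i (a : Fin p → ℤ) (N : Fin p → Rows n m) M →
                 (∀ c → M i c ≡ sum (λ j → a j * N j i c)) →
                 (∀ j r → r ≢ i → ∀ c → M r c ≡ N j r c) →
                 F M ≡ sum (λ j → a j * F (N j))
    linear-sum {zero}  i a N M row rest = zero-row i row
    linear-sum {suc p} i a N M row rest = begin
      F M                                                      ≡⟨ linear i (a zero) 1ℤ split off ⟩
      a zero * F (N zero) + 1ℤ * F M′                          ≡⟨ cong (a zero * F (N zero) +_) (*-identityˡ (F M′)) ⟩
      a zero * F (N zero) + F M′                               ≡⟨ cong (a zero * F (N zero) +_)
                                                                    (linear-sum i (a ∘ suc) (N ∘ suc) M′ row′ rest′) ⟩
      sum (λ j → a j * F (N j))                                ∎
      where
      w : Fin m → ℤ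
      w c = sum (λ j → a (suc j) * N (suc j) i c)
      M′ : Rows n m
      M′ = updateAt M i (const w)
      row′ : ∀ c → M′ i c ≡ w c
      row′ c = cong (λ v → v c) (updateAt-updates i M)
      split : ∀ c → M i c ≡ a zero * N zero i c + 1ℤ * M′ i c
      split c = trans (row c) (cong (a zero * N zero i c +_) (trans (sym (row′ c)) (sym (*-identityˡ (M′ i c)))))
      same : ∀ r → r ≢ i → ∀ c → M′ r c ≡ M r c
      same r r≢i c = cong (λ v → v c) (updateAt-minimal r i M r≢i)
      off : ∀ r → r ≢ i → ∀ c → M r c ≡ N zero r c × M r c ≡ M′ r c
      off r r≢i c = rest zero r r≢i c , sym (same r r≢i c)
      rest′ : ∀ j r → r ≢ i → ∀ c → M′ r c ≡ N (suc j) r c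
      rest′ j r r≢i c = trans (same r r≢i c) (rest (suc j) r r≢i c)

  open Alternating

  uncons-row : ∀ {n m} (M : Rows (suc n) m) → M ≐ (M zero ∷ tail M)
  uncons-row M zero    c = refl
  uncons-row M (suc r) c = refl

  fix-row : ∀ {n m} {F : Rows (suc n) m → ℤ} → Alternating F → ∀ v → Alternating (λ M → F (v ∷ M))
  fix-row A v .ext M≐N = ext A (λ { zero c → refl ; (suc r) c → M≐N r c })
  fix-row A v .linear i a b row rest =
    linear A (suc i) a b row (λ { zero _ c → refl , refl ; (suc r) r≢i c → rest r (λ r≡i → r≢i (cong suc r≡i)) c })
  fix-row A v .adjacent adj eq = adjacent A (there adj) eq

  -- Putting v + w in both rows gives zero; the two expanded terms with a repeated row vanish as
  -- well, so the mixed ones are opposite.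
  swap : ∀ {n m} {F : Rows (suc (suc n)) m → ℤ} → Alternating F → ∀ v w M →
         F (v ∷ w ∷ M) ≡ - F (w ∷ v ∷ M)
  swap {n} {m} {F} A v w M = cancel _ _ (begin
    0ℤ                                                                 ≡⟨ adjacent A here (λ _ → refl) ⟨
    F (v+w ∷ v+w ∷ M)                                                  ≡⟨ linear A zero 1ℤ 1ℤ v+w-row
                                                                            (λ { zero ne → contradiction refl ne ; (suc r) _ c → refl , refl }) ⟩
    1ℤ * F (v ∷ v+w ∷ M) + 1ℤ * F (w ∷ v+w ∷ M)                        ≡⟨ cong₂ (λ p q → 1ℤ * p + 1ℤ * q) (second v) (second w) ⟩
    1ℤ * (1ℤ * F (v ∷ v ∷ M) + 1ℤ * F (v ∷ w ∷ M)) +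
    1ℤ * (1ℤ * F (w ∷ v ∷ M) + 1ℤ * F (w ∷ w ∷ M))                     ≡⟨ cong₂ (λ p q → 1ℤ * (1ℤ * p + 1ℤ * F (v ∷ w ∷ M)) + 1ℤ * (1ℤ * F (w ∷ v ∷ M) + 1ℤ * q))
                                                                            (adjacent A here (λ _ → refl)) (adjacent A here (λ _ → refl)) ⟩
    1ℤ * (1ℤ * 0ℤ + 1ℤ * F (v ∷ w ∷ M)) +
    1ℤ * (1ℤ * F (w ∷ v ∷ M) + 1ℤ * 0ℤ)                                ∎)
    where
    v+w : Fin m → ℤ
    v+w c = v c + w c
    v+w-row : ∀ c → v c + w c ≡ 1ℤ * v c + 1ℤ * w c
    v+w-row c = sym (cong₂ _+_ (*-identityˡ (v c)) (*-identityˡ (w c)))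
    second : ∀ u → F (u ∷ v+w ∷ M) ≡ 1ℤ * F (u ∷ v ∷ M) + 1ℤ * F (u ∷ w ∷ M)
    second u = linear (fix-row A u) zero 1ℤ 1ℤ v+w-row (λ { zero ne → contradiction refl ne ; (suc r) _ c → refl , refl })
    simplify : ∀ x y → 1ℤ * (1ℤ * 0ℤ + 1ℤ * x) + 1ℤ * (1ℤ * y + 1ℤ * 0ℤ) + - y ≡ x
    simplify = solve-∀
    cancel : ∀ x y → 0ℤ ≡ 1ℤ * (1ℤ * 0ℤ + 1ℤ * x) + 1ℤ * (1ℤ * y + 1ℤ * 0ℤ) → x ≡ - y
    cancel x y e = trans (sym (simplify x y)) (trans (cong (_+ - y) (sym e)) (+-identityˡ (- y)))

  -- Swaps move row zero down until it meets its equal.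
  equal-rows₀ : ∀ {n m} {F : Rows (suc n) m → ℤ} → Alternating F → ∀ M i →
                (∀ c → M zero c ≡ M (suc i) c) → F M ≡ 0ℤ
  equal-rows₀ A M zero eq = adjacent A here eq
  equal-rows₀ {F = F} A M (suc i) eq = begin
    F M                                              ≡⟨ ext A (λ { zero c → refl ; (suc zero) c → refl ; (suc (suc r)) c → refl }) ⟩
    F (M zero ∷ M (suc zero) ∷ tail (tail M))        ≡⟨ swap A (M zero) (M (suc zero)) (tail (tail M)) ⟩
    - F (M (suc zero) ∷ M zero ∷ tail (tail M))      ≡⟨ cong -_ (equal-rows₀ (fix-row A (M (suc zero))) (M zero ∷ tail (tail M)) i eq) ⟩
    0ℤ                                               ∎

  equal-rows : ∀ {n m} {F : Rows n m → ℤ} → Alternating F → ∀ M {i k} → i ≢ k →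
               (∀ c → M i c ≡ M k c) → F M ≡ 0ℤ
  equal-rows A M {zero}  {zero}  i≢k eq = contradiction refl i≢k
  equal-rows A M {zero}  {suc k} i≢k eq = equal-rows₀ A M k eq
  equal-rows A M {suc i} {zero}  i≢k eq = equal-rows₀ A M i (sym ∘ eq)
  equal-rows A M {suc i} {suc k} i≢k eq =
    trans (ext A (uncons-row M)) (equal-rows (fix-row A (M zero)) (tail M) (i≢k ∘ cong suc) eq)

  -- The second hypothesis, that F vanishes as soon as some row is v, holds when v also occurs as a
  -- fixed row outside M. Rows are cleared from the top, each cleared row being absorbed into F.
  add-multiples : ∀ {n m} {F : Rows n m → ℤ} → Alternating F → ∀ (v : Fin m → ℤ) →
                  (∀ M i → (∀ c → M i c ≡ v c) → F M ≡ 0ℤ) →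
                  ∀ (a : Fin n → ℤ) M M′ → (∀ r c → M r c ≡ a r * v c + M′ r c) → F M ≡ F M′
  add-multiples {zero}  A v kills a M M′ eq = ext A (λ ())
  add-multiples {suc n} {F = F} A v kills a M M′ eq = begin
    F M                                                   ≡⟨ linear A zero (a zero) 1ℤ
                                                               (λ c → trans (eq zero c) (cong (a zero * v c +_) (sym (*-identityˡ (M′ zero c)))))
                                                               (λ { zero ne → contradiction refl ne ; (suc r) _ c → refl , refl }) ⟩
    a zero * F (v ∷ tail M) + 1ℤ * F (M′ zero ∷ tail M)   ≡⟨ cong₂ _+_ (trans (cong (a zero *_) (kills _ zero (λ _ → refl))) (*-zeroʳ (a zero)))
                                                                       (*-identityˡ (F (M′ zero ∷ tail M))) ⟩
    0ℤ + F (M′ zero ∷ tail M)                             ≡⟨ +-identityˡ (F (M′ zero ∷ tail M)) ⟩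
    F (M′ zero ∷ tail M)                                  ≡⟨ add-multiples (fix-row A (M′ zero)) v (λ N i → kills (M′ zero ∷ N) (suc i))
                                                               (a ∘ suc) (tail M) (tail M′) (eq ∘ suc) ⟩
    F (M′ zero ∷ tail M′)                                 ≡⟨ ext A (uncons-row M′) ⟨
    F M′                                                  ∎

  minor : ∀ {n} → Mat ℤ (suc n) → Fin (suc n) → Mat ℤ n
  minor M j r c = M (suc r) (punchIn j c)

  sgn : ℕ → ℤ
  sgn zero    = 1ℤ
  sgn (suc k) = - sgn k

  detℤ : ∀ {n} → Mat ℤ n → ℤ
  detℤ {zero}  M = 1ℤ
  detℤ {suc n} M = sum (λ j → sgn (toℕ j) * (M zero j * detℤ (minor M j)))

  -- A zero column at position j turns an alternating function of wider matrices into one of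
  -- matrices of minor size, which makes induction possible.
  insert-column : ∀ {n m} → Fin (suc m) → Rows n m → Rows n (suc m)
  insert-column j M r = insertAt (M r) j 0ℤ

  insertAt-linear : ∀ {m} (j : Fin (suc m)) a b (u v w : Fin m → ℤ) → (∀ c → u c ≡ a * v c + b * w c) →
                    ∀ c → insertAt u j 0ℤ c ≡ a * insertAt v j 0ℤ c + b * insertAt w j 0ℤ c
  insertAt-linear zero a b u v w eq zero = sym (cong₂ _+_ (*-zeroʳ a) (*-zeroʳ b))
  insertAt-linear zero a b u v w eq (suc c) = eq c
  insertAt-linear {suc m} (suc j) a b u v w eq zero = eq zero
  insertAt-linear {suc m} (suc j) a b u v w eq (suc c) = insertAt-linear j a b (tail u) (tail v) (tail w) (eq ∘ suc) c

  insertAt-cong : ∀ {m} (j : Fin (suc m)) (u v : Fin m → ℤ) → (∀ c → u c ≡ v c) →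
                  ∀ c → insertAt u j 0ℤ c ≡ insertAt v j 0ℤ c
  insertAt-cong zero u v eq zero = refl
  insertAt-cong zero u v eq (suc c) = eq c
  insertAt-cong {suc m} (suc j) u v eq zero = eq zero
  insertAt-cong {suc m} (suc j) u v eq (suc c) = insertAt-cong j (tail u) (tail v) (eq ∘ suc) c

  insert-column-alternating : ∀ {n m} {F : Rows n (suc m) → ℤ} → Alternating F → ∀ j →
                              Alternating (λ M → F (insert-column j M))
  insert-column-alternating A j .ext M≐N = ext A (λ r → insertAt-cong j _ _ (M≐N r))
  insert-column-alternating A j .linear i a b row rest =
    linear A i a b (insertAt-linear j a b _ _ _ row)
      (λ r r≢i c → insertAt-cong j _ _ (λ c → proj₁ (rest r r≢i c)) c , insertAt-cong j _ _ (λ c → proj₂ (rest r r≢i c)) c)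
  insert-column-alternating A j .adjacent adj eq = adjacent A adj (insertAt-cong j _ _ eq)

  insertAt-removed : ∀ {m} (j : Fin (suc m)) (u : Fin (suc m) → ℤ) c →
                     u c ≡ u j * δ j c + insertAt (u ∘ punchIn j) j 0ℤ c
  insertAt-removed zero u zero = sym (trans (+-identityʳ (u zero * 1ℤ)) (*-identityʳ (u zero)))
  insertAt-removed zero u (suc c) = sym (trans (cong (_+ u (suc c)) (*-zeroʳ (u zero))) (+-identityˡ (u (suc c))))
  insertAt-removed {suc m} (suc j) u zero = sym (trans (cong (_+ u zero) (*-zeroʳ (u (suc j)))) (+-identityˡ (u zero)))
  insertAt-removed {suc m} (suc j) u (suc c) = insertAt-removed j (tail u) c

  insertAt-δ : ∀ {m} (j : Fin (suc m)) (r : Fin m) c → insertAt (δ r) j 0ℤ c ≡ δ (punchIn j r) c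
  insertAt-δ zero r zero = refl
  insertAt-δ zero r (suc c) = refl
  insertAt-δ {suc m} (suc j) zero zero = refl
  insertAt-δ {suc m} (suc j) (suc r) zero = refl
  insertAt-δ {suc m} (suc j) zero (suc c) = insertAt-0 j c
    where
    insertAt-0 : ∀ {m} (j : Fin (suc m)) c → insertAt (λ _ → 0ℤ) j 0ℤ c ≡ 0ℤ
    insertAt-0 zero zero = refl
    insertAt-0 zero (suc c) = refl
    insertAt-0 {suc m} (suc j) zero = refl
    insertAt-0 {suc m} (suc j) (suc c) = insertAt-0 j c
  insertAt-δ {suc m} (suc j) (suc r) (suc c) = insertAt-δ j r c

  -- One swap costs a sign and brings `δ zero` to the top; below it stands the same configuration,
  -- one size smaller and with a zero column in front.
  cycle : ∀ {n} {F : Mat ℤ (suc n) → ℤ} → Alternating F → ∀ j → F (δ j ∷ (λ r → δ (punchIn j r))) ≡ sgn (toℕ j) * F δ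
  cycle {F = F} A zero = trans (ext A (λ { zero c → refl ; (suc r) c → refl })) (sym (*-identityˡ (F δ)))
  cycle {suc n} {F} A (suc j) = begin
    F (δ (suc j) ∷ (λ r → δ (punchIn (suc j) r)))                    ≡⟨ ext A (λ { zero c → refl ; (suc zero) c → refl ; (suc (suc r)) c → refl }) ⟩
    F (δ (suc j) ∷ δ zero ∷ (λ r → δ (suc (punchIn j r))))           ≡⟨ swap A _ _ _ ⟩
    - F (δ zero ∷ δ (suc j) ∷ (λ r → δ (suc (punchIn j r))))         ≡⟨ cong -_ (ext A embed) ⟩
    - F (δ zero ∷ insert-column zero (δ j ∷ (λ r → δ (punchIn j r)))) ≡⟨ cong -_ (cycle (insert-column-alternating (fix-row A (δ zero)) zero) j) ⟩
    - (sgn (toℕ j) * F (δ zero ∷ insert-column zero δ))              ≡⟨ neg-distribˡ-* (sgn (toℕ j)) _ ⟩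
    - sgn (toℕ j) * F (δ zero ∷ insert-column zero δ)                ≡⟨ cong (- sgn (toℕ j) *_) (ext A embed-δ) ⟩
    - sgn (toℕ j) * F δ                                              ∎
    where
    embed : ∀ r c → (δ zero ∷ δ (suc j) ∷ (λ r → δ (suc (punchIn j r)))) r c ≡
                    (δ zero ∷ insert-column zero (δ j ∷ (λ r → δ (punchIn j r)))) r c
    embed zero c = refl
    embed (suc zero) zero = refl
    embed (suc zero) (suc c) = refl
    embed (suc (suc r)) zero = refl
    embed (suc (suc r)) (suc c) = refl
    embed-δ : ∀ r c → (δ zero ∷ insert-column zero δ) r c ≡ δ r c
    embed-δ zero c = refl
    embed-δ (suc r) zero = refl
    embed-δ (suc r) (suc c) = refl

  -- Row zero is expanded in unit rows. Under `δ j` the entries of column j can be cleared, and what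
  -- remains is an alternating function of the minor, known by induction. The outcome is the very
  -- first-row expansion that defines `detℤ`.
  alternating-unique : ∀ {n} {F : Mat ℤ n → ℤ} → Alternating F → ∀ M → F M ≡ detℤ M * F δ
  alternating-unique {zero}  {F} A M = trans (ext A (λ ())) (sym (*-identityˡ (F δ)))
  alternating-unique {suc n} {F} A M = begin
    F M                                                                  ≡⟨ linear-sum A zero (M zero) (λ j → δ j ∷ tail M) M
                                                                              (λ c → sym (sum-δʳ c (M zero)))
                                                                              (λ { j zero ne → contradiction refl ne ; j (suc r) _ c → refl }) ⟩
    sum (λ j → M zero j * F (δ j ∷ tail M))                              ≡⟨ sum-cong-≗ (λ j → trans (cong (M zero j *_) (expand j)) (rearrange (M zero j) (detℤ (minor M j)) (sgn (toℕ j)) (F δ))) ⟩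
    sum (λ j → sgn (toℕ j) * (M zero j * detℤ (minor M j)) * F δ)        ≡⟨ *-distribʳ-sum (F δ) (λ j → sgn (toℕ j) * (M zero j * detℤ (minor M j))) ⟨
    detℤ M * F δ                                                         ∎
    where
    rearrange : ∀ x d s f → x * (d * (s * f)) ≡ s * (x * d) * f
    rearrange = solve-∀
    expand : ∀ j → F (δ j ∷ tail M) ≡ detℤ (minor M j) * (sgn (toℕ j) * F δ)
    expand j = begin
      F (δ j ∷ tail M)                            ≡⟨ add-multiples (fix-row A (δ j)) (δ j)
                                                       (λ N i eq → equal-rows A (δ j ∷ N) {zero} {suc i} (λ ()) (λ c → sym (eq c)))
                                                       (λ r → M (suc r) j) (tail M) (insert-column j (minor M j))
                                                       (λ r → insertAt-removed j (M (suc r))) ⟩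
      F (δ j ∷ insert-column j (minor M j))       ≡⟨ alternating-unique (insert-column-alternating (fix-row A (δ j)) j) (minor M j) ⟩
      detℤ (minor M j) * F (δ j ∷ insert-column j δ) ≡⟨ cong (detℤ (minor M j) *_)
                                                          (trans (ext A (λ { zero c → refl ; (suc r) c → insertAt-δ j r c })) (cycle A j)) ⟩
      detℤ (minor M j) * (sgn (toℕ j) * F δ)      ∎

  det-ext : ∀ {n} {M N : Mat ℤ n} → M ≐ N → detℤ M ≡ detℤ N
  det-ext {zero}  M≐N = refl
  det-ext {suc n} M≐N =
    sum-cong-≗ (λ j → cong₂ (λ x d → sgn (toℕ j) * (x * d)) (M≐N zero j) (det-ext (λ r c → M≐N (suc r) (punchIn j c))))

  -- In the term of column k the entry is linear and the minor does not contain the column; in every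
  -- other term the minor contains it and induction applies.
  det-linear-column : ∀ {n} (k : Fin n) a b {M M₁ M₂ : Mat ℤ n} → (∀ r → M r k ≡ a * M₁ r k + b * M₂ r k) →
                      (∀ c → c ≢ k → ∀ r → M r c ≡ M₁ r c × M r c ≡ M₂ r c) →
                      detℤ M ≡ a * detℤ M₁ + b * detℤ M₂
  det-linear-column {suc n} k a b {M} {M₁} {M₂} column rest = begin
    detℤ M                                        ≡⟨ sum-cong-≗ term ⟩
    sum (λ j → a * summand M₁ j + b * summand M₂ j) ≡⟨ sum-linear a b (summand M₁) (summand M₂) ⟩
    a * detℤ M₁ + b * detℤ M₂                     ∎
    where
    summand : Mat ℤ (suc n) → Fin (suc n) → ℤ
    summand N j = sgn (toℕ j) * (N zero j * detℤ (minor N j))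
    at-k : ∀ a b s x y d → s * ((a * x + b * y) * d) ≡ a * (s * (x * d)) + b * (s * (y * d))
    at-k = solve-∀
    off-k : ∀ a b s x d e → s * (x * (a * d + b * e)) ≡ a * (s * (x * d)) + b * (s * (x * e))
    off-k = solve-∀
    term : ∀ j → summand M j ≡ a * summand M₁ j + b * summand M₂ j
    term j with j ≟ k
    ... | yes refl = begin
      summand M j
        ≡⟨ cong (λ x → sgn (toℕ j) * (x * detℤ (minor M j))) (column zero) ⟩
      sgn (toℕ j) * ((a * M₁ zero j + b * M₂ zero j) * detℤ (minor M j))
        ≡⟨ at-k a b (sgn (toℕ j)) (M₁ zero j) (M₂ zero j) (detℤ (minor M j)) ⟩
      a * (sgn (toℕ j) * (M₁ zero j * detℤ (minor M j))) + b * (sgn (toℕ j) * (M₂ zero j * detℤ (minor M j)))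
        ≡⟨ cong₂ (λ d e → a * (sgn (toℕ j) * (M₁ zero j * d)) + b * (sgn (toℕ j) * (M₂ zero j * e)))
             (det-ext (λ r c → proj₁ (rest (punchIn j c) (punchInᵢ≢i j c) (suc r))))
             (det-ext (λ r c → proj₂ (rest (punchIn j c) (punchInᵢ≢i j c) (suc r)))) ⟩
      a * summand M₁ j + b * summand M₂ j ∎
    ... | no j≢k = begin
      summand M j
        ≡⟨ cong (λ d → sgn (toℕ j) * (M zero j * d))
             (det-linear-column (punchOut j≢k) a b {minor M j} {minor M₁ j} {minor M₂ j} column′ rest′) ⟩
      sgn (toℕ j) * (M zero j * (a * detℤ (minor M₁ j) + b * detℤ (minor M₂ j)))
        ≡⟨ off-k a b (sgn (toℕ j)) (M zero j) (detℤ (minor M₁ j)) (detℤ (minor M₂ j)) ⟩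
      a * (sgn (toℕ j) * (M zero j * detℤ (minor M₁ j))) + b * (sgn (toℕ j) * (M zero j * detℤ (minor M₂ j)))
        ≡⟨ cong₂ (λ x y → a * (sgn (toℕ j) * (x * detℤ (minor M₁ j))) + b * (sgn (toℕ j) * (y * detℤ (minor M₂ j))))
             (proj₁ (rest j j≢k zero)) (proj₂ (rest j j≢k zero)) ⟩
      a * summand M₁ j + b * summand M₂ j ∎
      where
      column′ : ∀ r → minor M j r (punchOut j≢k) ≡ a * minor M₁ j r (punchOut j≢k) + b * minor M₂ j r (punchOut j≢k)
      column′ r rewrite punchIn-punchOut j≢k = column (suc r)
      rest′ : ∀ c → c ≢ punchOut j≢k → ∀ r → minor M j r c ≡ minor M₁ j r c × minor M j r c ≡ minor M₂ j r c
      rest′ c c≢ r = rest (punchIn j c)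
        (λ eq → c≢ (punchIn-injective j c (punchOut j≢k) (trans eq (sym (punchIn-punchOut j≢k))))) (suc r)

  adjacent-punchOut : ∀ {n} {j k i : Fin (suc n)} → Adjacent i k → (j≢i : j ≢ i) (j≢k : j ≢ k) →
                      Adjacent (punchOut j≢i) (punchOut j≢k)
  adjacent-punchOut {j = zero} here j≢i j≢k = contradiction refl j≢i
  adjacent-punchOut {j = suc zero} here j≢i j≢k = contradiction refl j≢k
  adjacent-punchOut {suc (suc n)} {j = suc (suc j)} here j≢i j≢k = here
  adjacent-punchOut {j = zero} (there adj) j≢i j≢k = adj
  adjacent-punchOut {suc n} {j = suc j} (there adj) j≢i j≢k = there (adjacent-punchOut {j = j} adj _ _)

  adjacent-sgn : ∀ {n} {i k : Fin n} → Adjacent i k → sgn (toℕ k) ≡ - sgn (toℕ i)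
  adjacent-sgn here = refl
  adjacent-sgn (there adj) = cong -_ (adjacent-sgn adj)

  punchIn-adjacent : ∀ {n} {i k : Fin (suc n)} → Adjacent i k → (v : Fin (suc n) → ℤ) → v i ≡ v k →
                     ∀ c → v (punchIn i c) ≡ v (punchIn k c)
  punchIn-adjacent here v eq zero = sym eq
  punchIn-adjacent here v eq (suc c) = refl
  punchIn-adjacent (there adj) v eq zero = refl
  punchIn-adjacent {suc n} (there adj) v eq (suc c) = punchIn-adjacent adj (tail v) eq c

  sum-adjacent-cancel : ∀ {n} {i k : Fin n} → Adjacent i k → (f : Fin n → ℤ) → f i + f k ≡ 0ℤ →
                        (∀ j → j ≢ i → j ≢ k → f j ≡ 0ℤ) → sum f ≡ 0ℤ
  sum-adjacent-cancel here f cancel rest = begin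
    f zero + (f (suc zero) + sum (tail (tail f)))  ≡⟨ +-assoc (f zero) (f (suc zero)) (sum (tail (tail f))) ⟨
    f zero + f (suc zero) + sum (tail (tail f))    ≡⟨ cong₂ _+_ cancel (sum-zero (λ j → rest (suc (suc j)) (λ ()) (λ ()))) ⟩
    0ℤ                                             ∎
  sum-adjacent-cancel (there adj) f cancel rest =
    cong₂ _+_ (rest zero (λ ()) (λ ()))
      (sum-adjacent-cancel adj (tail f) cancel (λ j j≢i j≢k → rest (suc j) (j≢i ∘ suc-injective) (j≢k ∘ suc-injective)))

  -- Deleting either of the two columns leaves the same minor with opposite signs; every other minor
  -- still has two equal neighbouring columns.
  det-adjacent-columns : ∀ {n} {i k : Fin n} → Adjacent i k → ∀ M → (∀ r → M r i ≡ M r k) → detℤ M ≡ 0ℤ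
  det-adjacent-columns {suc n} {i} {k} adj M eq = sum-adjacent-cancel adj summand cancel rest
    where
    summand : Fin (suc n) → ℤ
    summand j = sgn (toℕ j) * (M zero j * detℤ (minor M j))
    negate : ∀ s x d → s * (x * d) + - s * (x * d) ≡ 0ℤ
    negate s x d = trans (cong (s * (x * d) +_) (sym (neg-distribˡ-* s (x * d)))) (+-inverseʳ (s * (x * d)))
    cancel : summand i + summand k ≡ 0ℤ
    cancel = begin
      summand i + sgn (toℕ k) * (M zero k * detℤ (minor M k))
        ≡⟨ cong (summand i +_) (cong₂ _*_ (adjacent-sgn adj)
             (cong₂ _*_ (sym (eq zero)) (det-ext (λ r c → sym (punchIn-adjacent adj (M (suc r)) (eq (suc r)) c))))) ⟩
      summand i + - sgn (toℕ i) * (M zero i * detℤ (minor M i))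
        ≡⟨ negate (sgn (toℕ i)) (M zero i) (detℤ (minor M i)) ⟩
      0ℤ ∎
    rest : ∀ j → j ≢ i → j ≢ k → summand j ≡ 0ℤ
    rest j j≢i j≢k = begin
      summand j                        ≡⟨ cong (λ d → sgn (toℕ j) * (M zero j * d))
                                            (det-adjacent-columns (adjacent-punchOut adj j≢i j≢k) (minor M j) minor-eq) ⟩
      sgn (toℕ j) * (M zero j * 0ℤ)    ≡⟨ cong (sgn (toℕ j) *_) (*-zeroʳ (M zero j)) ⟩
      sgn (toℕ j) * 0ℤ                 ≡⟨ *-zeroʳ (sgn (toℕ j)) ⟩
      0ℤ                               ∎
      where
      minor-eq : ∀ r → minor M j r (punchOut j≢i) ≡ minor M j r (punchOut j≢k)
      minor-eq r = trans (cong (M (suc r)) (punchIn-punchOut j≢i))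
                     (trans (eq (suc r)) (cong (M (suc r)) (sym (punchIn-punchOut j≢k))))

  -- Column properties come straight from the first-row expansion, so it is the transposed
  -- determinant that is first seen to be alternating in rows. Uniqueness then gives
  -- `det-transpose`, and with it the row properties of `detℤ`.
  det-transpose-alternating : ∀ {n} → Alternating {n} {n} (λ M → detℤ (transpose M))
  det-transpose-alternating .ext M≐N = det-ext (λ r c → M≐N c r)
  det-transpose-alternating .linear i a b row rest = det-linear-column i a b row (λ c c≢i r → rest c c≢i r)
  det-transpose-alternating .adjacent {M} adj eq = det-adjacent-columns adj (transpose M) eq

  det-zero-column : ∀ {n} (k : Fin n) (M : Mat ℤ n) → (∀ r → M r k ≡ 0ℤ) → detℤ M ≡ 0ℤ
  det-zero-column k M = zero-row det-transpose-alternating {transpose M} k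

  -- All minors along row zero except the first have a zero column.
  det-block : ∀ {n} (M : Mat ℤ (suc n)) → (∀ r → M (suc r) zero ≡ 0ℤ) →
              detℤ M ≡ M zero zero * detℤ (λ r c → M (suc r) (suc c))
  det-block {n} M column = begin
    1ℤ * (M zero zero * detℤ (minor M zero)) + sum (λ j → summand (suc j))
      ≡⟨ cong₂ _+_ (*-identityˡ (M zero zero * detℤ (minor M zero))) (sum-zero rest) ⟩
    M zero zero * detℤ (minor M zero) + 0ℤ
      ≡⟨ +-identityʳ (M zero zero * detℤ (minor M zero)) ⟩
    M zero zero * detℤ (minor M zero) ∎
    where
    summand : Fin (suc n) → ℤ
    summand j = sgn (toℕ j) * (M zero j * detℤ (minor M j))
    first-column : ∀ {n} (M : Mat ℤ (suc n)) (j : Fin n) → (∀ r → M (suc r) zero ≡ 0ℤ) → detℤ (minor M (suc j)) ≡ 0ℤ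
    first-column {suc n} M j column = det-zero-column zero (minor M (suc j)) column
    rest : ∀ j → summand (suc j) ≡ 0ℤ
    rest j = trans (cong (λ d → sgn (toℕ (suc j)) * (M zero (suc j) * d)) (first-column M j column))
               (trans (cong (sgn (toℕ (suc j)) *_) (*-zeroʳ (M zero (suc j)))) (*-zeroʳ (sgn (toℕ (suc j)))))

  det-scalar : ∀ n z → detℤ {n} (λ i j → z * δ i j) ≡ z ^ n
  det-scalar zero    z = refl
  det-scalar (suc n) z = trans (det-block {n} (λ i j → z * δ i j) (λ _ → *-zeroʳ z)) (cong₂ _*_ (*-identityʳ z) (det-scalar n z))

  det-δ : ∀ n → detℤ {n} δ ≡ 1ℤ
  det-δ n = trans (det-ext {n} (λ i j → sym (*-identityˡ (δ i j)))) (trans (det-scalar n 1ℤ) (^-zeroˡ n))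

  det-transpose : ∀ {n} (M : Mat ℤ n) → detℤ (transpose M) ≡ detℤ M
  det-transpose {n} M = begin
    detℤ (transpose M)            ≡⟨ alternating-unique det-transpose-alternating M ⟩
    detℤ M * detℤ (transpose (δ {n})) ≡⟨ cong (detℤ M *_) (trans (det-ext {n} (λ i j → δ-sym j i)) (det-δ n)) ⟩
    detℤ M * 1ℤ                   ≡⟨ *-identityʳ (detℤ M) ⟩
    detℤ M                        ∎

  det-alternating : ∀ {n} → Alternating (detℤ {n})
  det-alternating .ext = det-ext
  det-alternating .linear i a b {M} {M₁} {M₂} row rest = begin
    detℤ M                                                   ≡⟨ det-transpose M ⟨
    detℤ (transpose M)                                       ≡⟨ linear det-transpose-alternating i a b row rest ⟩
    a * detℤ (transpose M₁) + b * detℤ (transpose M₂)        ≡⟨ cong₂ (λ d e → a * d + b * e) (det-transpose M₁) (det-transpose M₂) ⟩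
    a * detℤ M₁ + b * detℤ M₂                                ∎
  det-alternating .adjacent {M} adj eq = trans (sym (det-transpose M)) (adjacent det-transpose-alternating {M} adj eq)

  infixl 7 _⊗_
  _⊗_ : ∀ {n m p} → Rows n m → Rows m p → Rows n p
  (M ⊗ N) i k = sum (λ j → M i j * N j k)

  -- For fixed N the determinant of M N is alternating in the rows of M and equals det(N) at the
  -- identity.
  det-⊗ : ∀ {n} (M N : Mat ℤ n) → detℤ (M ⊗ N) ≡ detℤ M * detℤ N
  det-⊗ M N = trans (alternating-unique product-alternating M)
                    (cong (detℤ M *_) (det-ext (λ i k → sum-δˡ i (λ j → N j k))))
    where
    combine : ∀ a b x y n → (a * x + b * y) * n ≡ a * (x * n) + b * (y * n)
    combine = solve-∀
    product-alternating : Alternating (λ M → detℤ (M ⊗ N))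
    product-alternating .ext M≐M′ = det-ext (λ i k → sum-cong-≗ (λ j → cong (_* N j k) (M≐M′ i j)))
    product-alternating .linear i a b {M} {M₁} {M₂} row rest = linear det-alternating i a b
      (λ k → trans (sum-cong-≗ (λ j → trans (cong (_* N j k) (row j)) (combine a b (M₁ i j) (M₂ i j) (N j k))))
                   (sum-linear a b (λ j → M₁ i j * N j k) (λ j → M₂ i j * N j k)))
      (λ r r≢i k → sum-cong-≗ (λ j → cong (_* N j k) (proj₁ (rest r r≢i j))) ,
                   sum-cong-≗ (λ j → cong (_* N j k) (proj₂ (rest r r≢i j))))
    product-alternating .adjacent adj eq = adjacent det-alternating adj (λ k → sum-cong-≗ (λ j → cong (_* N j k) (eq j)))

  -- The adjugate, already transposed: entry (j, i) is the determinant with row i replaced by `δ j`,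
  -- which absorbs the usual sign.
  cofactor : ∀ {n} → Mat ℤ n → Mat ℤ n
  cofactor M j i = detℤ (updateAt M i (const (δ j)))

  -- Entry (k, i) of the product is the determinant with row i replaced by row k: nothing changes if
  -- k = i, and two rows coincide otherwise.
  ⊗-cofactor : ∀ {n} (M : Mat ℤ n) → M ⊗ cofactor M ≐ (λ i j → detℤ M * δ i j)
  ⊗-cofactor M k i = trans (sym expand) replaced
    where
    expand : detℤ (updateAt M i (const (M k))) ≡ sum (λ j → M k j * cofactor M j i)
    expand = linear-sum det-alternating i (M k) (λ j → updateAt M i (const (δ j))) (updateAt M i (const (M k)))
      (λ c → trans (cong (λ v → v c) (updateAt-updates i M))
               (trans (sym (sum-δʳ c (M k)))
                 (sum-cong-≗ (λ j → cong (λ v → M k j * v c) (sym (updateAt-updates i M))))))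
      (λ j r r≢i c → cong (λ v → v c) (trans (updateAt-minimal r i M r≢i) (sym (updateAt-minimal r i M r≢i))))
    replaced : detℤ (updateAt M i (const (M k))) ≡ detℤ M * δ k i
    replaced with k ≟ i
    ... | yes refl = trans (det-ext same) (sym (trans (cong (detℤ M *_) (δ-diag k)) (*-identityʳ (detℤ M))))
      where
      same : updateAt M k (const (M k)) ≐ M
      same r c with r ≟ k
      ... | yes refl = cong (λ v → v c) (updateAt-updates r M)
      ... | no r≢k   = cong (λ v → v c) (updateAt-minimal r k M r≢k)
    ... | no k≢i = trans
      (equal-rows det-alternating (updateAt M i (const (M k))) k≢i
        (λ c → cong (λ v → v c) (trans (updateAt-minimal k i M k≢i) (sym (updateAt-updates i M)))))
      (sym (trans (cong (detℤ M *_) (δ-off k≢i)) (*-zeroʳ (detℤ M))))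

  cofactor₀₀ : ∀ {n} (M : Mat ℤ (suc n)) → cofactor M zero zero ≡ detℤ (λ r c → M (suc r) (suc c))
  cofactor₀₀ {n} M = begin
    1ℤ * (1ℤ * d) + sum (λ j → summand (suc j))   ≡⟨ cong₂ _+_ (trans (*-identityˡ (1ℤ * d)) (*-identityˡ d)) (sum-zero rest) ⟩
    d + 0ℤ                                        ≡⟨ +-identityʳ d ⟩
    d                                             ∎
    where
    d = detℤ (λ r c → M (suc r) (suc c))
    summand : Fin (suc n) → ℤ
    summand j = sgn (toℕ j) * (δ zero j * detℤ (minor M j))
    rest : ∀ j → summand (suc j) ≡ 0ℤ
    rest j = trans (cong (sgn (toℕ (suc j)) *_) (*-zeroˡ (detℤ (minor M (suc j))))) (*-zeroʳ (sgn (toℕ (suc j))))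

open Determinants

-- Integer polynomials: values, degrees and monic square roots

module Polynomials where
  open import Data.Integer using (+_; _+_; _*_; -_; _^_)
  open import Data.Nat using (_<_; _≤_)

  0+0 : ∀ {x y} → x ≡ 0ℤ → y ≡ 0ℤ → x + y ≡ 0ℤ
  0+0 = cong₂ _+_

  *-0 : ∀ x {y} → y ≡ 0ℤ → x * y ≡ 0ℤ
  *-0 x refl = *-zeroʳ x

  0-* : ∀ {x} y → x ≡ 0ℤ → x * y ≡ 0ℤ
  0-* y refl = *-zeroˡ y

  -- p is a polynomial of finite degree (a sequence ℕ → ℤ need not be one) whose value at x is f x.
  data Represents : Poly → (ℤ → ℤ) → Set where
    zeroᵣ  : ∀ {p f} → (∀ k → p k ≡ 0ℤ) → (∀ x → f x ≡ 0ℤ) → Represents p f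
    horner : ∀ {p f g} → Represents (p ∘ suc) g → (∀ x → f x ≡ p 0 + x * g x) → Represents p f

  rep-ext : ∀ {p q f g} → p ≈ₚ q → (∀ x → f x ≡ g x) → Represents p f → Represents q g
  rep-ext p≈q f≗g (zeroᵣ p≈0 f≗0) = zeroᵣ (λ k → trans (sym (p≈q k)) (p≈0 k)) (λ x → trans (sym (f≗g x)) (f≗0 x))
  rep-ext p≈q f≗g (horner {g = h} r eq) = horner (rep-ext (p≈q ∘ suc) (λ _ → refl) r)
    (λ x → trans (sym (f≗g x)) (trans (eq x) (cong (_+ x * h x) (p≈q 0))))

  rep-+ : ∀ {p q f g} → Represents p f → Represents q g → Represents (p +ₚ q) (λ x → f x + g x)
  rep-+ {p} {q} {f} {g} (zeroᵣ p≈0 f≗0) s =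
    rep-ext (λ k → sym (trans (cong (_+ q k) (p≈0 k)) (+-identityˡ (q k))))
            (λ x → sym (trans (cong (_+ g x) (f≗0 x)) (+-identityˡ (g x)))) s
  rep-+ {p} {q} {f} {g} r@(horner _ _) (zeroᵣ q≈0 g≗0) =
    rep-ext (λ k → sym (trans (cong (λ y → p k + y) (q≈0 k)) (+-identityʳ (p k))))
            (λ x → sym (trans (cong (λ y → f x + y) (g≗0 x)) (+-identityʳ (f x)))) r
  rep-+ {p} {q} (horner {g = f′} r eq) (horner {g = g′} s eq′) =
    horner (rep-+ r s) (λ x → trans (cong₂ _+_ (eq x) (eq′ x)) (regroup (p 0) (q 0) x (f′ x) (g′ x)))
    where
    regroup : ∀ a b x u v → a + x * u + (b + x * v) ≡ a + b + x * (u + v)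
    regroup = solve-∀

  scale : ℤ → Poly → Poly
  scale c p k = c * p k

  rep-scale : ∀ c {p f} → Represents p f → Represents (scale c p) (λ x → c * f x)
  rep-scale c (zeroᵣ p≈0 f≗0) = zeroᵣ (*-0 c ∘ p≈0) (*-0 c ∘ f≗0)
  rep-scale c {p} (horner {g = g} r eq) =
    horner (rep-scale c r) (λ x → trans (cong (c *_) (eq x)) (regroup c (p 0) x (g x)))
    where
    regroup : ∀ c a x u → c * (a + x * u) ≡ c * a + x * (c * u)
    regroup = solve-∀

  rep-neg : ∀ {p f} → Represents p f → Represents (negP p) (λ x → - f x)
  rep-neg {p} {f} r = rep-ext (λ k → -1*i≡-i (p k)) (λ x → -1*i≡-i (f x)) (rep-scale (- 1ℤ) r)

  rep-- : ∀ {p q f g} → Represents p f → Represents q g → Represents (p -ₚ q) (λ x → f x + - g x)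
  rep-- r s = rep-+ r (rep-neg s)

  rep-const : ∀ c → Represents (constP c) (λ _ → c)
  rep-const c = horner {g = λ _ → 0ℤ} (zeroᵣ (λ _ → refl) (λ _ → refl))
    (λ x → sym (trans (cong (λ y → c + y) (*-zeroʳ x)) (+-identityʳ c)))

  rep-x : Represents xP (λ x → x)
  rep-x = horner {g = λ _ → 1ℤ} (rep-ext (λ { zero → refl ; (suc k) → refl }) (λ _ → refl) (rep-const 1ℤ))
    (λ x → sym (trans (+-identityˡ (x * 1ℤ)) (*-identityʳ x)))

  -- The product in Horner form, p q = p₀ q + x p′ q. As `conv` runs down from the top index of p,
  -- its last term has to be brought to the front.
  *ₚ-suc : ∀ p q k → (p *ₚ q) (suc k) ≡ p 0 * q (suc k) + ((p ∘ suc) *ₚ q) k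
  *ₚ-suc p q k = conv-suc k
    where
    shuffle : ∀ x y z → x + (y + z) ≡ y + (x + z)
    shuffle = solve-∀
    conv-suc : ∀ m → conv p q (suc k) (suc m) ≡ p 0 * q (suc k) + conv (p ∘ suc) q k m
    conv-suc zero = +-comm (p 1 * q k) (p 0 * q (suc k))
    conv-suc (suc m) = trans (cong (λ y → p (suc (suc m)) * q (k ℕ.∸ suc m) + y) (conv-suc m))
      (shuffle (p (suc (suc m)) * q (k ℕ.∸ suc m)) (p 0 * q (suc k)) (conv (p ∘ suc) q k m))

  *ₚ-zeroˡ : ∀ {p} q → (∀ k → p k ≡ 0ℤ) → ∀ k → (p *ₚ q) k ≡ 0ℤ
  *ₚ-zeroˡ q p≈0 zero = 0-* (q 0) (p≈0 0)
  *ₚ-zeroˡ {p} q p≈0 (suc k) = trans (*ₚ-suc p q k) (0+0 (0-* (q (suc k)) (p≈0 0)) (*ₚ-zeroˡ q (p≈0 ∘ suc) k))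

  shift : Poly → Poly
  shift p zero    = 0ℤ
  shift p (suc k) = p k

  rep-* : ∀ {p q f g} → Represents p f → Represents q g → Represents (p *ₚ q) (λ x → f x * g x)
  rep-* {q = q} {g = g} (zeroᵣ p≈0 f≗0) s = zeroᵣ (*ₚ-zeroˡ q p≈0) (λ x → 0-* (g x) (f≗0 x))
  rep-* {p} {q} {f} {g} (horner {g = h} r eq) s =
    rep-ext (λ { zero → +-identityʳ (p 0 * q 0) ; (suc k) → sym (*ₚ-suc p q k) })
      (λ x → trans (regroup (p 0) x (h x) (g x)) (cong (_* g x) (sym (eq x))))
      (rep-+ (rep-scale (p 0) s) (rep-shift (rep-* r s)))
    where
    rep-shift : ∀ {p f} → Represents p f → Represents (shift p) (λ x → x * f x)
    rep-shift {f = f} r = horner r (λ x → sym (+-identityˡ (x * f x)))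
    regroup : ∀ a x u v → a * v + x * (u * v) ≡ (a + x * u) * v
    regroup = solve-∀

  rep-^ : ∀ {p f} n → Represents p f → Represents (p ^ₚ n) (λ x → f x ^ n)
  rep-^ zero    r = rep-const 1ℤ
  rep-^ (suc n) r = rep-* r (rep-^ n r)

  rep-signP : ∀ k {p f} → Represents p f → Represents (signP k p) (λ x → sgn k * f x)
  rep-signP zero    {f = f} r = rep-ext (λ _ → refl) (λ x → sym (*-identityˡ (f x))) r
  rep-signP (suc k) {f = f} r = rep-ext (λ _ → refl) (λ x → neg-distribˡ-* (sgn k) (f x)) (rep-neg (rep-signP k r))

  rep-ΣF : ∀ {n} {p : Fin n → Poly} {f : Fin n → ℤ → ℤ} → (∀ j → Represents (p j) (f j)) →
           Represents (ΣF (constP 0ℤ) _+ₚ_ p) (λ x → sum (λ j → f j x))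
  rep-ΣF {zero}  r = rep-const 0ℤ
  rep-ΣF {suc n} r = rep-+ (r zero) (rep-ΣF (r ∘ suc))

  rep-det : ∀ {n} {M : Mat Poly n} {f : Fin n → Fin n → ℤ → ℤ} → (∀ i j → Represents (M i j) (f i j)) →
            Represents (det M) (λ x → detℤ (λ i j → f i j x))
  rep-det {zero}  r = rep-const 1ℤ
  rep-det {suc n} r =
    rep-ΣF (λ j → rep-signP (toℕ j) (rep-* (r zero j) (rep-det (λ i c → r (suc i) (punchIn j c)))))

  charPoly-entry : ∀ {n} → Mat ℤ n → Mat Poly n
  charPoly-entry M i j = (if i == j then xP else constP 0ℤ) -ₚ constP (M i j)

  rep-charPoly : ∀ {n} (M : Mat ℤ n) → Represents (charPoly M) (λ x → detℤ (λ i j → x * δ i j + - M i j))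
  rep-charPoly M = rep-det {f = λ i j x → x * δ i j + - M i j} (λ i j → rep-- (diagonal i j) (rep-const (M i j)))
    where
    diagonal : ∀ i j → Represents (if i == j then xP else constP 0ℤ) (λ x → x * δ i j)
    diagonal i j with if-== i j xP (constP 0ℤ)
    ... | inj₁ (refl , eq) = rep-ext (λ k → cong (λ p → p k) (sym eq))
                               (λ x → sym (trans (cong (x *_) (δ-diag i)) (*-identityʳ x))) rep-x
    ... | inj₂ (i≢j , eq)  = rep-ext (λ k → cong (λ p → p k) (sym eq)) (λ x → sym (*-0 x (δ-off i≢j))) (rep-const 0ℤ)

  rep-zero-values : ∀ {p f} → Represents p f → (∀ k → p k ≡ 0ℤ) → ∀ x → f x ≡ 0ℤ
  rep-zero-values (zeroᵣ _ f≗0)  p≈0 x = f≗0 x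
  rep-zero-values (horner r eq) p≈0 x = trans (eq x) (0+0 (p≈0 0) (*-0 x (rep-zero-values r (p≈0 ∘ suc) x)))

  -- The constant term is divisible by every positive integer, in particular by one exceeding its absolute value.
  rep-zero-coefficients : ∀ {p f} → Represents p f → (∀ n → f (+ suc n) ≡ 0ℤ) → ∀ k → p k ≡ 0ℤ
  rep-zero-coefficients (zeroᵣ p≈0 _) f≗0 k = p≈0 k
  rep-zero-coefficients {p} (horner {g = g} r eq) f≗0 = λ { zero → p₀≡0 ; (suc k) → rep-zero-coefficients r g≗0 k }
    where
    value : ∀ n → p 0 ≡ - (+ suc n * g (+ suc n))
    value n = inverseˡ-unique (p 0) (+ suc n * g (+ suc n)) (trans (sym (eq (+ suc n))) (f≗0 n))
    too-divisible : ∀ m k → m ≡ suc m ℕ.* k → m ≡ 0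
    too-divisible m zero    e = trans e (ℕ.*-zeroʳ m)
    too-divisible m (suc k) e = contradiction (subst (suc m ≤_) (sym e) (ℕ.m≤m*n (suc m) (suc k))) ℕ.1+n≰n
    p₀≡0 : p 0 ≡ 0ℤ
    p₀≡0 = ∣i∣≡0⇒i≡0 (too-divisible ∣ p 0 ∣ ∣ g x ∣
      (trans (cong ∣_∣ (value ∣ p 0 ∣)) (trans (∣-i∣≡∣i∣ (x * g x)) (abs-* x (g x)))))
      where
      x = + suc ∣ p 0 ∣
    g≗0 : ∀ n → g (+ suc n) ≡ 0ℤ
    g≗0 n with i*j≡0⇒i≡0∨j≡0 (+ suc n) {g (+ suc n)} (trans (sym (neg-involutive (+ suc n * g (+ suc n)))) (cong -_ (trans (sym (value n)) p₀≡0)))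
    ... | inj₂ e = e

  rep-unique : ∀ {p q f g} → Represents p f → Represents q g → (∀ n → f (+ suc n) ≡ g (+ suc n)) → p ≈ₚ q
  rep-unique {p} {q} r s f≗g k = i-j≡0⇒i≡j (p k) (q k) (rep-zero-coefficients (rep-- r s) (λ n → i≡j⇒i-j≡0 (f≗g n)) k)

  rep-values : ∀ {p q f g} → Represents p f → Represents q g → p ≈ₚ q → ∀ x → f x ≡ g x
  rep-values {f = f} {g} r s p≈q x = i-j≡0⇒i≡j (f x) (g x) (rep-zero-values (rep-- r s) (λ k → i≡j⇒i-j≡0 (p≈q k)) x)

  DegreeAtMost : ℕ → Poly → Set
  DegreeAtMost n p = ∀ k → n < k → p k ≡ 0ℤ

  Monic : ℕ → Poly → Set
  Monic n p = p n ≡ 1ℤ × DegreeAtMost n p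

  -- Recovers the order of a tournament matrix from its characteristic polynomial.
  monic-degree : ∀ {m n p} → Monic m p → Monic n p → m ≡ n
  monic-degree {m} {n} (lead , bound) (lead′ , bound′) with ℕ.<-cmp m n
  ... | tri< m<n _ _ = contradiction (trans (sym lead′) (bound n m<n)) λ ()
  ... | tri≈ _ m≡n _ = m≡n
  ... | tri> _ _ n<m = contradiction (trans (sym lead) (bound′ m n<m)) λ ()

  *ₚ-degree : ∀ {m n} p q → DegreeAtMost m p → DegreeAtMost n q →
              (p *ₚ q) (m ℕ.+ n) ≡ p m * q n × DegreeAtMost (m ℕ.+ n) (p *ₚ q)
  *ₚ-degree {zero} {n} p q bp bq = constant n , λ k n<k → trans (constant k) (*-0 (p 0) (bq k n<k))
    where
    constant : ∀ k → (p *ₚ q) k ≡ p 0 * q k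
    constant zero    = refl
    constant (suc k) = trans (*ₚ-suc p q k)
      (trans (cong (λ y → p 0 * q (suc k) + y) (*ₚ-zeroˡ q (λ k → bp (suc k) (s≤s z≤n)) k)) (+-identityʳ (p 0 * q (suc k))))
  *ₚ-degree {suc m} {n} p q bp bq = top , bound
    where
    rest : ((p ∘ suc) *ₚ q) (m ℕ.+ n) ≡ p (suc m) * q n × DegreeAtMost (m ℕ.+ n) ((p ∘ suc) *ₚ q)
    rest = *ₚ-degree (p ∘ suc) q (λ k m<k → bp (suc k) (s≤s m<k)) bq
    top : (p *ₚ q) (suc (m ℕ.+ n)) ≡ p (suc m) * q n
    top = trans (*ₚ-suc p q (m ℕ.+ n))
      (trans (cong₂ _+_ (*-0 (p 0) (bq (suc (m ℕ.+ n)) (s≤s (ℕ.m≤n+m n m)))) (proj₁ rest)) (+-identityˡ (p (suc m) * q n)))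
    bound : DegreeAtMost (suc (m ℕ.+ n)) (p *ₚ q)
    bound (suc k) (s≤s lt) = trans (*ₚ-suc p q k)
      (0+0 (*-0 (p 0) (bq (suc k) (ℕ.m≤n⇒m≤1+n (ℕ.≤-trans (s≤s (ℕ.m≤n+m n m)) lt)))) (proj₂ rest k lt))

  monic-* : ∀ {m n p q} → Monic m p → Monic n q → Monic (m ℕ.+ n) (p *ₚ q)
  monic-* {p = p} {q} (lp , bp) (lq , bq) with *ₚ-degree p q bp bq
  ... | top , bound = trans top (cong₂ _*_ lp lq) , bound

  monic-^ : ∀ {d p} n → Monic d p → Monic (n ℕ.* d) (p ^ₚ n)
  monic-^ zero    m = refl , λ { (suc k) _ → refl }
  monic-^ (suc n) m = monic-* m (monic-^ n m)

  monic-+ : ∀ {m n p q} → Monic m p → DegreeAtMost n q → n < m → Monic m (p +ₚ q)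
  monic-+ {m} (lp , bp) bq n<m =
    cong₂ _+_ lp (bq m n<m) , λ k m<k → 0+0 (bp k m<k) (bq k (ℕ.<-trans n<m m<k))

  degree-weaken : ∀ {m n p} → m ≤ n → DegreeAtMost m p → DegreeAtMost n p
  degree-weaken m≤n b k n<k = b k (ℕ.≤-<-trans m≤n n<k)

  degree-neg : ∀ {n p} → DegreeAtMost n p → DegreeAtMost n (negP p)
  degree-neg b k n<k = cong -_ (b k n<k)

  degree-const : ∀ c → DegreeAtMost 0 (constP c)
  degree-const c (suc k) _ = refl

  monic-x : Monic 1 xP
  monic-x = refl , λ { (suc zero) (s≤s ()) ; (suc (suc k)) _ → refl }

  degree-signP : ∀ {n p} k → DegreeAtMost n p → DegreeAtMost n (signP k p)
  degree-signP zero    b = b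
  degree-signP (suc k) b = degree-neg (degree-signP k b)

  degree-ΣF : ∀ {d n} {p : Fin n → Poly} → (∀ j → DegreeAtMost d (p j)) → DegreeAtMost d (ΣF (constP 0ℤ) _+ₚ_ p)
  degree-ΣF {n = zero}  b zero    ()
  degree-ΣF {n = zero}  b (suc k) _  = refl
  degree-ΣF {n = suc n} b k d<k = 0+0 (b zero k d<k) (degree-ΣF (b ∘ suc) k d<k)

  degree-det : ∀ {n} {M : Mat Poly n} → (∀ i j → DegreeAtMost 1 (M i j)) → DegreeAtMost n (det M)
  degree-det {zero}  b = degree-const 1ℤ
  degree-det {suc n} {M} b = degree-ΣF (λ j → degree-signP (toℕ j)
    (proj₂ (*ₚ-degree (M zero j) (det (λ r c → M (suc r) (punchIn j c))) (b zero j) (degree-det (λ r c → b (suc r) (punchIn j c))))))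

  -- Only the corner term of the first-row expansion reaches the full degree: every other term is a
  -- constant entry times a minor with n rows of entries of degree at most one.
  monic-det : ∀ {n} {M : Mat Poly n} → (∀ i j → i ≡ j × Monic 1 (M i j) ⊎ i ≢ j × DegreeAtMost 0 (M i j)) → Monic n (det M)
  monic-det {zero}  entries = refl , degree-const 1ℤ
  monic-det {suc n} {M} entries = monic-+ leading (degree-ΣF others) (ℕ.n<1+n n)
    where
    degree-one : ∀ i j → DegreeAtMost 1 (M i j)
    degree-one i j with entries i j
    ... | inj₁ (_ , m) = proj₂ m
    ... | inj₂ (_ , b) = degree-weaken z≤n b
    leading : Monic (suc n) (M zero zero *ₚ det (λ r c → M (suc r) (suc c)))
    leading with entries zero zero
    ... | inj₁ (_ , m) = monic-* m (monic-det lower)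
      where
      lower : ∀ i j → i ≡ j × Monic 1 (M (suc i) (suc j)) ⊎ i ≢ j × DegreeAtMost 0 (M (suc i) (suc j))
      lower i j with entries (suc i) (suc j)
      ... | inj₁ (refl , m) = inj₁ (refl , m)
      ... | inj₂ (ne , b)   = inj₂ ((λ e → ne (cong suc e)) , b)
    ... | inj₂ (ne , _) = contradiction refl ne
    others : ∀ j → DegreeAtMost n (signP (toℕ (suc j)) (M zero (suc j) *ₚ det (λ r c → M (suc r) (punchIn (suc j) c))))
    others j with entries zero (suc j)
    ... | inj₂ (_ , b) = degree-signP (toℕ (suc j))
      (proj₂ (*ₚ-degree (M zero (suc j)) (det (λ r c → M (suc r) (punchIn (suc j) c))) b
        (degree-det (λ r c → degree-one (suc r) (punchIn (suc j) c)))))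

  monic-charPoly : ∀ {n} (M : Mat ℤ n) → Monic n (charPoly M)
  monic-charPoly M = monic-det entry
    where
    entry : ∀ i j → i ≡ j × Monic 1 (charPoly-entry M i j) ⊎ i ≢ j × DegreeAtMost 0 (charPoly-entry M i j)
    entry i j with if-== i j xP (constP 0ℤ)
    ... | inj₁ (i≡j , eq) rewrite eq = inj₁ (i≡j , monic-+ monic-x (degree-neg (degree-const (M i j))) (s≤s z≤n))
    ... | inj₂ (i≢j , eq) rewrite eq = inj₂ (i≢j , λ { (suc k) _ → refl })

  -- The top coefficient of the product is that of p times `q n`, so the degree bound of p can be
  -- lowered step by step until nothing is left.
  *ₚ-cancelʳ : ∀ {n} m p q → DegreeAtMost m p → DegreeAtMost n q → q n ≢ 0ℤ → (∀ k → (p *ₚ q) k ≡ 0ℤ) → ∀ k → p k ≡ 0ℤ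
  *ₚ-cancelʳ {n} m p q bp bq qₙ≢0 pq≈0 = all m bp
    where
    top : ∀ m → DegreeAtMost m p → p m ≡ 0ℤ
    top m b with i*j≡0⇒i≡0∨j≡0 (p m) {q n} (trans (sym (proj₁ (*ₚ-degree p q b bq))) (pq≈0 (m ℕ.+ n)))
    ... | inj₁ e = e
    ... | inj₂ e = contradiction e qₙ≢0
    all : ∀ m → DegreeAtMost m p → ∀ k → p k ≡ 0ℤ
    all zero    b zero    = top 0 b
    all zero    b (suc k) = b (suc k) (s≤s z≤n)
    all (suc m) b = all m λ k m<k → step k (ℕ.m≤n⇒m<n∨m≡n m<k)
      where
      step : ∀ k → suc m < k ⊎ suc m ≡ k → p k ≡ 0ℤ
      step k (inj₁ lt)   = b k lt
      step k (inj₂ refl) = top (suc m) b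

  -- (p - q)(p + q) vanishes, and p + q can be cancelled because its leading coefficient is 2.
  monic-square-unique : ∀ {n p q f g} → Monic n p → Monic n q → Represents p f → Represents q g →
                        (∀ x → f x * f x ≡ g x * g x) → p ≈ₚ q
  monic-square-unique {n} {p} {q} {f} {g} (lp , bp) (lq , bq) r s squares k = i-j≡0⇒i≡j (p k) (q k)
    (*ₚ-cancelʳ n (p -ₚ q) (p +ₚ q) (λ k n<k → 0+0 (bp k n<k) (degree-neg bq k n<k)) (λ k n<k → 0+0 (bp k n<k) (bq k n<k))
      (λ e → contradiction (trans (sym (cong₂ _+_ lp lq)) e) λ ())
      (rep-zero-coefficients (rep-* (rep-- r s) (rep-+ r s))
        (λ m → trans (difference (f (+ suc m)) (g (+ suc m))) (i≡j⇒i-j≡0 (squares (+ suc m))))) k)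
    where
    difference : ∀ x y → (x + - y) * (x + y) ≡ x * x + - (y * y)
    difference = solve-∀

open Polynomials

-- Matrix products, linear matrix polynomials and two determinant formulas

module Matrices where
  open import Data.Integer using (_+_; _*_; -_; _^_)
  open ≡-Reasoning

  ⊗-cong : ∀ {n m p} {M M′ : Rows n m} {N N′ : Rows m p} → M ≐ M′ → N ≐ N′ → M ⊗ N ≐ M′ ⊗ N′
  ⊗-cong M≐ N≐ i k = sum-cong-≗ (λ j → cong₂ _*_ (M≐ i j) (N≐ j k))

  ⊗-assoc : ∀ {n m p q} (M : Rows n m) (N : Rows m p) (P : Rows p q) → (M ⊗ N) ⊗ P ≐ M ⊗ (N ⊗ P)
  ⊗-assoc M N P i l = begin
    sum (λ k → sum (λ j → M i j * N j k) * P k l)     ≡⟨ sum-cong-≗ (λ k → *-distribʳ-sum (P k l) (λ j → M i j * N j k)) ⟩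
    sum (λ k → sum (λ j → M i j * N j k * P k l))     ≡⟨ ∑-comm (λ k j → M i j * N j k * P k l) ⟩
    sum (λ j → sum (λ k → M i j * N j k * P k l))     ≡⟨ sum-cong-≗ (λ j → trans (sum-cong-≗ (λ k → *-assoc (M i j) (N j k) (P k l)))
                                                                                (sym (*-distribˡ-sum (M i j) (λ k → N j k * P k l)))) ⟩
    sum (λ j → M i j * sum (λ k → N j k * P k l))     ∎

  ⊗-linearˡ : ∀ {n m p} a b (M M′ : Rows n m) (N : Rows m p) i k →
              ((λ i j → a * M i j + b * M′ i j) ⊗ N) i k ≡ a * (M ⊗ N) i k + b * (M′ ⊗ N) i k
  ⊗-linearˡ a b M M′ N i k = trans (sum-cong-≗ (λ j → distrib a b (M i j) (M′ i j) (N j k)))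
                                   (sum-linear a b (λ j → M i j * N j k) (λ j → M′ i j * N j k))
    where
    distrib : ∀ a b x y n → (a * x + b * y) * n ≡ a * (x * n) + b * (y * n)
    distrib = solve-∀

  ⊗-linearʳ : ∀ {n m p} a b (M : Rows n m) (N N′ : Rows m p) i k →
              (M ⊗ (λ j k → a * N j k + b * N′ j k)) i k ≡ a * (M ⊗ N) i k + b * (M ⊗ N′) i k
  ⊗-linearʳ a b M N N′ i k = trans (sum-cong-≗ (λ j → distrib a b (N j k) (N′ j k) (M i j)))
                                   (sum-linear a b (λ j → M i j * N j k) (λ j → M i j * N′ j k))
    where
    distrib : ∀ a b x y m → m * (a * x + b * y) ≡ a * (m * x) + b * (m * y)
    distrib = solve-∀

  infix 6 _•1+_•_
  -- The matrix a I + b M. The shifts yI ± S, the product ζI + 2K and the factor that inverts it up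
  -- to a scalar all have this shape.
  _•1+_•_ : ∀ {n} → ℤ → ℤ → Mat ℤ n → Mat ℤ n
  (a •1+ b • M) i j = a * δ i j + b * M i j

  •1+-⊗ : ∀ {n} a b (M N : Mat ℤ n) i k → ((a •1+ b • M) ⊗ N) i k ≡ a * N i k + b * (M ⊗ N) i k
  •1+-⊗ a b M N i k = trans (⊗-linearˡ a b δ M N i k) (cong (λ x → a * x + b * (M ⊗ N) i k) (sum-δˡ i (λ j → N j k)))

  ⊗-•1+ : ∀ {n} a b (M N : Mat ℤ n) i k → (M ⊗ (a •1+ b • N)) i k ≡ a * M i k + b * (M ⊗ N) i k
  ⊗-•1+ a b M N i k = trans (⊗-linearʳ a b M δ N i k) (cong (λ x → a * x + b * (M ⊗ N) i k) (sum-δʳ k (M i)))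

  •1+-⊗-•1+ : ∀ {n} a b c d (M N : Mat ℤ n) i k →
    ((a •1+ b • M) ⊗ (c •1+ d • N)) i k ≡ a * c * δ i k + a * d * N i k + b * c * M i k + b * d * (M ⊗ N) i k
  •1+-⊗-•1+ a b c d M N i k = begin
    ((a •1+ b • M) ⊗ (c •1+ d • N)) i k
      ≡⟨ •1+-⊗ a b M (c •1+ d • N) i k ⟩
    a * (c * δ i k + d * N i k) + b * (M ⊗ (c •1+ d • N)) i k
      ≡⟨ cong (λ x → a * (c * δ i k + d * N i k) + b * x) (⊗-•1+ c d M N i k) ⟩
    a * (c * δ i k + d * N i k) + b * (c * M i k + d * (M ⊗ N) i k)
      ≡⟨ expand a b c d (δ i k) (N i k) (M i k) ((M ⊗ N) i k) ⟩
    a * c * δ i k + a * d * N i k + b * c * M i k + b * d * (M ⊗ N) i k ∎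
    where
    expand : ∀ a b c d e x y z → a * (c * e + d * x) + b * (c * y + d * z) ≡ a * c * e + a * d * x + b * c * y + b * d * z
    expand = solve-∀

  det-scale : ∀ {n} c (M : Mat ℤ n) → detℤ (λ i j → c * M i j) ≡ c ^ n * detℤ M
  det-scale {n} c M = begin
    detℤ (λ i j → c * M i j)              ≡⟨ det-ext scaled ⟨
    detℤ ((λ i j → c * δ i j) ⊗ M)        ≡⟨ det-⊗ (λ i j → c * δ i j) M ⟩
    detℤ {n} (λ i j → c * δ i j) * detℤ M ≡⟨ cong (_* detℤ M) (det-scalar n c) ⟩
    c ^ n * detℤ M                        ∎
    where
    scaled : (λ i j → c * δ i j) ⊗ M ≐ (λ i j → c * M i j)
    scaled i k = begin
      sum (λ j → c * δ i j * M j k)      ≡⟨ sum-cong-≗ (λ j → *-assoc c (δ i j) (M j k)) ⟩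
      sum (λ j → c * (δ i j * M j k))    ≡⟨ *-distribˡ-sum c (λ j → δ i j * M j k) ⟨
      c * sum (λ j → δ i j * M j k)      ≡⟨ cong (c *_) (sum-δˡ i (λ j → M j k)) ⟩
      c * M i k                          ∎

  dot : ∀ {n} → (Fin n → ℤ) → (Fin n → ℤ) → ℤ
  dot u v = sum (λ i → u i * v i)

  outer : ∀ {n} → (Fin n → ℤ) → (Fin n → ℤ) → Mat ℤ n
  outer u v i j = u i * v j

  outer-⊗-outer : ∀ {n} (u v w x : Fin n → ℤ) i k → (outer u v ⊗ outer w x) i k ≡ dot v w * outer u x i k
  outer-⊗-outer u v w x i k = begin
    sum (λ j → u i * v j * (w j * x k))      ≡⟨ sum-cong-≗ (λ j → regroup (u i) (v j) (w j) (x k)) ⟩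
    sum (λ j → v j * w j * (u i * x k))      ≡⟨ *-distribʳ-sum (u i * x k) (λ j → v j * w j) ⟨
    dot v w * outer u x i k                  ∎
    where
    regroup : ∀ a b c d → a * b * (c * d) ≡ b * c * (a * d)
    regroup = solve-∀

  bordered : ∀ {n} → ℤ → (Fin n → ℤ) → (Fin n → ℤ) → Mat ℤ n → Mat ℤ (suc n)
  bordered a r c M zero    zero    = a
  bordered a r c M zero    (suc j) = r j
  bordered a r c M (suc i) zero    = c i
  bordered a r c M (suc i) (suc j) = M i j

  det-lower-block : ∀ {n} (M : Mat ℤ (suc n)) → (∀ j → M zero (suc j) ≡ 0ℤ) →
                    detℤ M ≡ M zero zero * detℤ (λ r c → M (suc r) (suc c))
  det-lower-block M row = trans (sym (det-transpose M))
    (trans (det-block (transpose M) row) (cong (M zero zero *_) (det-transpose (λ r c → M (suc r) (suc c)))))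

  -- Both sides are determinants of products with  [[1, -cw], [u, zI]].
  rank-one-det : ∀ {n} z c (u w : Fin n → ℤ) →
                 z * detℤ (z •1+ c • outer u w) ≡ z ^ n * (z + c * dot w u)
  rank-one-det {n} z c u w = begin
    z * detℤ (z •1+ c • outer u w)          ≡⟨ *-comm z (detℤ (z •1+ c • outer u w)) ⟩
    detℤ (z •1+ c • outer u w) * z          ≡⟨ cong (_* z) (trans (sym (*-identityˡ (detℤ (z •1+ c • outer u w)))) (sym (det-block P (λ _ → refl)))) ⟩
    detℤ P * z                              ≡⟨ cong (_* z) (trans (sym (det-ext L⊗B)) (trans (det-⊗ L B) (trans (cong (_* detℤ B) det-L) (*-identityˡ (detℤ B))))) ⟩
    detℤ B * z                              ≡⟨ cong (detℤ B *_) det-R ⟨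
    detℤ B * detℤ R                         ≡⟨ det-⊗ B R ⟨
    detℤ (B ⊗ R)                            ≡⟨ det-ext B⊗R ⟩
    detℤ Q                                  ≡⟨ det-block Q (λ _ → refl) ⟩
    (z + c * dot w u) * detℤ {n} (λ i j → z * δ i j) ≡⟨ cong ((z + c * dot w u) *_) (det-scalar n z) ⟩
    (z + c * dot w u) * z ^ n               ≡⟨ *-comm (z + c * dot w u) (z ^ n) ⟩
    z ^ n * (z + c * dot w u)               ∎
    where
    zI : Mat ℤ n
    zI i j = z * δ i j
    B L R P Q : Mat ℤ (suc n)
    B = bordered 1ℤ (λ j → - (c * w j)) u zI
    L = bordered 1ℤ (λ _ → 0ℤ) (λ i → - u i) δ
    R = bordered z (λ _ → 0ℤ) (λ i → - u i) δ
    P = bordered 1ℤ (λ j → - (c * w j)) (λ _ → 0ℤ) (z •1+ c • outer u w)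
    Q = bordered (z + c * dot w u) (λ j → - (c * w j)) (λ _ → 0ℤ) zI
    det-L : detℤ L ≡ 1ℤ
    det-L = trans (det-lower-block L (λ _ → refl)) (trans (*-identityˡ (detℤ {n} δ)) (det-δ n))
    det-R : detℤ R ≡ z
    det-R = trans (det-lower-block R (λ _ → refl)) (trans (cong (z *_) (det-δ n)) (*-identityʳ z))
    first-only : ∀ x (f : Fin n → ℤ) → x + sum (λ j → 0ℤ * f j) ≡ x
    first-only x f = trans (cong (x +_) (sum-zero (λ j → *-zeroˡ (f j)))) (+-identityʳ x)
    L⊗B : L ⊗ B ≐ P
    L⊗B zero zero = first-only (1ℤ * 1ℤ) u
    L⊗B zero (suc k) = trans (first-only (1ℤ * - (c * w k)) (λ j → z * δ j k)) (*-identityˡ (- (c * w k)))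
    L⊗B (suc i) zero = trans (cong (- u i * 1ℤ +_) (sum-δˡ i u)) (cancel (u i))
      where
      cancel : ∀ x → - x * 1ℤ + x ≡ 0ℤ
      cancel = solve-∀
    L⊗B (suc i) (suc k) = trans (cong (- u i * - (c * w k) +_) (sum-δˡ i (λ j → z * δ j k))) (combine (u i) c (w k) (z * δ i k))
      where
      combine : ∀ x c y d → - x * - (c * y) + d ≡ d + c * (x * y)
      combine = solve-∀
    B⊗R : B ⊗ R ≐ Q
    B⊗R zero zero = cong₂ _+_ (*-identityˡ z)
      (trans (sum-cong-≗ (λ j → sign c (w j) (u j))) (sym (*-distribˡ-sum c (λ j → w j * u j))))
      where
      sign : ∀ c x y → - (c * x) * - y ≡ c * (x * y)
      sign = solve-∀
    B⊗R zero (suc k) = trans (cong (1ℤ * 0ℤ +_) (sum-δʳ k (λ j → - (c * w j)))) (+-identityˡ (- (c * w k)))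
    B⊗R (suc i) zero = trans (cong (u i * z +_) (trans (sum-cong-≗ (λ j → *-assoc z (δ i j) (- u j)))
        (trans (sym (*-distribˡ-sum z (λ j → δ i j * - u j))) (cong (z *_) (sum-δˡ i (λ j → - u j))))))
        (cancel (u i) z)
      where
      cancel : ∀ x z → x * z + z * - x ≡ 0ℤ
      cancel = solve-∀
    B⊗R (suc i) (suc k) = trans (cong (_+ sum (λ j → z * δ i j * δ j k)) (*-zeroʳ (u i)))
      (trans (+-identityˡ _) (sum-δʳ k (λ j → z * δ i j)))

  -- Adding the row (1, 1, …, 1) to row 0 leaves (1+y, 0, …, 0); subtracting it from the others clears column 0.
  det-minus-J : ∀ {n} y (M : Mat ℤ n) →
    detℤ (λ i j → M i j + - 1ℤ) ≡ (1ℤ + y) * detℤ M + - detℤ (bordered y (λ _ → - 1ℤ) (λ _ → 1ℤ) M)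
  det-minus-J {n} y M = begin
    detℤ M-J                                             ≡⟨ *-identityˡ (detℤ M-J) ⟨
    1ℤ * detℤ M-J                                        ≡⟨ det-block (ones ∷ tail P) (λ _ → refl) ⟨
    detℤ (ones ∷ tail P)                                 ≡⟨ add-multiples (fix-row det-alternating ones) ones
                                                              (λ N i eq → equal-rows det-alternating (ones ∷ N) {zero} {suc i} (λ ()) (λ c → sym (eq c)))
                                                              (λ _ → 1ℤ) (tail B) (tail P) (λ { r zero → refl ; r (suc c) → sym (restore (M r c)) }) ⟨
    detℤ (ones ∷ tail B)                                 ≡⟨ Alternating.linear det-alternating zero (1ℤ + y) (- 1ℤ)
                                                              {ones ∷ tail B} {updateAt B zero (const (δ zero))} {B}
                                                              (λ { zero → sym (head-entry y) ; (suc c) → sym (cong (_+ 1ℤ) (*-zeroʳ (1ℤ + y))) })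
                                                              (λ { zero ne → contradiction refl ne ; (suc r) _ c → refl , refl }) ⟩
    (1ℤ + y) * cofactor B zero zero + - 1ℤ * detℤ B      ≡⟨ cong₂ (λ d e → (1ℤ + y) * d + e) (cofactor₀₀ B) (-1*i≡-i (detℤ B)) ⟩
    (1ℤ + y) * detℤ M + - detℤ B                         ∎
    where
    M-J : Mat ℤ n
    M-J i j = M i j + - 1ℤ
    B P : Mat ℤ (suc n)
    B = bordered y (λ _ → - 1ℤ) (λ _ → 1ℤ) M
    P = bordered 0ℤ (λ _ → 0ℤ) (λ _ → 0ℤ) M-J
    ones : Fin (suc n) → ℤ
    ones _ = 1ℤ
    restore : ∀ x → 1ℤ * 1ℤ + (x + - 1ℤ) ≡ x
    restore = solve-∀
    head-entry : ∀ y → (1ℤ + y) * 1ℤ + - 1ℤ * y ≡ 1ℤ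
    head-entry = solve-∀

  Skew : ∀ {n} → Mat ℤ n → Set
  Skew S = ∀ i j → S j i ≡ - S i j

  charVal : ∀ {n} → Mat ℤ n → ℤ → ℤ
  charVal M x = detℤ (λ i j → x * δ i j + - M i j)

  -- For skew S the matrix yI + S is the transpose of yI - S.
  charVal-skew : ∀ {n} {S : Mat ℤ n} → Skew S → ∀ y → detℤ (y •1+ 1ℤ • S) ≡ charVal S y
  charVal-skew {S = S} skew y = trans (sym (det-transpose (y •1+ 1ℤ • S))) (det-ext (λ i j →
    cong₂ (λ d s → y * d + s) (δ-sym j i) (trans (*-identityˡ (S j i)) (skew i j))))

  charVal-parity : ∀ {n} {S : Mat ℤ n} → Skew S → ∀ y → charVal S (- y) ≡ (- 1ℤ) ^ n * charVal S y
  charVal-parity {n} {S} skew y = begin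
    charVal S (- y)                                  ≡⟨ det-ext (λ i j → negate y (δ i j) (S i j)) ⟩
    detℤ (λ i j → - 1ℤ * (y •1+ 1ℤ • S) i j)         ≡⟨ det-scale (- 1ℤ) (y •1+ 1ℤ • S) ⟩
    (- 1ℤ) ^ n * detℤ (y •1+ 1ℤ • S)                 ≡⟨ cong ((- 1ℤ) ^ n *_) (charVal-skew skew y) ⟩
    (- 1ℤ) ^ n * charVal S y                         ∎
    where
    negate : ∀ y d s → - y * d + - s ≡ - 1ℤ * (y * d + 1ℤ * s)
    negate = solve-∀

open Matrices

-- The target polynomial in the variable y = 2x + 1

module TargetPolynomial where
  open import Data.Integer using (+_; _+_; _*_; -_; _^_)
  open ≡-Reasoning

  targetPoly : ℕ → Poly
  targetPoly t = ((xP ^ₚ 3) -ₚ (constP (+ (2 ℕ.* t ∸ 1)) *ₚ (xP ^ₚ 2)) -ₚ constP (+ (t ℕ.* (4 ℕ.* t ∸ 1))))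
                 *ₚ (((xP ^ₚ 2) +ₚ xP +ₚ constP (+ t)) ^ₚ (2 ℕ.* t ∸ 1))

  targetVal : ℕ → ℤ → ℤ
  targetVal t x = (x ^ 3 + - (+ (2 ℕ.* t ∸ 1) * x ^ 2) + - (+ (t ℕ.* (4 ℕ.* t ∸ 1)))) * (x ^ 2 + x + + t) ^ (2 ℕ.* t ∸ 1)

  rep-target : ∀ t → Represents (targetPoly t) (targetVal t)
  rep-target t = rep-*
    (rep-- (rep-- (rep-^ 3 rep-x) (rep-* (rep-const (+ (2 ℕ.* t ∸ 1))) (rep-^ 2 rep-x))) (rep-const (+ (t ℕ.* (4 ℕ.* t ∸ 1)))))
    (rep-^ (2 ℕ.* t ∸ 1) (rep-+ (rep-+ (rep-^ 2 rep-x) rep-x) (rep-const (+ t))))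

  monic-target : ∀ t → Monic (3 ℕ.+ (2 ℕ.* t ∸ 1) ℕ.* 2) (targetPoly t)
  monic-target t = monic-*
    (monic-+ (monic-+ (monic-^ 3 monic-x)
       (degree-neg (proj₂ (*ₚ-degree (constP (+ (2 ℕ.* t ∸ 1))) (xP ^ₚ 2) (degree-const _) (proj₂ (monic-^ 2 monic-x))))) (s≤s (s≤s (s≤s z≤n))))
       (degree-neg (degree-const _)) (s≤s z≤n))
    (monic-^ (2 ℕ.* t ∸ 1)
       (monic-+ (monic-+ (monic-^ 2 monic-x) (proj₂ monic-x) (s≤s (s≤s z≤n))) (degree-const _) (s≤s z≤n)))

  ^-distribʳ-* : ∀ x y n → (x * y) ^ n ≡ x ^ n * y ^ n
  ^-distribʳ-* x y zero    = refl
  ^-distribʳ-* x y (suc n) = trans (cong (λ p → x * y * p) (^-distribʳ-* x y n)) (regroup x y (x ^ n) (y ^ n))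
    where
    regroup : ∀ x y p q → x * y * (p * q) ≡ x * p * (y * q)
    regroup = solve-∀

  pos-pred : ∀ {m} → 1 ℕ.≤ m → + (m ∸ 1) ≡ + m + - 1ℤ
  pos-pred (s≤s _) = refl

  module Parameters (t : ℕ) (t≥1 : t ℕ.≥ 1) where
    T : ℤ
    T = + t
    k : ℕ
    k = 2 ℕ.* t ∸ 1

    suc-k : suc k ≡ 2 ℕ.* t
    suc-k = ℕ.suc-pred (2 ℕ.* t) {{ℕ.>-nonZero (ℕ.≤-trans t≥1 (ℕ.m≤n*m t 2))}}

    pos-k : + k ≡ + 2 * T + - 1ℤ
    pos-k = trans (pos-pred (ℕ.≤-trans t≥1 (ℕ.m≤n*m t 2))) (cong (_+ - 1ℤ) (pos-* 2 t))

    -- At y = 2x + 1 this is 4 (x² + x + t), four times the quadratic factor of the target.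
    ζ : ℤ → ℤ
    ζ y = y * y + (+ 4 * T + - 1ℤ)

    double+1 : ℤ → ℤ
    double+1 x = + 2 * x + 1ℤ

    -- The power of 2 is shared out as 8 for the cubic and 4 for each quadratic factor. The right
    -- side is arranged to match (1 + y) χ_S′ - χ_S term by term, with y (ζ + 4t) odd and ζ (ζ + 4t
    -- + 2) even in y.
    targetVal-scaled : ∀ x → let y = double+1 x in
      (+ 2) ^ (3 ℕ.+ k ℕ.* 2) * targetVal t x ≡ ζ y ^ k * ((1ℤ + y) * y * (ζ y + + 4 * T) + - (ζ y * (ζ y + (+ 4 * T + + 2))))
    targetVal-scaled x = begin
      (+ 2) ^ (3 ℕ.+ k ℕ.* 2) * targetVal t x
        ≡⟨ cong₂ _*_ two-power (cong₂ (λ c d → (x ^ 3 + - (c * x ^ 2) + - d) * q ^ k) pos-k pos-d) ⟩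
      + 8 * (+ 4) ^ k * ((x ^ 3 + - ((+ 2 * T + - 1ℤ) * x ^ 2) + - (T * (+ 4 * T + - 1ℤ))) * q ^ k)
        ≡⟨ regroup ((+ 4) ^ k) (q ^ k) (x ^ 3 + - ((+ 2 * T + - 1ℤ) * x ^ 2) + - (T * (+ 4 * T + - 1ℤ))) ⟩
      ((+ 4) ^ k * q ^ k) * (+ 8 * (x ^ 3 + - ((+ 2 * T + - 1ℤ) * x ^ 2) + - (T * (+ 4 * T + - 1ℤ))))
        ≡⟨ cong₂ _*_ (trans (sym (^-distribʳ-* (+ 4) q k)) (cong (_^ k) (quadratic T x))) (cubic T x) ⟩
      ζ y ^ k * ((1ℤ + y) * y * (ζ y + + 4 * T) + - (ζ y * (ζ y + (+ 4 * T + + 2)))) ∎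
      where
      y q : ℤ
      y = double+1 x
      q = x ^ 2 + x + T
      two-power : (+ 2) ^ (3 ℕ.+ k ℕ.* 2) ≡ + 8 * (+ 4) ^ k
      two-power = trans (^-distribˡ-+-* (+ 2) 3 (k ℕ.* 2))
        (cong (λ p → + 8 * p) (trans (cong (λ e → (+ 2) ^ e) (ℕ.*-comm k 2)) (sym (^-*-assoc (+ 2) 2 k))))
      pos-d : + (t ℕ.* (4 ℕ.* t ∸ 1)) ≡ T * (+ 4 * T + - 1ℤ)
      pos-d = trans (pos-* t (4 ℕ.* t ∸ 1)) (cong (λ d → T * d)
        (trans (pos-pred (ℕ.≤-trans t≥1 (ℕ.m≤n*m t 4))) (cong (_+ - 1ℤ) (pos-* 4 t))))
      regroup : ∀ a b c → + 8 * a * (c * b) ≡ a * b * (+ 8 * c)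
      regroup = solve-∀
      quadratic : ∀ T x → + 4 * (x * (x * 1ℤ) + x + T) ≡ (+ 2 * x + 1ℤ) * (+ 2 * x + 1ℤ) + (+ 4 * T + - 1ℤ)
      quadratic = solve-∀
      cubic : ∀ T x → + 8 * (x * (x * (x * 1ℤ)) + - ((+ 2 * T + - 1ℤ) * (x * (x * 1ℤ))) + - (T * (+ 4 * T + - 1ℤ))) ≡
        (1ℤ + (+ 2 * x + 1ℤ)) * (+ 2 * x + 1ℤ) * ((+ 2 * x + 1ℤ) * (+ 2 * x + 1ℤ) + (+ 4 * T + - 1ℤ) + + 4 * T) +
        - (((+ 2 * x + 1ℤ) * (+ 2 * x + 1ℤ) + (+ 4 * T + - 1ℤ)) * ((+ 2 * x + 1ℤ) * (+ 2 * x + 1ℤ) + (+ 4 * T + - 1ℤ) + (+ 4 * T + + 2)))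
      cubic = solve-∀

    -- The hypothesis turns 2 (xI - A) into (yI - R) - J, and `det-minus-J` trades the subtraction
    -- of J for a border.
    charVal-tournament : ∀ {n} (A R : Mat ℤ n) → (∀ i j → + 2 * A i j ≡ 1ℤ + - δ i j + R i j) → ∀ x →
      let y = double+1 x in
      (+ 2) ^ n * charVal A x ≡ (1ℤ + y) * charVal R y + - charVal (bordered 0ℤ (λ _ → 1ℤ) (λ _ → - 1ℤ) R) y
    charVal-tournament {n} A R eq x = begin
      (+ 2) ^ n * charVal A x                                    ≡⟨ det-scale (+ 2) (λ i j → x * δ i j + - A i j) ⟨
      detℤ (λ i j → + 2 * (x * δ i j + - A i j))                 ≡⟨ det-ext (λ i j → trans (distribute x (δ i j) (A i j)) (trans (cong (λ a → + 2 * x * δ i j + - a) (eq i j)) (collect x (δ i j) (R i j)))) ⟩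
      detℤ (λ i j → (y * δ i j + - R i j) + - 1ℤ)                ≡⟨ det-minus-J y (λ i j → y * δ i j + - R i j) ⟩
      (1ℤ + y) * charVal R y + - detℤ (bordered y (λ _ → - 1ℤ) (λ _ → 1ℤ) (λ i j → y * δ i j + - R i j))
                                                                 ≡⟨ cong (λ d → (1ℤ + y) * charVal R y + - d) (det-ext shape) ⟩
      (1ℤ + y) * charVal R y + - charVal (bordered 0ℤ (λ _ → 1ℤ) (λ _ → - 1ℤ) R) y ∎
      where
      y : ℤ
      y = double+1 x
      distribute : ∀ x d a → + 2 * (x * d + - a) ≡ + 2 * x * d + - (+ 2 * a)
      distribute = solve-∀
      collect : ∀ x d r → + 2 * x * d + - (1ℤ + - d + r) ≡ ((+ 2 * x + 1ℤ) * d + - r) + - 1ℤ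
      collect = solve-∀
      shape : bordered y (λ _ → - 1ℤ) (λ _ → 1ℤ) (λ i j → y * δ i j + - R i j) ≐
              (λ i j → y * δ i j + - bordered 0ℤ (λ _ → 1ℤ) (λ _ → - 1ℤ) R i j)
      shape zero    zero    = sym (trans (+-identityʳ (y * 1ℤ)) (*-identityʳ y))
      shape zero    (suc j) = sym (cong (_+ - 1ℤ) (*-zeroʳ y))
      shape (suc i) zero    = sym (cong (_+ 1ℤ) (*-zeroʳ y))
      shape (suc i) (suc j) = refl

open TargetPolynomial

-- Characteristic polynomial and principal minor of a skew matrix with prescribed square

module RegularSkewMatrices where
  open import Data.Integer using (+_; _+_; _*_; -_; _^_)
  open ≡-Reasoning

  cancelˡ : ∀ {c} → c ≢ 0ℤ → ∀ x y → c * x ≡ c * y → x ≡ y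
  cancelˡ {c} c≢0 x y = *-cancelˡ-≡ c x y {{≢-nonZero c≢0}}

  *-≢0 : ∀ {x y} → x ≢ 0ℤ → y ≢ 0ℤ → x * y ≢ 0ℤ
  *-≢0 {x} x≢0 y≢0 e with i*j≡0⇒i≡0∨j≡0 x e
  ... | inj₁ x≡0 = x≢0 x≡0
  ... | inj₂ y≡0 = y≢0 y≡0

  ^-≢0 : ∀ {x} n → x ≢ 0ℤ → x ^ n ≢ 0ℤ
  ^-≢0 {x} n x≢0 e = x≢0 (i^n≡0⇒i≡0 x n e)

  square-abs : ∀ y → y * y ≡ + (∣ y ∣ ℕ.* ∣ y ∣)
  square-abs (+ n)    = sym (pos-* n n)
  square-abs -[1+ n ] = refl

  i≡-i⇒i≡0 : ∀ i → i ≡ - i → i ≡ 0ℤ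
  i≡-i⇒i≡0 (+ zero) _ = refl

  -- Both sides are X M adj(M), bracketed in the two possible ways. This reads off cofactors from an
  -- inverse known only up to the scalar c.
  ⊗-adjugate : ∀ {n} c (X M : Mat ℤ n) → X ⊗ M ≐ (λ i j → c * δ i j) → ∀ i k → c * cofactor M i k ≡ detℤ M * X i k
  ⊗-adjugate c X M X⊗M i k = begin
    c * cofactor M i k                             ≡⟨ cong (c *_) (sum-δˡ i (λ j → cofactor M j k)) ⟨
    c * sum (λ j → δ i j * cofactor M j k)         ≡⟨ *-distribˡ-sum c (λ j → δ i j * cofactor M j k) ⟩
    sum (λ j → c * (δ i j * cofactor M j k))       ≡⟨ sum-cong-≗ (λ j → trans (sym (*-assoc c (δ i j) (cofactor M j k)))
                                                                              (cong (_* cofactor M j k) (sym (X⊗M i j)))) ⟩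
    ((X ⊗ M) ⊗ cofactor M) i k                     ≡⟨ ⊗-assoc X M (cofactor M) i k ⟩
    (X ⊗ (M ⊗ cofactor M)) i k                     ≡⟨ sum-cong-≗ (λ j → trans (cong (X i j *_) (⊗-cofactor M j k)) (shuffle (X i j) (detℤ M) (δ j k))) ⟩
    sum (λ j → detℤ M * (X i j * δ j k))           ≡⟨ *-distribˡ-sum (detℤ M) (λ j → X i j * δ j k) ⟨
    detℤ M * sum (λ j → X i j * δ j k)             ≡⟨ cong (detℤ M *_) (sum-δʳ k (X i)) ⟩
    detℤ M * X i k                                 ∎
    where
    shuffle : ∀ x d e → x * (d * e) ≡ d * (x * e)
    shuffle = solve-∀

  skew-square-symmetric : ∀ {n} {S : Mat ℤ n} → Skew S → ∀ i j → (S ⊗ S) i j ≡ (S ⊗ S) j i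
  skew-square-symmetric {S = S} skew i j = sum-cong-≗ (λ l →
    trans (cong₂ _*_ (skew l i) (skew j l)) (signs (S l i) (S j l)))
    where
    signs : ∀ x y → - x * - y ≡ y * x
    signs = solve-∀

  -- The cube of a skew matrix equals minus its own diagonal on the diagonal, since S² is symmetric.
  skew-cube-diagonal : ∀ {n} {S : Mat ℤ n} → Skew S → ∀ i → ((S ⊗ S) ⊗ S) i i ≡ 0ℤ
  skew-cube-diagonal {S = S} skew i = i≡-i⇒i≡0 (((S ⊗ S) ⊗ S) i i) (begin
    ((S ⊗ S) ⊗ S) i i                    ≡⟨ sum-cong-≗ (λ j → trans (cong₂ _*_ (skew-square-symmetric {S = S} skew i j) (skew i j)) (sign ((S ⊗ S) j i) (S i j))) ⟩
    sum (λ j → - 1ℤ * (S i j * (S ⊗ S) j i)) ≡⟨ *-distribˡ-sum (- 1ℤ) (λ j → S i j * (S ⊗ S) j i) ⟨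
    - 1ℤ * (S ⊗ (S ⊗ S)) i i             ≡⟨ -1*i≡-i ((S ⊗ (S ⊗ S)) i i) ⟩
    - (S ⊗ (S ⊗ S)) i i                  ≡⟨ cong -_ (⊗-assoc S S S i i) ⟨
    - ((S ⊗ S) ⊗ S) i i                  ∎)
    where
    sign : ∀ q s → q * - s ≡ - 1ℤ * (s * q)
    sign = solve-∀

  -- With c = -b the terms linear in S cancel. Leaving b and c open covers the factors I + S and I -
  -- S in either order.
  shifts-⊗ : ∀ {n} b c y (S : Mat ℤ n) i k → b + c ≡ 0ℤ →
    ((y •1+ b • S) ⊗ (y •1+ c • S)) i k ≡ y * y * δ i k + b * c * (S ⊗ S) i k
  shifts-⊗ b c y S i k b+c≡0 = begin
    ((y •1+ b • S) ⊗ (y •1+ c • S)) i k                                       ≡⟨ •1+-⊗-•1+ y b y c S S i k ⟩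
    y * y * δ i k + y * c * S i k + b * y * S i k + b * c * (S ⊗ S) i k       ≡⟨ collect b c y (δ i k) (S i k) ((S ⊗ S) i k) ⟩
    y * y * δ i k + b * c * (S ⊗ S) i k + y * S i k * (b + c)                 ≡⟨ cong (λ e → y * y * δ i k + b * c * (S ⊗ S) i k + e) (*-0 (y * S i k) b+c≡0) ⟩
    y * y * δ i k + b * c * (S ⊗ S) i k + 0ℤ                                  ≡⟨ +-identityʳ _ ⟩
    y * y * δ i k + b * c * (S ⊗ S) i k                                       ∎
    where
    collect : ∀ b c y d s q → y * y * d + y * c * s + b * y * s + b * c * q ≡ y * y * d + b * c * q + y * s * (b + c)
    collect = solve-∀

  charVal-det : ∀ {n} (S : Mat ℤ n) y → detℤ (y •1+ - 1ℤ • S) ≡ charVal S y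
  charVal-det S y = det-ext (λ i j → cong (λ s → y * δ i j + s) (-1*i≡-i (S i j)))

  module Positivity (t : ℕ) (t≥1 : t ℕ.≥ 1) where
    open Parameters t t≥1

    -- Here t ≥ 1 enters, through 4t - 1 > 0. It makes ζ and ζ + 2h cancellable at every integer y.
    ζ-positive : ∀ y → Σ ℕ λ m → ζ y ≡ + suc m
    ζ-positive y with 4 ℕ.* t ∸ 1 | ℕ.m<n⇒0<n∸m (ℕ.≤-trans (s≤s (s≤s z≤n)) (ℕ.*-monoʳ-≤ 4 t≥1)) | pos-pred (ℕ.≤-trans t≥1 (ℕ.m≤n*m t 4))
    ... | suc m | _ | eq = ∣ y ∣ ℕ.* ∣ y ∣ ℕ.+ m , (begin
      y * y + (+ 4 * T + - 1ℤ)                 ≡⟨ cong₂ _+_ (square-abs y) (sym (trans eq (cong (_+ - 1ℤ) (pos-* 4 t)))) ⟩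
      + (∣ y ∣ ℕ.* ∣ y ∣ ℕ.+ suc m)             ≡⟨ cong +_ (ℕ.+-suc (∣ y ∣ ℕ.* ∣ y ∣) m) ⟩
      + suc (∣ y ∣ ℕ.* ∣ y ∣ ℕ.+ m)             ∎)

    ζ≢0 : ∀ y → ζ y ≢ 0ℤ
    ζ≢0 y e with ζ-positive y
    ... | m , eq with trans (sym eq) e
    ... | ()

    ζ+2h≢0 : ∀ y → ζ y + (+ 4 * T + + 2) ≢ 0ℤ
    ζ+2h≢0 y e with ζ-positive y
    ... | m , eq with trans (sym (cong₂ (λ a b → a + (b + + 2)) eq (sym (pos-* 4 t)))) e
    ... | ()

  module RegularSkew (t : ℕ) (t≥1 : t ℕ.≥ 1) (n : ℕ) (order : n ≡ 3 ℕ.+ (2 ℕ.* t ∸ 1) ℕ.* 2) where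
    open Parameters t t≥1
    open Positivity t t≥1

    N : ℕ
    N = suc n

    block-projection : (u v : Fin N → ℤ) → Mat ℤ N
    block-projection u v i j = outer u u i j + outer v v i j

    module _ (S : Mat ℤ N) (skew : Skew S) (u v : Fin N → ℤ)
             (uu : dot u u ≡ + 2 * T + 1ℤ) (vv : dot v v ≡ + 2 * T + 1ℤ) (uv : dot u v ≡ 0ℤ)
             (square : ∀ i j → (S ⊗ S) i j ≡ - (+ 4 * T + - 1ℤ) * δ i j + - (+ 2) * block-projection u v i j) where
      private
        K : Mat ℤ N
        K = block-projection u v

      shifts-product : ∀ y b c → b * c ≡ - 1ℤ → b + c ≡ 0ℤ → (y •1+ b • S) ⊗ (y •1+ c • S) ≐ (ζ y •1+ + 2 • K)
      shifts-product y b c bc b+c i j = begin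
        ((y •1+ b • S) ⊗ (y •1+ c • S)) i j                                          ≡⟨ shifts-⊗ b c y S i j b+c ⟩
        y * y * δ i j + b * c * (S ⊗ S) i j                                          ≡⟨ cong₂ (λ e q → y * y * δ i j + e * q) bc (square i j) ⟩
        y * y * δ i j + - 1ℤ * (- (+ 4 * T + - 1ℤ) * δ i j + - (+ 2) * K i j)        ≡⟨ collect y T (δ i j) (K i j) ⟩
        ζ y * δ i j + + 2 * K i j                                                    ∎
        where
        collect : ∀ y T d x → y * y * d + - 1ℤ * (- (+ 4 * T + - 1ℤ) * d + - (+ 2) * x) ≡ (y * y + (+ 4 * T + - 1ℤ)) * d + + 2 * x
        collect = solve-∀

      -- Orthogonality of u and v kills the mixed term, so the rank-two perturbation splits into two
      -- of rank one; the price is a scalar z.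
      rank-two-product : ∀ z → (z •1+ + 2 • outer u u) ⊗ (z •1+ + 2 • outer v v) ≐ (λ i j → z * (z •1+ + 2 • K) i j)
      rank-two-product z i j = begin
        ((z •1+ + 2 • outer u u) ⊗ (z •1+ + 2 • outer v v)) i j
          ≡⟨ •1+-⊗-•1+ z (+ 2) z (+ 2) (outer u u) (outer v v) i j ⟩
        z * z * δ i j + z * + 2 * outer v v i j + + 2 * z * outer u u i j + + 2 * + 2 * (outer u u ⊗ outer v v) i j
          ≡⟨ cong (λ e → z * z * δ i j + z * + 2 * outer v v i j + + 2 * z * outer u u i j + e)
               (*-0 (+ 2 * + 2) (trans (outer-⊗-outer u u v v i j) (0-* (outer u v i j) uv))) ⟩
        z * z * δ i j + z * + 2 * outer v v i j + + 2 * z * outer u u i j + 0ℤ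
          ≡⟨ collect z (δ i j) (outer u u i j) (outer v v i j) ⟩
        z * (z •1+ + 2 • K) i j ∎
        where
        collect : ∀ z d x y → z * z * d + z * + 2 * y + + 2 * z * x + 0ℤ ≡ z * (z * d + + 2 * (x + y))
        collect = solve-∀

      charVal-squared : ∀ y → let w = ζ y ^ suc k * (ζ y + (+ 4 * T + + 2)) in charVal S y * charVal S y ≡ w * w
      charVal-squared y = begin
        charVal S y * charVal S y                            ≡⟨ cong₂ _*_ (charVal-det S y) (charVal-skew skew y) ⟨
        detℤ (y •1+ - 1ℤ • S) * detℤ (y •1+ 1ℤ • S)          ≡⟨ det-⊗ (y •1+ - 1ℤ • S) (y •1+ 1ℤ • S) ⟨
        detℤ ((y •1+ - 1ℤ • S) ⊗ (y •1+ 1ℤ • S))             ≡⟨ det-ext (shifts-product y (- 1ℤ) 1ℤ refl refl) ⟩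
        E                                                    ≡⟨ cancelˡ (*-≢0 (*-≢0 z≢0 z≢0) (^-≢0 N z≢0)) E (w * w) scaled ⟩
        w * w                                                ∎
        where
        z w E E₁ E₂ : ℤ
        z = ζ y
        w = z ^ suc k * (z + (+ 4 * T + + 2))
        E = detℤ (z •1+ + 2 • K)
        E₁ = detℤ (z •1+ + 2 • outer u u)
        E₂ = detℤ (z •1+ + 2 • outer v v)
        z≢0 : z ≢ 0ℤ
        z≢0 = ζ≢0 y
        regroup : ∀ z e₁ e₂ → z * z * (e₁ * e₂) ≡ (z * e₁) * (z * e₂)
        regroup = solve-∀
        two-h : ∀ z T → z + + 2 * (+ 2 * T + 1ℤ) ≡ z + (+ 4 * T + + 2)
        two-h = solve-∀
        quartic : ∀ z p → z * (z * (z * (z * (p * (p * 1ℤ))))) ≡ (z * (z * p)) * (z * (z * p))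
        quartic = solve-∀
        final : ∀ z q s → ((z * q) * (z * q) * s) * ((z * q) * (z * q) * s) ≡ z * z * ((z * q) * (z * q)) * (q * s * (q * s))
        final = solve-∀
        -- Each rank-one determinant costs a factor z, and the scalar in `rank-two-product` costs
        -- z^N; all of it is cancelled at the end.
        scaled : z * z * z ^ N * E ≡ z * z * z ^ N * (w * w)
        scaled = begin
          z * z * z ^ N * E                                  ≡⟨ *-assoc (z * z) (z ^ N) E ⟩
          z * z * (z ^ N * E)                                ≡⟨ cong (λ d → z * z * d) (det-scale z (z •1+ + 2 • K)) ⟨
          z * z * detℤ (λ i j → z * (z •1+ + 2 • K) i j)     ≡⟨ cong (λ d → z * z * d) (trans (det-ext (λ i j → sym (rank-two-product z i j)))
                                                                                       (det-⊗ (z •1+ + 2 • outer u u) (z •1+ + 2 • outer v v))) ⟩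
          z * z * (E₁ * E₂)                                  ≡⟨ regroup z E₁ E₂ ⟩
          (z * E₁) * (z * E₂)                                ≡⟨ cong₂ _*_ (trans (rank-one-det z (+ 2) u u) (cong (λ d → z ^ N * (z + + 2 * d)) uu))
                                                                          (trans (rank-one-det z (+ 2) v v) (cong (λ d → z ^ N * (z + + 2 * d)) vv)) ⟩
          (z ^ N * (z + + 2 * (+ 2 * T + 1ℤ))) * (z ^ N * (z + + 2 * (+ 2 * T + 1ℤ)))
                                                             ≡⟨ cong₂ (λ p s → (p * s) * (p * s)) power (two-h z T) ⟩
          (P * s) * (P * s)                                  ≡⟨ final z (z ^ suc k) s ⟩
          z * z * P * (w * w)                                ≡⟨ cong (λ p → z * z * p * (w * w)) power ⟨
          z * z * z ^ N * (w * w)                            ∎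
          where
          P s : ℤ
          P = (z * z ^ suc k) * (z * z ^ suc k)
          s = z + (+ 4 * T + + 2)
          -- The order N = 4t + 2 is even, so z^N is a square.
          power : z ^ N ≡ P
          power = trans (cong (λ m → z ^ suc m) order)
            (trans (cong (λ p → z * (z * (z * (z * p)))) (sym (^-*-assoc z k 2))) (quartic z (z ^ k)))

      -- The square of the characteristic polynomial is known; being monic fixes the sign of the root.
      charVal-from-square : ∀ y → charVal S y ≡ ζ y ^ suc k * (ζ y + (+ 4 * T + + 2))
      charVal-from-square y = trans (rep-values (rep-charPoly S) rep-D
          (monic-square-unique (monic-charPoly S) monic-D (rep-charPoly S) rep-D
            (λ x → trans (charVal-squared x) (sym (cong₂ _*_ (D-value x) (D-value x))))) y) (D-value y)
        where
        b : ℤ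
        b = (+ 4 * T + - 1ℤ) + (+ 4 * T + + 2)
        D : Poly
        D = ((xP ^ₚ 2 +ₚ constP (+ 4 * T + - 1ℤ)) ^ₚ suc k) *ₚ (xP ^ₚ 2 +ₚ constP b)
        rep-D : Represents D (λ x → (x ^ 2 + (+ 4 * T + - 1ℤ)) ^ suc k * (x ^ 2 + b))
        rep-D = rep-* (rep-^ (suc k) (rep-+ (rep-^ 2 rep-x) (rep-const (+ 4 * T + - 1ℤ)))) (rep-+ (rep-^ 2 rep-x) (rep-const b))
        monic-D : Monic N D
        monic-D = subst (λ m → Monic m D) (trans (cong (λ m → 2 ℕ.+ m) (ℕ.+-comm (k ℕ.* 2) 2)) (cong suc (sym order)))
          (monic-* (monic-^ (suc k) (monic-+ (monic-^ 2 monic-x) (degree-const _) (s≤s z≤n)))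
                   (monic-+ (monic-^ 2 monic-x) (degree-const _) (s≤s z≤n)))
        D-value : ∀ x → (x ^ 2 + (+ 4 * T + - 1ℤ)) ^ suc k * (x ^ 2 + b) ≡ ζ x ^ suc k * (ζ x + (+ 4 * T + + 2))
        D-value x = cong₂ (λ p q → p ^ suc k * q) (cong (λ s → x * s + (+ 4 * T + - 1ℤ)) (*-identityʳ x)) (collect x T)
          where
          collect : ∀ x T → x * (x * 1ℤ) + ((+ 4 * T + - 1ℤ) + (+ 4 * T + + 2)) ≡ x * x + (+ 4 * T + - 1ℤ) + (+ 4 * T + + 2)
          collect = solve-∀

      K⊗K : K ⊗ K ≐ (λ i j → (+ 2 * T + 1ℤ) * K i j)
      K⊗K i j = begin
        (K ⊗ K) i j
          ≡⟨ ⊗-cong {M = K} {K′} {K} {K′} K≐ K≐ i j ⟩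
        (K′ ⊗ K′) i j
          ≡⟨ ⊗-linearˡ 1ℤ 1ℤ (outer u u) (outer v v) K′ i j ⟩
        1ℤ * (outer u u ⊗ K′) i j + 1ℤ * (outer v v ⊗ K′) i j
          ≡⟨ cong₂ (λ x y → 1ℤ * x + 1ℤ * y) (⊗-linearʳ 1ℤ 1ℤ (outer u u) (outer u u) (outer v v) i j)
                                            (⊗-linearʳ 1ℤ 1ℤ (outer v v) (outer u u) (outer v v) i j) ⟩
        1ℤ * (1ℤ * (outer u u ⊗ outer u u) i j + 1ℤ * (outer u u ⊗ outer v v) i j) +
        1ℤ * (1ℤ * (outer v v ⊗ outer u u) i j + 1ℤ * (outer v v ⊗ outer v v) i j)
          ≡⟨ cong₂ (λ x y → 1ℤ * x + 1ℤ * y)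
               (cong₂ (λ x y → 1ℤ * x + 1ℤ * y) (trans (outer-⊗-outer u u u u i j) (cong (_* outer u u i j) uu))
                                               (trans (outer-⊗-outer u u v v i j) (0-* (outer u v i j) uv)))
               (cong₂ (λ x y → 1ℤ * x + 1ℤ * y) (trans (outer-⊗-outer v v u u i j) (0-* (outer v u i j) vu))
                                               (trans (outer-⊗-outer v v v v i j) (cong (_* outer v v i j) vv))) ⟩
        1ℤ * (1ℤ * ((+ 2 * T + 1ℤ) * outer u u i j) + 1ℤ * 0ℤ) + 1ℤ * (1ℤ * 0ℤ + 1ℤ * ((+ 2 * T + 1ℤ) * outer v v i j))
          ≡⟨ collect (+ 2 * T + 1ℤ) (outer u u i j) (outer v v i j) ⟩
        (+ 2 * T + 1ℤ) * K i j ∎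
        where
        K′ : Mat ℤ N
        K′ i j = 1ℤ * outer u u i j + 1ℤ * outer v v i j
        K≐ : K ≐ K′
        K≐ i j = sym (cong₂ _+_ (*-identityˡ (outer u u i j)) (*-identityˡ (outer v v i j)))
        vu : dot v u ≡ 0ℤ
        vu = trans (sum-cong-≗ (λ l → *-comm (v l) (u l))) uv
        collect : ∀ h x y → 1ℤ * (1ℤ * (h * x) + 1ℤ * 0ℤ) + 1ℤ * (1ℤ * 0ℤ + 1ℤ * (h * y)) ≡ h * (x + y)
        collect = solve-∀

      skew-diagonal : ∀ i → S i i ≡ 0ℤ
      skew-diagonal i = i≡-i⇒i≡0 (S i i) (skew i i)

      -- Multiplying the formula for S² by S expresses 2 K S through S³ and S, whose diagonals
      -- vanish.
      K⊗S-diagonal : ∀ i → (K ⊗ S) i i ≡ 0ℤ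
      K⊗S-diagonal i = cancelˡ {+ 2} (λ ()) ((K ⊗ S) i i) 0ℤ (begin
        + 2 * (K ⊗ S) i i                                                     ≡⟨ isolate a (S i i) ((K ⊗ S) i i) ⟩
        - (- a * S i i + - (+ 2) * (K ⊗ S) i i) + - a * S i i                 ≡⟨ cong₂ (λ x s → - x + - a * s) (sym (•1+-⊗ (- a) (- (+ 2)) K S i i)) (skew-diagonal i) ⟩
        - (((- a) •1+ - (+ 2) • K) ⊗ S) i i + - a * 0ℤ                        ≡⟨ cong₂ (λ x y → - x + y) (sym (⊗-cong {M = S ⊗ S} {N = S} square (λ _ _ → refl) i i)) (*-zeroʳ (- a)) ⟩
        - ((S ⊗ S) ⊗ S) i i + 0ℤ                                              ≡⟨ cong (λ x → - x + 0ℤ) (skew-cube-diagonal {S = S} skew i) ⟩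
        + 2 * 0ℤ                                                              ∎)
        where
        a : ℤ
        a = + 4 * T + - 1ℤ
        isolate : ∀ a s x → + 2 * x ≡ - (- a * s + - (+ 2) * x) + - a * s
        isolate = solve-∀

      -- X inverts yI - S up to the scalar ζ (ζ + 2h): the factor yI + S produces ζI + 2K, which (ζ
      -- + 2h) I - 2K inverts because K² = hK. The minor is the corner cofactor, and the corner of X
      -- is y (ζ + 2h) - 2y.
      principal-minor : K zero zero ≡ 1ℤ → ∀ y →
        charVal (λ i j → S (suc i) (suc j)) y ≡ ζ y ^ k * (y * (ζ y + + 4 * T))
      principal-minor K₀₀ y = cancelˡ (*-≢0 (ζ≢0 y) (ζ+2h≢0 y)) _ _ (begin
        z * z+2h * charVal (λ i j → S (suc i) (suc j)) y     ≡⟨ cong (λ d → z * z+2h * d) (trans (sym (charVal-det (λ i j → S (suc i) (suc j)) y)) (sym (cofactor₀₀ M))) ⟩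
        z * z+2h * cofactor M zero zero                      ≡⟨ ⊗-adjugate (z * z+2h) X M X⊗M zero zero ⟩
        detℤ M * X zero zero                                 ≡⟨ cong₂ _*_ (trans (charVal-det S y) (charVal-from-square y)) X₀₀ ⟩
        z ^ suc k * z+2h * (y * (z + + 4 * T))               ≡⟨ regroup z (z ^ k) z+2h (y * (z + + 4 * T)) ⟩
        z * z+2h * (z ^ k * (y * (z + + 4 * T)))             ∎)
        where
        z z+2h : ℤ
        z = ζ y
        z+2h = z + (+ 4 * T + + 2)
        M X : Mat ℤ N
        M = y •1+ - 1ℤ • S
        X = (z+2h •1+ - (+ 2) • K) ⊗ (y •1+ 1ℤ • S)
        regroup : ∀ z p w x → z * p * w * x ≡ z * w * (p * x)
        regroup = solve-∀
        X⊗M : X ⊗ M ≐ (λ i j → z * z+2h * δ i j)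
        X⊗M i j = begin
          (X ⊗ M) i j
            ≡⟨ ⊗-assoc (z+2h •1+ - (+ 2) • K) (y •1+ 1ℤ • S) M i j ⟩
          ((z+2h •1+ - (+ 2) • K) ⊗ ((y •1+ 1ℤ • S) ⊗ M)) i j
            ≡⟨ ⊗-cong {M = z+2h •1+ - (+ 2) • K} (λ _ _ → refl) (shifts-product y 1ℤ (- 1ℤ) refl refl) i j ⟩
          ((z+2h •1+ - (+ 2) • K) ⊗ (z •1+ + 2 • K)) i j
            ≡⟨ •1+-⊗-•1+ z+2h (- (+ 2)) z (+ 2) K K i j ⟩
          z+2h * z * δ i j + z+2h * + 2 * K i j + - (+ 2) * z * K i j + - (+ 2) * + 2 * (K ⊗ K) i j
            ≡⟨ cong (λ x → z+2h * z * δ i j + z+2h * + 2 * K i j + - (+ 2) * z * K i j + - (+ 2) * + 2 * x) (K⊗K i j) ⟩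
          z+2h * z * δ i j + z+2h * + 2 * K i j + - (+ 2) * z * K i j + - (+ 2) * + 2 * ((+ 2 * T + 1ℤ) * K i j)
            ≡⟨ collect z T (δ i j) (K i j) ⟩
          z * z+2h * δ i j ∎
          where
          collect : ∀ z T d x → (z + (+ 4 * T + + 2)) * z * d + (z + (+ 4 * T + + 2)) * + 2 * x + - (+ 2) * z * x + - (+ 2) * + 2 * ((+ 2 * T + 1ℤ) * x)
                    ≡ z * (z + (+ 4 * T + + 2)) * d
          collect = solve-∀
        X₀₀ : X zero zero ≡ y * (z + + 4 * T)
        X₀₀ = begin
          X zero zero
            ≡⟨ •1+-⊗-•1+ z+2h (- (+ 2)) y 1ℤ K S zero zero ⟩
          z+2h * y * 1ℤ + z+2h * 1ℤ * S zero zero + - (+ 2) * y * K zero zero + - (+ 2) * 1ℤ * (K ⊗ S) zero zero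
            ≡⟨ cong₂ (λ s r → z+2h * y * 1ℤ + z+2h * 1ℤ * s + - (+ 2) * y * K zero zero + - (+ 2) * 1ℤ * r) (skew-diagonal zero) (K⊗S-diagonal zero) ⟩
          z+2h * y * 1ℤ + z+2h * 1ℤ * 0ℤ + - (+ 2) * y * K zero zero + - (+ 2) * 1ℤ * 0ℤ
            ≡⟨ cong (λ c → z+2h * y * 1ℤ + z+2h * 1ℤ * 0ℤ + - (+ 2) * y * c + - (+ 2) * 1ℤ * 0ℤ) K₀₀ ⟩
          z+2h * y * 1ℤ + z+2h * 1ℤ * 0ℤ + - (+ 2) * y * 1ℤ + - (+ 2) * 1ℤ * 0ℤ
            ≡⟨ collect z y T ⟩
          y * (z + + 4 * T) ∎
          where
          collect : ∀ z y T → (z + (+ 4 * T + + 2)) * y * 1ℤ + (z + (+ 4 * T + + 2)) * 1ℤ * 0ℤ + - (+ 2) * y * 1ℤ + - (+ 2) * 1ℤ * 0ℤ ≡ y * (z + + 4 * T)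
          collect = solve-∀

open RegularSkewMatrices

-- From a skew EW matrix to a tournament

module BlockSquares where
  open import Data.Integer using (+_; _+_; _*_; -_; _^_)
  open ≡-Reasoning

  ΣF≡sum : ∀ {n} (f : Fin n → ℤ) → ΣF 0ℤ _+_ f ≡ sum f
  ΣF≡sum {zero}  f = refl
  ΣF≡sum {suc n} f = cong (λ s → f zero + s) (ΣF≡sum (f ∘ suc))

  ±1-square : ∀ {x} → x ≡ 1ℤ ⊎ x ≡ -1ℤ → x * x ≡ 1ℤ
  ±1-square (inj₁ refl) = refl
  ±1-square (inj₂ refl) = refl

  square-±1 : ∀ x → x * x ≡ 1ℤ → x ≡ 1ℤ ⊎ x ≡ -1ℤ
  square-±1 (+ 1) _ = inj₁ refl
  square-±1 -[1+ 0 ] _ = inj₂ refl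
  square-±1 (+ suc (suc n)) ()
  square-±1 -[1+ suc n ] ()

  indicator : Bool → ℤ
  indicator b = if b then 1ℤ else 0ℤ

  sum-initial : ∀ h m → sum {h ℕ.+ m} (λ i → indicator (toℕ i <ᵇ h)) ≡ + h
  sum-initial zero    m = sum-zero {m} (λ _ → refl)
  sum-initial (suc h) m = cong (λ s → 1ℤ + s) (sum-initial h m)

  sum-final : ∀ h m → sum {h ℕ.+ m} (λ i → indicator (not (toℕ i <ᵇ h))) ≡ + m
  sum-final zero    zero    = refl
  sum-final zero    (suc m) = cong (λ s → 1ℤ + s) (sum-final zero m)
  sum-final (suc h) m = trans (+-identityˡ (sum {h ℕ.+ m} (λ i → indicator (not (toℕ i <ᵇ h))))) (sum-final h m)

  indicator-idem : ∀ b → indicator b * indicator b ≡ indicator b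
  indicator-idem true  = refl
  indicator-idem false = refl

  -- A skew matrix S with ±1 off the diagonal and S Sᵀ = (4t - 1) I + 2 (u uᵀ + v vᵀ), where u and v are supported
  -- on complementary sets of 2t + 1 indices and take the values ±1 there.
  record BlockSquare (t N : ℕ) : Set where
    field
      S      : Mat ℤ N
      skew   : Skew S
      unit   : ∀ {i j} → i ≢ j → S i j * S i j ≡ 1ℤ
      u v    : Fin N → ℤ
      disjoint : ∀ i → u i * v i ≡ 0ℤ
      cover  : ∀ i → u i * u i + v i * v i ≡ 1ℤ
      uu     : dot u u ≡ + 2 * + t + 1ℤ
      vv     : dot v v ≡ + 2 * + t + 1ℤ
      square : ∀ i j → (S ⊗ S) i j ≡ - (+ 4 * + t + - 1ℤ) * δ i j + - (+ 2) * (outer u u i j + outer v v i j)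

  -- With order 2h = 4t + 2 the Gram matrix is 4t I plus twice the block indicator, diagonal
  -- included.
  ewGram-blocks : ∀ t i j → let h = 2 ℕ.* t ℕ.+ 1 ; b = λ i → toℕ i <ᵇ h in
    ewGram h i j ≡ + 4 * + t * δ i j + + 2 * (indicator (b i) * indicator (b j) + indicator (not (b i)) * indicator (not (b j)))
  ewGram-blocks t i j with if-== i j (+ (h ℕ.+ h)) (off-diagonal (toℕ i <ᵇ h) (toℕ j <ᵇ h))
    where
    h : ℕ
    h = 2 ℕ.* t ℕ.+ 1
    off-diagonal : Bool → Bool → ℤ
    off-diagonal b c = if b ∧ c ∨ (not b ∧ not c) then + 2 else 0ℤ
  ... | inj₁ (refl , eq) = trans eq (begin
    + (h ℕ.+ h)                                  ≡⟨ cong₂ (λ x y → x + 1ℤ + (y + 1ℤ)) (pos-* 2 t) (pos-* 2 t) ⟩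
    (+ 2 * + t + 1ℤ) + (+ 2 * + t + 1ℤ)          ≡⟨ collect (+ t) ⟩
    + 4 * + t * 1ℤ + + 2 * 1ℤ                    ≡⟨ cong₂ (λ d e → + 4 * + t * d + + 2 * e) (sym (δ-diag i)) (one-block (toℕ i <ᵇ h)) ⟩
    + 4 * + t * δ i i + + 2 * (indicator (toℕ i <ᵇ h) * indicator (toℕ i <ᵇ h) + indicator (not (toℕ i <ᵇ h)) * indicator (not (toℕ i <ᵇ h))) ∎)
    where
    h : ℕ
    h = 2 ℕ.* t ℕ.+ 1
    collect : ∀ T → (+ 2 * T + 1ℤ) + (+ 2 * T + 1ℤ) ≡ + 4 * T * 1ℤ + + 2 * 1ℤ
    collect = solve-∀
    one-block : ∀ b → 1ℤ ≡ indicator b * indicator b + indicator (not b) * indicator (not b)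
    one-block true  = refl
    one-block false = refl
  ... | inj₂ (i≢j , eq) = trans eq (trans (blocks (toℕ i <ᵇ h) (toℕ j <ᵇ h))
      (trans (sym (+-identityˡ _)) (cong (_+ + 2 * (indicator (toℕ i <ᵇ h) * indicator (toℕ j <ᵇ h) + indicator (not (toℕ i <ᵇ h)) * indicator (not (toℕ j <ᵇ h))))
        (sym (*-0 (+ 4 * + t) (δ-off i≢j))))))
    where
    h : ℕ
    h = 2 ℕ.* t ℕ.+ 1
    blocks : ∀ b c → (if b ∧ c ∨ (not b ∧ not c) then + 2 else 0ℤ) ≡ + 2 * (indicator b * indicator c + indicator (not b) * indicator (not c))
    blocks true  true  = refl
    blocks true  false = refl
    blocks false true  = refl
    blocks false false = refl

  ==-δ : ∀ {n} x (i j : Fin n) → (if i == j then x else 0ℤ) ≡ x * δ i j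
  ==-δ x i j with if-== i j x 0ℤ
  ... | inj₁ (refl , eq) = trans eq (sym (trans (cong (λ d → x * d) (δ-diag i)) (*-identityʳ x)))
  ... | inj₂ (i≢j , eq)  = trans eq (sym (*-0 x (δ-off i≢j)))

  -- For S = B - I the product B Bᵀ is (I + S)(I - S) = I - S²; u and v are the indicators of the
  -- two halves.
  EW⇒BlockSquare : ∀ t (B : Mat ℤ ((2 ℕ.* t ℕ.+ 1) ℕ.+ (2 ℕ.* t ℕ.+ 1))) → IsEWMatrix (2 ℕ.* t ℕ.+ 1) B → IsSkewSymmetric B →
                   BlockSquare t ((2 ℕ.* t ℕ.+ 1) ℕ.+ (2 ℕ.* t ℕ.+ 1))
  EW⇒BlockSquare t B (pm1 , gram , _) skewB = record
    { S = S ; skew = skew ; unit = unit ; u = u ; v = v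
    ; disjoint = disjoint ; cover = cover
    ; uu = trans (sum-cong-≗ {h ℕ.+ h} (λ i → indicator-idem (toℕ i <ᵇ h))) (trans (sum-initial h h) pos-h)
    ; vv = trans (sum-cong-≗ {h ℕ.+ h} (λ i → indicator-idem (not (toℕ i <ᵇ h)))) (trans (sum-final h h) pos-h)
    ; square = square }
    where
    h : ℕ
    h = 2 ℕ.* t ℕ.+ 1
    pos-h : + h ≡ + 2 * + t + 1ℤ
    pos-h = cong (_+ 1ℤ) (pos-* 2 t)
    S : Mat ℤ (h ℕ.+ h)
    S i j = B i j + - δ i j
    u v : Fin (h ℕ.+ h) → ℤ
    u i = indicator (toℕ i <ᵇ h)
    v i = indicator (not (toℕ i <ᵇ h))
    disjoint : ∀ i → u i * v i ≡ 0ℤ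
    disjoint i with toℕ i <ᵇ h
    ... | true  = refl
    ... | false = refl
    cover : ∀ i → u i * u i + v i * v i ≡ 1ℤ
    cover i with toℕ i <ᵇ h
    ... | true  = refl
    ... | false = refl
    skew : Skew S
    skew i j = begin
      B j i + - δ j i                                  ≡⟨ cong (λ d → B j i + - d) (δ-sym j i) ⟩
      B j i + - δ i j                                  ≡⟨ isolate (B i j) (B j i) (δ i j) ⟩
      (B i j + B j i) + (- (B i j + - δ i j) + - (+ 2 * δ i j)) ≡⟨ cong (_+ (- S i j + - (+ 2 * δ i j))) (trans (skewB i j) (==-δ (+ 2) i j)) ⟩
      + 2 * δ i j + (- S i j + - (+ 2 * δ i j))        ≡⟨ cancel (+ 2 * δ i j) (S i j) ⟩
      - S i j                                          ∎
      where
      isolate : ∀ x y d → y + - d ≡ (x + y) + (- (x + - d) + - (+ 2 * d))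
      isolate = solve-∀
      cancel : ∀ x s → x + (- s + - x) ≡ - s
      cancel = solve-∀
    unit : ∀ {i j} → i ≢ j → S i j * S i j ≡ 1ℤ
    unit {i} {j} i≢j = trans (cong (λ s → s * s) (trans (cong (λ d → B i j + - d) (δ-off i≢j)) (+-identityʳ (B i j)))) (±1-square (pm1 i j))
    product : (B · transpose B) ≐ (1ℤ •1+ 1ℤ • S) ⊗ (1ℤ •1+ - 1ℤ • S)
    product i j = trans (ΣF≡sum (λ l → B i l * B j l)) (sum-cong-≗ (λ l → cong₂ _*_ (first (B i l) (δ i l)) (second l)))
      where
      first : ∀ b d → b ≡ 1ℤ * d + 1ℤ * (b + - d)
      first = solve-∀
      second : ∀ l → B j l ≡ 1ℤ * δ l j + - 1ℤ * S l j
      second l = trans (first (B j l) (δ j l)) (cong₂ (λ d s → 1ℤ * d + s) (δ-sym j l)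
        (trans (*-identityˡ (S j l)) (trans (skew l j) (sym (-1*i≡-i (S l j))))))
    square : ∀ i j → (S ⊗ S) i j ≡ - (+ 4 * + t + - 1ℤ) * δ i j + - (+ 2) * (outer u u i j + outer v v i j)
    square i j = begin
      (S ⊗ S) i j                                                         ≡⟨ isolate (δ i j) ((S ⊗ S) i j) ⟩
      δ i j + - (1ℤ * 1ℤ * δ i j + 1ℤ * - 1ℤ * (S ⊗ S) i j)               ≡⟨ cong (λ g → δ i j + - g) (shifts-⊗ 1ℤ (- 1ℤ) 1ℤ S i j refl) ⟨
      δ i j + - ((1ℤ •1+ 1ℤ • S) ⊗ (1ℤ •1+ - 1ℤ • S)) i j                 ≡⟨ cong (λ g → δ i j + - g) (product i j) ⟨
      δ i j + - (B · transpose B) i j                                     ≡⟨ cong (λ g → δ i j + - g) (trans (gram i j) (ewGram-blocks t i j)) ⟩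
      δ i j + - (+ 4 * + t * δ i j + + 2 * (outer u u i j + outer v v i j)) ≡⟨ collect (+ t) (δ i j) (outer u u i j + outer v v i j) ⟩
      - (+ 4 * + t + - 1ℤ) * δ i j + - (+ 2) * (outer u u i j + outer v v i j) ∎
      where
      isolate : ∀ d q → q ≡ d + - (1ℤ * 1ℤ * d + 1ℤ * - 1ℤ * q)
      isolate = solve-∀
      collect : ∀ T d x → d + - (+ 4 * T * d + + 2 * x) ≡ - (+ 4 * T + - 1ℤ) * d + - (+ 2) * x
      collect = solve-∀

  -- Conjugation by a diagonal sign matrix. Multiplying u and v by the same signs preserves their
  -- supports and norms.
  switch : ∀ {t N} (D : BlockSquare t N) (d : Fin N → ℤ) → (∀ i → d i * d i ≡ 1ℤ) → BlockSquare t N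
  switch {t} {N} D d d² = record
    { S = S′ ; skew = λ i j → trans (cong (λ s → d j * d i * s) (skew i j)) (negate (d i) (d j) (S i j))
    ; unit = λ {i} {j} i≢j → trans (squared (d i) (d j) (S i j)) (trans (cong₂ _*_ (cong₂ _*_ (d² i) (d² j)) (unit i≢j)) refl)
    ; u = u′ ; v = v′
    ; disjoint = λ i → trans (pair (d i) (u i) (v i)) (*-0 (d i * d i) (disjoint i))
    ; cover = λ i → trans (cong₂ _+_ (same u i) (same v i)) (cover i)
    ; uu = trans (sum-cong-≗ (same u)) uu ; vv = trans (sum-cong-≗ (same v)) vv
    ; square = square′ }
    where
    open BlockSquare D
    S′ : Mat ℤ N
    S′ i j = d i * d j * S i j
    u′ v′ : Fin N → ℤ
    u′ i = d i * u i
    v′ i = d i * v i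
    negate : ∀ x y s → y * x * - s ≡ - (x * y * s)
    negate = solve-∀
    squared : ∀ x y s → x * y * s * (x * y * s) ≡ x * x * (y * y) * (s * s)
    squared = solve-∀
    pair : ∀ x a b → x * a * (x * b) ≡ x * x * (a * b)
    pair = solve-∀
    same : ∀ (w : Fin N → ℤ) i → d i * w i * (d i * w i) ≡ w i * w i
    same w i = trans (pair (d i) (w i) (w i)) (trans (cong (_* (w i * w i)) (d² i)) (*-identityˡ (w i * w i)))
    through : ∀ x y z r s → x * y * r * (y * z * s) ≡ y * y * (x * z * (r * s))
    through = solve-∀
    δ-switch : ∀ i j → d i * d j * δ i j ≡ δ i j
    δ-switch i j with i ≟ j
    ... | yes refl = trans (cong (_* δ i i) (d² i)) (*-identityˡ (δ i i))
    ... | no i≢j   = trans (*-0 (d i * d j) (δ-off i≢j)) (sym (δ-off i≢j))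
    square′ : ∀ i j → (S′ ⊗ S′) i j ≡ - (+ 4 * + t + - 1ℤ) * δ i j + - (+ 2) * (outer u′ u′ i j + outer v′ v′ i j)
    square′ i j = begin
      sum (λ l → d i * d l * S i l * (d l * d j * S l j))         ≡⟨ sum-cong-≗ (λ l → trans (through (d i) (d l) (d j) (S i l) (S l j))
                                                                     (trans (cong (_* (d i * d j * (S i l * S l j))) (d² l)) (*-identityˡ (d i * d j * (S i l * S l j))))) ⟩
      sum (λ l → d i * d j * (S i l * S l j))                     ≡⟨ *-distribˡ-sum (d i * d j) (λ l → S i l * S l j) ⟨
      d i * d j * (S ⊗ S) i j                                     ≡⟨ cong (λ q → d i * d j * q) (square i j) ⟩
      d i * d j * (- a * δ i j + - (+ 2) * (outer u u i j + outer v v i j)) ≡⟨ distribute a (d i) (d j) (δ i j) (u i) (u j) (v i) (v j) ⟩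
      - a * (d i * d j * δ i j) + - (+ 2) * (outer u′ u′ i j + outer v′ v′ i j) ≡⟨ cong (λ e → - a * e + - (+ 2) * (outer u′ u′ i j + outer v′ v′ i j)) (δ-switch i j) ⟩
      - a * δ i j + - (+ 2) * (outer u′ u′ i j + outer v′ v′ i j) ∎
      where
      a : ℤ
      a = + 4 * + t + - 1ℤ
      distribute : ∀ a x y e p q r s → x * y * (- a * e + - (+ 2) * (p * q + r * s)) ≡
                   - a * (x * y * e) + - (+ 2) * ((x * p) * (y * q) + (x * r) * (y * s))
      distribute = solve-∀

  -- On ±1 this is (1 + x) / 2, and the zero diagonal stays zero.
  upper-half : ℤ → ℤ
  upper-half (+ 1) = 1ℤ
  upper-half _     = 0ℤ

  module ToTournament (t : ℕ) (t≥1 : t ℕ.≥ 1) (n : ℕ) (order : n ≡ 3 ℕ.+ (2 ℕ.* t ∸ 1) ℕ.* 2) (D₀ : BlockSquare t (suc n)) where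
    open Parameters t t≥1

    private
      module D₀ = BlockSquare D₀

    -- Switching by the first row of the matrix itself makes that row constant 1 off the diagonal,
    -- as the border of `charVal-tournament` requires.
    row-signs : Fin (suc n) → ℤ
    row-signs zero    = 1ℤ
    row-signs (suc j) = D₀.S zero (suc j)

    row-signs² : ∀ i → row-signs i * row-signs i ≡ 1ℤ
    row-signs² zero    = refl
    row-signs² (suc j) = D₀.unit (λ ())

    open BlockSquare (switch D₀ row-signs row-signs²)

    private
      module Reg = RegularSkew t t≥1 n order
      dot-uv : dot u v ≡ 0ℤ
      dot-uv = sum-zero disjoint

    R A : Mat ℤ n
    R i j = S (suc i) (suc j)
    A i j = upper-half (R i j)

    first-row : ∀ j → S zero (suc j) ≡ 1ℤ
    first-row j = trans (cong (_* row-signs (suc j)) (*-identityˡ (row-signs (suc j)))) (row-signs² (suc j))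

    S-diagonal : ∀ i → S i i ≡ 0ℤ
    S-diagonal i = i≡-i⇒i≡0 (S i i) (skew i i)

    S-bordered : S ≐ bordered 0ℤ (λ _ → 1ℤ) (λ _ → - 1ℤ) R
    S-bordered zero    zero    = S-diagonal zero
    S-bordered zero    (suc j) = first-row j
    S-bordered (suc i) zero    = trans (skew zero (suc i)) (cong -_ (first-row i))
    S-bordered (suc i) (suc j) = refl

    doubled : ∀ i j → + 2 * A i j ≡ 1ℤ + - δ i j + R i j
    doubled i j with i ≟ j
    ... | yes refl rewrite S-diagonal (suc i) | δ-diag i = refl
    ... | no i≢j with square-±1 (R i j) (unit (i≢j ∘ suc-injective))
    ... | inj₁ e rewrite e | δ-off i≢j = refl
    ... | inj₂ e rewrite e | δ-off i≢j = refl

    A-01 : ∀ x → upper-half x ≡ 0ℤ ⊎ upper-half x ≡ 1ℤ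
    A-01 (+ zero)        = inj₁ refl
    A-01 (+ 1)           = inj₂ refl
    A-01 (+ suc (suc _)) = inj₁ refl
    A-01 -[1+ _ ]        = inj₁ refl

    tournament : IsTournamentMatrix A
    tournament = (λ i j → A-01 (R i j)) , λ i j → cancelˡ {+ 2} (λ ()) _ _ (begin
      + 2 * (A i j + A j i)                                    ≡⟨ *-distribˡ-+ (+ 2) (A i j) (A j i) ⟩
      + 2 * A i j + + 2 * A j i                                ≡⟨ cong₂ _+_ (doubled i j) (doubled j i) ⟩
      1ℤ + - δ i j + R i j + (1ℤ + - δ j i + R j i)            ≡⟨ cong₂ (λ d r → 1ℤ + - δ i j + R i j + (1ℤ + - d + r)) (δ-sym j i) (skew (suc i) (suc j)) ⟩
      1ℤ + - δ i j + R i j + (1ℤ + - δ i j + - R i j)          ≡⟨ collect (δ i j) (R i j) ⟩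
      + 2 * (1ℤ + - δ i j)                                     ≡⟨ cong (λ x → + 2 * x) (off i j) ⟩
      + 2 * (if i == j then 0ℤ else 1ℤ)                        ∎)
      where
      collect : ∀ d r → 1ℤ + - d + r + (1ℤ + - d + - r) ≡ + 2 * (1ℤ + - d)
      collect = solve-∀
      off : ∀ i j → 1ℤ + - δ i j ≡ (if i == j then 0ℤ else 1ℤ)
      off i j with if-== i j 0ℤ 1ℤ
      ... | inj₁ (refl , eq) = trans (cong (λ d → 1ℤ + - d) (δ-diag i)) (sym eq)
      ... | inj₂ (i≢j , eq)  = trans (cong (λ d → 1ℤ + - d) (δ-off i≢j)) (sym eq)

    charVal-A : ∀ x → charVal A x ≡ targetVal t x
    charVal-A x = cancelˡ (^-≢0 {+ 2} n (λ ())) (charVal A x) (targetVal t x) (begin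
      (+ 2) ^ n * charVal A x
        ≡⟨ charVal-tournament A R doubled x ⟩
      (1ℤ + y) * charVal R y + - charVal (bordered 0ℤ (λ _ → 1ℤ) (λ _ → - 1ℤ) R) y
        ≡⟨ cong₂ (λ q p → (1ℤ + y) * q + - p) (Reg.principal-minor S skew u v uu vv dot-uv square (cover zero) y)
             (trans (det-ext (λ i j → cong (λ s → y * δ i j + - s) (sym (S-bordered i j)))) (Reg.charVal-from-square S skew u v uu vv dot-uv square y)) ⟩
      (1ℤ + y) * (ζ y ^ k * (y * (ζ y + + 4 * T))) + - (ζ y ^ suc k * (ζ y + (+ 4 * T + + 2)))
        ≡⟨ collect y (ζ y) (ζ y ^ k) (+ 4 * T) (ζ y + (+ 4 * T + + 2)) ⟩
      ζ y ^ k * ((1ℤ + y) * y * (ζ y + + 4 * T) + - (ζ y * (ζ y + (+ 4 * T + + 2))))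
        ≡⟨ targetVal-scaled x ⟨
      (+ 2) ^ (3 ℕ.+ k ℕ.* 2) * targetVal t x
        ≡⟨ cong (λ m → (+ 2) ^ m * targetVal t x) order ⟨
      (+ 2) ^ n * targetVal t x ∎)
      where
      y : ℤ
      y = double+1 x
      collect : ∀ y z p c w → (1ℤ + y) * (p * (y * (z + c))) + - (z * p * w) ≡ p * ((1ℤ + y) * y * (z + c) + - (z * w))
      collect = solve-∀

    charPoly-A : charPoly A ≈ₚ targetPoly t
    charPoly-A = rep-unique (rep-charPoly A) (rep-target t) (λ m → charVal-A (+ suc m))

open BlockSquares

-- An integral Cayley-Hamilton argument giving W² = 2hW

module CayleyHamilton where
  open import Data.Integer using (+_; _+_; _*_; -_; _^_)

  ℕsum-mono : ∀ {n} {f g : Fin n → ℕ} → (∀ i → f i ℕ.≤ g i) → ℕsum f ℕ.≤ ℕsum g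
  ℕsum-mono {zero}  f≤g = z≤n
  ℕsum-mono {suc n} f≤g = ℕ.+-mono-≤ (f≤g zero) (ℕsum-mono (f≤g ∘ suc))

  ≤-ℕsum : ∀ {n} (f : Fin n → ℕ) i → f i ℕ.≤ ℕsum f
  ≤-ℕsum f zero    = ℕ.m≤m+n (f zero) _
  ≤-ℕsum f (suc i) = ℕ.≤-trans (≤-ℕsum (f ∘ suc) i) (ℕ.m≤n+m _ (f zero))

  ℕsum-const : ∀ n c → ℕsum {n} (λ _ → c) ≡ n ℕ.* c
  ℕsum-const zero    c = refl
  ℕsum-const (suc n) c = cong (λ s → c ℕ.+ s) (ℕsum-const n c)

  abs-sum : ∀ {n} (f : Fin n → ℤ) → ∣ sum f ∣ ℕ.≤ ℕsum (λ i → ∣ f i ∣)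
  abs-sum {zero}  f = z≤n
  abs-sum {suc n} f = ℕ.≤-trans (∣i+j∣≤∣i∣+∣j∣ (f zero) (sum (f ∘ suc))) (ℕ.+-monoʳ-≤ ∣ f zero ∣ (abs-sum (f ∘ suc)))

  -- Summing the absolute values of a column of yG = Z + SG shows that G vanishes once y is large compared with Z.
  large-shift-divides : ∀ {n} (S Z G : Mat ℤ n) m → (∀ i j → ∣ S i j ∣ ℕ.≤ 1) →
                        n ℕ.+ suc (ℕsum (λ j → ℕsum (λ i → ∣ Z i j ∣))) ℕ.≤ m →
                        (+ m •1+ - 1ℤ • S) ⊗ G ≐ Z → ∀ i j → Z i j ≡ 0ℤ
  large-shift-divides {n} S Z G m S≤1 large eq i j = trans (sym (eq i j)) (sum-zero (λ l → *-0 ((+ m •1+ - 1ℤ • S) i l) (G≡0 l)))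
    where
    Γ β : ℕ
    Γ = ℕsum (λ l → ∣ G l j ∣)
    β = ℕsum (λ i → ∣ Z i j ∣)
    row : ∀ i → m ℕ.* ∣ G i j ∣ ℕ.≤ ∣ Z i j ∣ ℕ.+ Γ
    row i = begin
      m ℕ.* ∣ G i j ∣                          ≡⟨ abs-* (+ m) (G i j) ⟨
      ∣ + m * G i j ∣                          ≡⟨ cong ∣_∣ (trans (isolate (+ m * G i j) ((S ⊗ G) i j))
                                                    (cong (λ z → z + (S ⊗ G) i j) (trans (sym (•1+-⊗ (+ m) (- 1ℤ) S G i j)) (eq i j)))) ⟩
      ∣ Z i j + (S ⊗ G) i j ∣                  ≤⟨ ∣i+j∣≤∣i∣+∣j∣ (Z i j) ((S ⊗ G) i j) ⟩
      ∣ Z i j ∣ ℕ.+ ∣ (S ⊗ G) i j ∣            ≤⟨ ℕ.+-monoʳ-≤ ∣ Z i j ∣ (ℕ.≤-trans (abs-sum (λ l → S i l * G l j)) (ℕsum-mono term)) ⟩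
      ∣ Z i j ∣ ℕ.+ Γ                          ∎
      where
      open ℕ.≤-Reasoning
      isolate : ∀ x y → x ≡ (x + - 1ℤ * y) + y
      isolate = solve-∀
      term : ∀ l → ∣ S i l * G l j ∣ ℕ.≤ ∣ G l j ∣
      term l = ℕ.≤-trans (ℕ.≤-reflexive (abs-* (S i l) (G l j)))
        (ℕ.≤-trans (ℕ.*-monoˡ-≤ ∣ G l j ∣ (S≤1 i l)) (ℕ.≤-reflexive (ℕ.*-identityˡ ∣ G l j ∣)))
    -- As m is at least n + 1 + β, cancelling n Γ leaves (β + 1) Γ ≤ β, which forces Γ = 0.
    column : n ℕ.* Γ ℕ.+ suc β ℕ.* Γ ℕ.≤ n ℕ.* Γ ℕ.+ β
    column = begin
      n ℕ.* Γ ℕ.+ suc β ℕ.* Γ                  ≡⟨ ℕ.*-distribʳ-+ Γ n (suc β) ⟨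
      (n ℕ.+ suc β) ℕ.* Γ                      ≤⟨ ℕ.*-monoˡ-≤ Γ (ℕ.≤-trans (ℕ.+-monoʳ-≤ n (s≤s (≤-ℕsum (λ j → ℕsum (λ i → ∣ Z i j ∣)) j))) large) ⟩
      m ℕ.* Γ                                  ≡⟨ ℕ*-distribˡ-sum m (λ l → ∣ G l j ∣) ⟩
      ℕsum (λ l → m ℕ.* ∣ G l j ∣)             ≤⟨ ℕsum-mono row ⟩
      ℕsum (λ l → ∣ Z l j ∣ ℕ.+ Γ)             ≡⟨ ℕ∑-distrib-+ (λ l → ∣ Z l j ∣) (λ _ → Γ) ⟩
      β ℕ.+ ℕsum {n} (λ _ → Γ)                 ≡⟨ cong (λ s → β ℕ.+ s) (ℕsum-const n Γ) ⟩
      β ℕ.+ n ℕ.* Γ                            ≡⟨ ℕ.+-comm β (n ℕ.* Γ) ⟩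
      n ℕ.* Γ ℕ.+ β                            ∎
      where open ℕ.≤-Reasoning
    vanish : ∀ x → suc β ℕ.* x ℕ.≤ β → x ≡ 0
    vanish zero    _  = refl
    vanish (suc x) le = contradiction (ℕ.≤-trans (ℕ.m≤m*n (suc β) (suc x)) le) ℕ.1+n≰n
    G≡0 : ∀ l → G l j ≡ 0ℤ
    G≡0 l = ∣i∣≡0⇒i≡0 (ℕ.n≤0⇒n≡0 (subst (λ g → ∣ G l j ∣ ℕ.≤ g) (vanish Γ (ℕ.+-cancelˡ-≤ (n ℕ.* Γ) _ _ column)) (≤-ℕsum (λ l → ∣ G l j ∣) l)))

  sum-squares : ∀ {n} (f : Fin n → ℤ) → sum (λ i → f i * f i) ≡ + ℕsum (λ i → ∣ f i ∣ ℕ.* ∣ f i ∣)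
  sum-squares {zero}  f = refl
  sum-squares {suc n} f = cong₂ _+_ (square-abs (f zero)) (sum-squares (f ∘ suc))

  sum-squares-zero : ∀ {n} (f : Fin n → ℤ) → sum (λ i → f i * f i) ≡ 0ℤ → ∀ i → f i ≡ 0ℤ
  sum-squares-zero f e i = ∣i∣≡0⇒i≡0 (reduce (ℕ.m*n≡0⇒m≡0∨n≡0 ∣ f i ∣ (ℕ.n≤0⇒n≡0
    (subst (λ s → ∣ f i ∣ ℕ.* ∣ f i ∣ ℕ.≤ s) (+-injective (trans (sym (sum-squares f)) e)) (≤-ℕsum (λ i → ∣ f i ∣ ℕ.* ∣ f i ∣) i)))))

  Symmetric : ∀ {n} → Mat ℤ n → Set
  Symmetric W = ∀ i j → W i j ≡ W j i

  open ≡-Reasoning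

  -- |WV|² = Vᵀ W (WV).
  symmetric-reduced : ∀ {n} (W V : Mat ℤ n) → Symmetric W → (∀ i j → (W ⊗ (W ⊗ V)) i j ≡ 0ℤ) → ∀ i j → (W ⊗ V) i j ≡ 0ℤ
  symmetric-reduced W V symmetric WWV≡0 i j = sum-squares-zero (λ i → (W ⊗ V) i j) (begin
    sum (λ i → (W ⊗ V) i j * (W ⊗ V) i j)
      ≡⟨ sum-cong-≗ (λ i → *-distribʳ-sum ((W ⊗ V) i j) (λ m → W i m * V m j)) ⟩
    sum (λ i → sum (λ m → W i m * V m j * (W ⊗ V) i j))
      ≡⟨ ∑-comm (λ i m → W i m * V m j * (W ⊗ V) i j) ⟩
    sum (λ m → sum (λ i → W i m * V m j * (W ⊗ V) i j))
      ≡⟨ sum-zero (λ m → trans (sum-cong-≗ (λ i → trans (cong (λ w → w * V m j * (W ⊗ V) i j) (symmetric i m)) (shuffle (W m i) (V m j) ((W ⊗ V) i j))))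
           (trans (sym (*-distribˡ-sum (V m j) (λ i → W m i * (W ⊗ V) i j))) (*-0 (V m j) (WWV≡0 m j)))) ⟩
    0ℤ ∎) i
    where
    shuffle : ∀ w v x → w * v * x ≡ v * (w * x)
    shuffle = solve-∀

  -- The characteristic polynomial is assumed at odd y = 2x + 1 only, since these are the values a
  -- tournament supplies.
  module Reduction (t : ℕ) (t≥1 : t ℕ.≥ 1) {N : ℕ} (S : Mat ℤ N) (skew : Skew S) (S≤1 : ∀ i j → ∣ S i j ∣ ℕ.≤ 1)
                   (charVal-S : ∀ x → charVal S (Parameters.double+1 t t≥1 x) ≡
                      Parameters.ζ t t≥1 (Parameters.double+1 t t≥1 x) ^ suc (Parameters.k t t≥1) *
                      (Parameters.ζ t t≥1 (Parameters.double+1 t t≥1 x) + (+ 4 * + t + + 2))) where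
    open Parameters t t≥1

    2h : ℤ
    2h = + 4 * T + + 2

    -- S Sᵀ - (4t - 1) I, as S² = -S Sᵀ for skew S.
    W : Mat ℤ N
    W = (- (+ 4 * T + - 1ℤ)) •1+ - 1ℤ • (S ⊗ S)

    -- Up to left multiples of yI - S, the scalar y² + 4t - 1 is -W, so (y² + 4t - 1)^j (y² + 8t + 1) is remainder j.
    remainder : ℕ → Mat ℤ N
    remainder zero    = 2h •1+ - 1ℤ • W
    remainder (suc j) = λ i l → - (W ⊗ remainder j) i l

    module _ (y : ℤ) where
      private
        M U : Mat ℤ N
        M = y •1+ - 1ℤ • S
        U = y •1+ 1ℤ • S

      M⊗U : M ⊗ U ≐ (ζ y •1+ 1ℤ • W)
      M⊗U i l = trans (shifts-⊗ (- 1ℤ) 1ℤ y S i l refl) (collect y (+ 4 * T + - 1ℤ) (δ i l) ((S ⊗ S) i l))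
        where
        collect : ∀ y a d q → y * y * d + - 1ℤ * 1ℤ * q ≡ (y * y + a) * d + 1ℤ * (- a * d + - 1ℤ * q)
        collect = solve-∀

      -- In ζ (M X + Y) the last summand is ζY = M (U Y) - W Y, so the quotient becomes ζX + U Y and
      -- the remainder -W Y.
      division : ∀ j → Σ (Mat ℤ N) λ X → ∀ i l → ζ y ^ j * (ζ y + 2h) * δ i l ≡ (M ⊗ X) i l + remainder j i l
      division zero = U , λ i l → sym (trans (cong (λ x → x + remainder 0 i l) (M⊗U i l)) (collect (ζ y) 2h (δ i l) (W i l)))
        where
        collect : ∀ z h d w → (z * d + 1ℤ * w) + (h * d + - 1ℤ * w) ≡ 1ℤ * (z + h) * d
        collect = solve-∀
      division (suc j) with division j
      ... | X , eq = (λ i l → ζ y * X i l + 1ℤ * (U ⊗ Y) i l) , λ i l → begin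
        ζ y * ζ y ^ j * (ζ y + 2h) * δ i l
          ≡⟨ regroup (ζ y) (ζ y ^ j) (ζ y + 2h) (δ i l) ⟩
        ζ y * (ζ y ^ j * (ζ y + 2h) * δ i l)
          ≡⟨ cong (λ x → ζ y * x) (eq i l) ⟩
        ζ y * ((M ⊗ X) i l + Y i l)
          ≡⟨ collect (ζ y) ((M ⊗ X) i l) (Y i l) ((W ⊗ Y) i l) ⟩
        ζ y * (M ⊗ X) i l + 1ℤ * (ζ y * Y i l + 1ℤ * (W ⊗ Y) i l) + - (W ⊗ Y) i l
          ≡⟨ cong (λ x → ζ y * (M ⊗ X) i l + 1ℤ * x + - (W ⊗ Y) i l) (M⊗U⊗Y i l) ⟨
        ζ y * (M ⊗ X) i l + 1ℤ * (M ⊗ (U ⊗ Y)) i l + - (W ⊗ Y) i l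
          ≡⟨ cong (λ x → x + - (W ⊗ Y) i l) (⊗-linearʳ (ζ y) 1ℤ M X (U ⊗ Y) i l) ⟨
        (M ⊗ (λ i l → ζ y * X i l + 1ℤ * (U ⊗ Y) i l)) i l + - (W ⊗ Y) i l ∎
        where
        Y : Mat ℤ N
        Y = remainder j
        M⊗U⊗Y : ∀ i l → (M ⊗ (U ⊗ Y)) i l ≡ ζ y * Y i l + 1ℤ * (W ⊗ Y) i l
        M⊗U⊗Y i l = trans (sym (⊗-assoc M U Y i l)) (trans (⊗-cong {M = M ⊗ U} {N = Y} M⊗U (λ _ _ → refl) i l) (•1+-⊗ (ζ y) 1ℤ W Y i l))
        regroup : ∀ z p w d → z * p * w * d ≡ z * (p * w * d)
        regroup = solve-∀
        collect : ∀ z m x w → z * (m + x) ≡ z * m + 1ℤ * (z * x + 1ℤ * w) + - w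
        collect = solve-∀

    -- M adj(M) and M X + Z are the same scalar matrix, so M (adj(M) - X) = Z for a Z that does not
    -- involve y.
    remainder-vanishes : ∀ i l → remainder (suc k) i l ≡ 0ℤ
    remainder-vanishes = large-shift-divides S Z G m S≤1 large M⊗G
      where
      Z : Mat ℤ N
      Z = remainder (suc k)
      -- Chosen so that m is odd, hence of the form for which `charVal-S` is available, and beyond
      -- the bound of `large-shift-divides`.
      x m : ℕ
      x = N ℕ.+ ℕsum (λ j → ℕsum (λ i → ∣ Z i j ∣))
      m = 2 ℕ.* x ℕ.+ 1
      large : N ℕ.+ suc (ℕsum (λ j → ℕsum (λ i → ∣ Z i j ∣))) ℕ.≤ m
      large = ℕ.≤-trans (ℕ.≤-reflexive (trans (ℕ.+-suc N _) (ℕ.+-comm 1 x))) (ℕ.+-monoˡ-≤ 1 (ℕ.m≤n*m x 2))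
      odd : + m ≡ double+1 (+ x)
      odd = cong (λ a → a + 1ℤ) (pos-* 2 x)
      M : Mat ℤ N
      M = + m •1+ - 1ℤ • S
      det-M : detℤ M ≡ ζ (+ m) ^ suc k * (ζ (+ m) + 2h)
      det-M = trans (charVal-det S (+ m)) (subst (λ y → charVal S y ≡ ζ y ^ suc k * (ζ y + 2h)) (sym odd) (charVal-S (+ x)))
      X G : Mat ℤ N
      X = proj₁ (division (+ m) (suc k))
      G i l = 1ℤ * cofactor M i l + - 1ℤ * X i l
      M⊗G : M ⊗ G ≐ Z
      M⊗G i l = begin
        (M ⊗ G) i l                                          ≡⟨ ⊗-linearʳ 1ℤ (- 1ℤ) M (cofactor M) X i l ⟩
        1ℤ * (M ⊗ cofactor M) i l + - 1ℤ * (M ⊗ X) i l       ≡⟨ cong (λ c → 1ℤ * c + - 1ℤ * (M ⊗ X) i l)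
                                                                 (trans (⊗-cofactor M i l) (trans (cong (_* δ i l) det-M) (proj₂ (division (+ m) (suc k)) i l))) ⟩
        1ℤ * ((M ⊗ X) i l + Z i l) + - 1ℤ * (M ⊗ X) i l      ≡⟨ collect ((M ⊗ X) i l) (Z i l) ⟩
        Z i l                                                ∎
        where
        collect : ∀ x z → 1ℤ * (x + z) + - 1ℤ * x ≡ z
        collect = solve-∀

    W-symmetric : Symmetric W
    W-symmetric i j = cong₂ (λ d q → - (+ 4 * T + - 1ℤ) * d + - 1ℤ * q) (δ-sym i j) (skew-square-symmetric {S = S} skew i j)

    -- A remainder is ±W^j (2hI - W). Symmetry of W lets `symmetric-reduced` strip the powers of W
    -- one at a time, down to the first.
    W⊗remainder : ∀ j → (∀ i l → remainder (suc j) i l ≡ 0ℤ) → ∀ i l → (W ⊗ remainder 0) i l ≡ 0ℤ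
    W⊗remainder zero    zero-at i l = neg-injective (zero-at i l)
    W⊗remainder (suc j) zero-at = W⊗remainder j (λ i l → cong -_ (symmetric-reduced W (remainder j) W-symmetric
      (λ i l → trans (sym (trans (cong -_ (negated i l)) (neg-involutive _))) (zero-at i l)) i l))
      where
      negated : ∀ i l → (W ⊗ remainder (suc j)) i l ≡ - (W ⊗ (W ⊗ remainder j)) i l
      negated i l = trans (sum-cong-≗ (λ m → trans (sym (neg-distribʳ-* (W i m) ((W ⊗ remainder j) m l))) (sym (-1*i≡-i _))))
        (trans (sym (*-distribˡ-sum (- 1ℤ) (λ m → W i m * (W ⊗ remainder j) m l))) (-1*i≡-i _))

    W⊗W : W ⊗ W ≐ (λ i j → 2h * W i j)
    W⊗W i j = begin
      (W ⊗ W) i j                                            ≡⟨ isolate (2h * W i j) ((W ⊗ W) i j) ⟩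
      2h * W i j + - (2h * W i j + - 1ℤ * (W ⊗ W) i j)       ≡⟨ cong (λ x → 2h * W i j + - x) (trans (sym (⊗-•1+ 2h (- 1ℤ) W W i j)) (W⊗remainder k remainder-vanishes i j)) ⟩
      2h * W i j + 0ℤ                                        ≡⟨ +-identityʳ (2h * W i j) ⟩
      2h * W i j                                             ∎
      where
      isolate : ∀ x q → q ≡ x + - (x + - 1ℤ * q)
      isolate = solve-∀

open CayleyHamilton

-- Integer Gram matrices with unit diagonal and K² = hK

module UnitGramMatrices where
  open import Data.Integer using (+_; _+_; _*_; -_)
  open ≡-Reasoning

  sum-one : ∀ n → sum {n} (λ _ → 1ℤ) ≡ + n
  sum-one zero    = refl
  sum-one (suc n) = cong (λ s → 1ℤ + s) (sum-one n)

  -- K is a multiple of a projection with unit diagonal, hence the Gram matrix of vectors ±e, ±f with e ⊥ f.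
  module UnitGram {N : ℕ} (h : ℕ) (twice : + N ≡ + 2 * + suc h) (K : Mat ℤ N) (symmetric : Symmetric K)
                  (diagonal : ∀ i → K i i ≡ 1ℤ) (K⊗K : ∀ i j → (K ⊗ K) i j ≡ + suc h * K i j) where

    -- Used with c = ±1, where nonnegativity of the norm bounds the entries, and with c = -K i j for
    -- an entry ±1, where the norm is zero and the rows are proportional.
    combination-norm : ∀ c → c * c ≡ 1ℤ → ∀ i j →
      sum (λ l → (K i l + c * K j l) * (K i l + c * K j l)) ≡ + 2 * + suc h * (1ℤ + c * K i j)
    combination-norm c c²≡1 i j = begin
      sum (λ l → (K i l + c * K j l) * (K i l + c * K j l))
        ≡⟨ sum-cong-≗ (λ l → trans (expand c (K i l) (K j l)) (cong₂ (λ x y → 1ℤ * (K i l * x) + c * (+ 2 * (K i l * y) + c * (K j l * y))) (symmetric i l) (symmetric j l))) ⟩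
      sum (λ l → 1ℤ * (K i l * K l i) + c * (+ 2 * (K i l * K l j) + c * (K j l * K l j)))
        ≡⟨ sum-linear 1ℤ c (λ l → K i l * K l i) (λ l → + 2 * (K i l * K l j) + c * (K j l * K l j)) ⟩
      1ℤ * (K ⊗ K) i i + c * sum (λ l → + 2 * (K i l * K l j) + c * (K j l * K l j))
        ≡⟨ cong (λ s → 1ℤ * (K ⊗ K) i i + c * s) (sum-linear (+ 2) c (λ l → K i l * K l j) (λ l → K j l * K l j)) ⟩
      1ℤ * (K ⊗ K) i i + c * (+ 2 * (K ⊗ K) i j + c * (K ⊗ K) j j)
        ≡⟨ cong₂ (λ x y → 1ℤ * x + c * (+ 2 * (K ⊗ K) i j + c * y)) (norm i) (norm j) ⟩
      1ℤ * H + c * (+ 2 * (K ⊗ K) i j + c * H)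
        ≡⟨ cong (λ x → 1ℤ * H + c * (+ 2 * x + c * H)) (K⊗K i j) ⟩
      1ℤ * H + c * (+ 2 * (H * K i j) + c * H)
        ≡⟨ collect H c (K i j) ⟩
      H * (1ℤ + + 2 * c * K i j + c * c)
        ≡⟨ cong (λ e → H * (1ℤ + + 2 * c * K i j + e)) c²≡1 ⟩
      H * (1ℤ + + 2 * c * K i j + 1ℤ)
        ≡⟨ factor H c (K i j) ⟩
      + 2 * H * (1ℤ + c * K i j) ∎
      where
      H : ℤ
      H = + suc h
      norm : ∀ i → (K ⊗ K) i i ≡ H
      norm i = trans (K⊗K i i) (trans (cong (λ x → H * x) (diagonal i)) (*-identityʳ H))
      expand : ∀ c x y → (x + c * y) * (x + c * y) ≡ 1ℤ * (x * x) + c * (+ 2 * (x * y) + c * (y * y))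
      expand = solve-∀
      collect : ∀ H c x → 1ℤ * H + c * (+ 2 * (H * x) + c * H) ≡ H * (1ℤ + + 2 * c * x + c * c)
      collect = solve-∀
      factor : ∀ H c x → H * (1ℤ + + 2 * c * x + 1ℤ) ≡ + 2 * H * (1ℤ + c * x)
      factor = solve-∀

    nonnegative-factor : ∀ q z {m} → + suc q * z ≡ + m → Σ ℕ λ p → z ≡ + p
    nonnegative-factor q (+ p) _ = p , refl

    bounded : ∀ c → c * c ≡ 1ℤ → ∀ i j → Σ ℕ λ p → 1ℤ + c * K i j ≡ + p
    -- `h + 1 * suc h` is the predecessor of 2 (h + 1), in the form to which that product reduces.
    bounded c c² i j = nonnegative-factor (h ℕ.+ 1 ℕ.* suc h) (1ℤ + c * K i j) (trans (sym (combination-norm c c² i j)) (sum-squares (λ l → K i l + c * K j l)))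

    sign-entry : ∀ i j → K i j ≡ 0ℤ ⊎ K i j * K i j ≡ 1ℤ
    sign-entry i j = cases (K i j)
        (subst (λ x → Σ ℕ λ p → 1ℤ + x ≡ + p) (*-identityˡ (K i j)) (bounded 1ℤ refl i j))
        (subst (λ x → Σ ℕ λ p → 1ℤ + x ≡ + p) (-1*i≡-i (K i j)) (bounded (- 1ℤ) refl i j))
      where
      cases : ∀ x → (Σ ℕ λ p → 1ℤ + x ≡ + p) → (Σ ℕ λ p → 1ℤ + - x ≡ + p) → x ≡ 0ℤ ⊎ x * x ≡ 1ℤ
      cases (+ 0)           _        _        = inj₁ refl
      cases (+ 1)           _        _        = inj₂ refl
      cases (+ suc (suc n)) _        (_ , ())
      cases -[1+ 0 ]        _        _        = inj₂ refl
      cases -[1+ suc n ]    (_ , ()) _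

    proportional : ∀ i j → K i j * K i j ≡ 1ℤ → ∀ l → K i l ≡ K i j * K j l
    proportional i j e l = trans (isolate (K i l) (K i j) (K j l)) (trans (cong (_+ K i j * K j l)
        (sum-squares-zero (λ l → K i l + - K i j * K j l) (trans (combination-norm (- K i j) (trans (signs (K i j)) e) i j) vanish) l)) (+-identityˡ (K i j * K j l)))
      where
      isolate : ∀ x c y → x ≡ (x + - c * y) + c * y
      isolate = solve-∀
      signs : ∀ x → - x * - x ≡ x * x
      signs = solve-∀
      vanish : + 2 * + suc h * (1ℤ + - K i j * K i j) ≡ 0ℤ
      vanish = *-0 (+ 2 * + suc h) (trans (cong (λ x → 1ℤ + x) (trans (sym (neg-distribˡ-* (K i j) (K i j))) (cong -_ e))) refl)

    -- Proportionality of rows multiplied by K i j, so that it also holds for K i j = 0 and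
    -- `K-blocks` needs no cases.
    weighted : ∀ i j l → K i j * K i l ≡ K i j * K i j * K j l
    weighted i j l = from (sign-entry i j)
      where
      from : K i j ≡ 0ℤ ⊎ K i j * K i j ≡ 1ℤ → K i j * K i l ≡ K i j * K i j * K j l
      from (inj₁ e) = trans (0-* (K i l) e) (sym (0-* (K j l) (0-* (K i j) e)))
      from (inj₂ e) = trans (cong (λ x → K i j * x) (proportional i j e l)) (sym (*-assoc (K i j) (K i j) (K j l)))

    row-norm : ∀ i → dot (K i) (K i) ≡ + suc h
    row-norm i = trans (sum-cong-≗ (λ l → cong (λ x → K i l * x) (symmetric i l)))
      (trans (K⊗K i i) (trans (cong (λ x → + suc h * x) (diagonal i)) (*-identityʳ (+ suc h))))

    -- A row without zeros would have norm N, twice the value in `row-norm`.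
    zero-entry : ∀ i → Σ (Fin N) λ j → K i j ≡ 0ℤ
    zero-entry i with any? (λ j → K i j ℤ.≟ 0ℤ)
    ... | yes found = found
    ... | no none = contradiction (sym (ℕ.suc-injective (+-injective (trans (sym (row-norm i)) (trans (sum-cong-≗ all-units) (trans (sum-one N) twice)))))) (ℕ.m+1+n≢m h)
      where
      all-units : ∀ l → K i l * K i l ≡ 1ℤ
      all-units l = fromInj₂ (λ e → contradiction (l , e) none) (sign-entry i l)

    module _ (i₀ : Fin N) where
      private
        j₀ : Fin N
        j₀ = proj₁ (zero-entry i₀)

      u v : Fin N → ℤ
      u = K i₀
      v = K j₀

      -- Where u l is nonzero, proportionality makes u l * v l equal to K i₀ j₀, which is zero by
      -- the choice of j₀.
      disjoint : ∀ l → u l * v l ≡ 0ℤ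
      disjoint l = from (sign-entry i₀ l)
        where
        from : K i₀ l ≡ 0ℤ ⊎ K i₀ l * K i₀ l ≡ 1ℤ → u l * v l ≡ 0ℤ
        from (inj₁ e) = 0-* (v l) e
        from (inj₂ e) = begin
          K i₀ l * K j₀ l     ≡⟨ cong (λ x → K i₀ l * x) (symmetric j₀ l) ⟩
          K i₀ l * K l j₀     ≡⟨ proportional i₀ l e j₀ ⟨
          K i₀ j₀             ≡⟨ proj₂ (zero-entry i₀) ⟩
          0ℤ                  ∎

      uncovered : Fin N → ℤ
      uncovered l = 1ℤ + - (u l * u l + v l * v l)

      uncovered-idem : ∀ l → uncovered l * uncovered l ≡ uncovered l
      uncovered-idem l = idem (u l) (v l) (sign-entry i₀ l) (sign-entry j₀ l) (disjoint l)
        where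
        square-idem : ∀ {x} → x ≡ 0ℤ ⊎ x * x ≡ 1ℤ → x * x * (x * x) ≡ x * x
        square-idem (inj₁ refl) = refl
        square-idem (inj₂ e)    = trans (cong₂ _*_ e e) (sym e)
        expand : ∀ x y → (1ℤ + - (x * x + y * y)) * (1ℤ + - (x * x + y * y)) ≡
                 1ℤ + - (+ 2 * (x * x) + + 2 * (y * y)) + (x * x * (x * x) + y * y * (y * y)) + + 2 * ((x * y) * (x * y))
        expand = solve-∀
        collect : ∀ a b → 1ℤ + - (+ 2 * a + + 2 * b) + (a + b) + + 2 * (0ℤ * 0ℤ) ≡ 1ℤ + - (a + b)
        collect = solve-∀
        idem : ∀ x y → x ≡ 0ℤ ⊎ x * x ≡ 1ℤ → y ≡ 0ℤ ⊎ y * y ≡ 1ℤ → x * y ≡ 0ℤ →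
               (1ℤ + - (x * x + y * y)) * (1ℤ + - (x * x + y * y)) ≡ 1ℤ + - (x * x + y * y)
        idem x y sx sy xy≡0 = trans (expand x y)
          (trans (cong₂ (λ a b → 1ℤ + - (+ 2 * (x * x) + + 2 * (y * y)) + a + + 2 * (b * b)) (cong₂ _+_ (square-idem sx) (square-idem sy)) xy≡0)
                 (collect (x * x) (y * y)))

      -- `uncovered` is the 0/1 indicator of the indices outside both supports. Its squares sum to N
      -- minus the two row norms, that is, to zero.
      cover : ∀ l → u l * u l + v l * v l ≡ 1ℤ
      cover l = trans (isolate (u l * u l + v l * v l)) (cong (λ x → 1ℤ + - x) (sum-squares-zero uncovered total l))
        where
        isolate : ∀ x → x ≡ 1ℤ + - (1ℤ + - x)
        isolate = solve-∀
        total : sum (λ l → uncovered l * uncovered l) ≡ 0ℤ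
        total = begin
          sum (λ l → uncovered l * uncovered l)                       ≡⟨ sum-cong-≗ (λ l → trans (uncovered-idem l) (linear (u l * u l) (v l * v l))) ⟩
          sum (λ l → 1ℤ * 1ℤ + - 1ℤ * (u l * u l + v l * v l))        ≡⟨ sum-linear 1ℤ (- 1ℤ) (λ _ → 1ℤ) (λ l → u l * u l + v l * v l) ⟩
          1ℤ * sum {N} (λ _ → 1ℤ) + - 1ℤ * sum (λ l → u l * u l + v l * v l)
            ≡⟨ cong₂ (λ x y → 1ℤ * x + - 1ℤ * y) (trans (sum-one N) twice) (trans (∑-distrib-+ (λ l → u l * u l) (λ l → v l * v l)) (cong₂ _+_ (row-norm i₀) (row-norm j₀))) ⟩
          1ℤ * (+ 2 * + suc h) + - 1ℤ * (+ suc h + + suc h)           ≡⟨ cancel (+ suc h) ⟩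
          0ℤ                                                          ∎
          where
          linear : ∀ x y → 1ℤ + - (x + y) ≡ 1ℤ * 1ℤ + - 1ℤ * (x + y)
          linear = solve-∀
          cancel : ∀ H → 1ℤ * (+ 2 * H) + - 1ℤ * (H + H) ≡ 0ℤ
          cancel = solve-∀

      K-blocks : ∀ i j → K i j ≡ outer u u i j + outer v v i j
      K-blocks i j = sym (begin
        u i * u j + v i * v j                       ≡⟨ cong₂ _+_ (weighted i₀ i j) (weighted j₀ i j) ⟩
        u i * u i * K i j + v i * v i * K i j       ≡⟨ *-distribʳ-+ (K i j) (u i * u i) (v i * v i) ⟨
        (u i * u i + v i * v i) * K i j             ≡⟨ cong (_* K i j) (cover i) ⟩
        1ℤ * K i j                                  ≡⟨ *-identityˡ (K i j) ⟩
        K i j                                       ∎)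

open UnitGramMatrices

-- From a tournament back to a block square

module Tournaments where
  open import Data.Integer using (+_; _+_; _*_; -_; _^_)
  open ≡-Reasoning

  monic-cong : ∀ {n p q} → p ≈ₚ q → Monic n p → Monic n q
  monic-cong {n} p≈q (lead , bound) = trans (sym (p≈q n)) lead , λ k n<k → trans (sym (p≈q k)) (bound k n<k)

  sum-except : ∀ {n} (i : Fin n) (f : Fin n → ℤ) → sum (λ l → (1ℤ + - δ i l) * f l) ≡ sum f + - f i
  sum-except i f = begin
    sum (λ l → (1ℤ + - δ i l) * f l)              ≡⟨ sum-cong-≗ (λ l → expand (δ i l) (f l)) ⟩
    sum (λ l → 1ℤ * f l + - 1ℤ * (δ i l * f l))   ≡⟨ sum-linear 1ℤ (- 1ℤ) f (λ l → δ i l * f l) ⟩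
    1ℤ * sum f + - 1ℤ * sum (λ l → δ i l * f l)   ≡⟨ cong₂ _+_ (*-identityˡ (sum f)) (trans (-1*i≡-i _) (cong -_ (sum-δˡ i f))) ⟩
    sum f + - f i                                 ∎
    where
    expand : ∀ d x → (1ℤ + - d) * x ≡ 1ℤ * x + - 1ℤ * (d * x)
    expand = solve-∀

  module FromTournament (t : ℕ) (t≥1 : t ℕ.≥ 1) {n : ℕ} (A : Mat ℤ n) (tournament : IsTournamentMatrix A)
                        (charPoly-A : charPoly A ≈ₚ targetPoly t) where
    open Parameters t t≥1

    order : n ≡ 3 ℕ.+ k ℕ.* 2
    order = monic-degree {p = targetPoly t} (monic-cong {n} {charPoly A} {targetPoly t} charPoly-A (monic-charPoly A)) (monic-target t)

    R : Mat ℤ n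
    R i j = A i j + - A j i

    S : Mat ℤ (suc n)
    S = bordered 0ℤ (λ _ → 1ℤ) (λ _ → - 1ℤ) R

    A+Aᵀ : ∀ i j → A i j + A j i ≡ 1ℤ + - δ i j
    A+Aᵀ i j with if-== i j 0ℤ 1ℤ
    ... | inj₁ (refl , eq) = trans (proj₂ tournament i i) (trans eq (cong (λ d → 1ℤ + - d) (sym (δ-diag i))))
    ... | inj₂ (i≢j , eq)  = trans (proj₂ tournament i j) (trans eq (cong (λ d → 1ℤ + - d) (sym (δ-off i≢j))))

    R-skew : Skew R
    R-skew i j = flip-sign (A i j) (A j i)
      where
      flip-sign : ∀ x y → y + - x ≡ - (x + - y)
      flip-sign = solve-∀

    S-skew : Skew S
    S-skew zero    zero    = refl
    S-skew zero    (suc j) = refl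
    S-skew (suc i) zero    = refl
    S-skew (suc i) (suc j) = R-skew i j

    doubled : ∀ i j → + 2 * A i j ≡ 1ℤ + - δ i j + R i j
    doubled i j = trans (split (A i j) (A j i)) (cong (_+ R i j) (A+Aᵀ i j))
      where
      split : ∀ x y → + 2 * x ≡ x + y + (x + - y)
      split = solve-∀

    minus-one-power : (- 1ℤ) ^ n ≡ - 1ℤ
    minus-one-power = trans (cong ((- 1ℤ) ^_) order)
      (cong (λ p → - 1ℤ * (- 1ℤ * (- 1ℤ * p))) (trans (cong ((- 1ℤ) ^_) (ℕ.*-comm k 2)) (trans (sym (^-*-assoc (- 1ℤ) 2 k)) (^-zeroˡ k))))

    charVal-relation : ∀ x → let y = double+1 x in
      (1ℤ + y) * charVal R y + - charVal S y ≡ ζ y ^ k * ((1ℤ + y) * y * (ζ y + + 4 * T) + - (ζ y * (ζ y + (+ 4 * T + + 2))))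
    charVal-relation x = begin
      (1ℤ + y) * charVal R y + - charVal S y       ≡⟨ charVal-tournament A R doubled x ⟨
      (+ 2) ^ n * charVal A x                      ≡⟨ cong₂ (λ m v → (+ 2) ^ m * v) order (rep-values (rep-charPoly A) (rep-target t) charPoly-A x) ⟩
      (+ 2) ^ (3 ℕ.+ k ℕ.* 2) * targetVal t x      ≡⟨ targetVal-scaled x ⟩
      ζ y ^ k * ((1ℤ + y) * y * (ζ y + + 4 * T) + - (ζ y * (ζ y + (+ 4 * T + + 2)))) ∎
      where
      y : ℤ
      y = double+1 x

    -- charVal R is odd and charVal S is even, so the relations at y and -y determine both.
    charVal-S : ∀ x → let y = double+1 x in charVal S y ≡ ζ y ^ suc k * (ζ y + (+ 4 * T + + 2))
    charVal-S x = cancelˡ {+ 2} (λ ()) p (z * Z * w) (begin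
      + 2 * p                                                                  ≡⟨ eliminate y p q ⟩
      (1ℤ + y) * (((1ℤ + y) * q + - p) + - ((1ℤ + - y) * - q + - p)) + - (+ 2 * ((1ℤ + y) * q + - p))
                                                                               ≡⟨ cong₂ (λ e f → (1ℤ + y) * (e + - f) + - (+ 2 * e)) (charVal-relation x) reflected ⟩
      (1ℤ + y) * (Z * ((1ℤ + y) * y * c + - (z * w)) + - (Z * ((1ℤ + - y) * - y * c + - (z * w)))) + - (+ 2 * (Z * ((1ℤ + y) * y * c + - (z * w))))
                                                                               ≡⟨ collect y Z c z w ⟩
      + 2 * (z * Z * w)                                                        ∎)
      where
      y p q z Z c w : ℤ
      y = double+1 x
      p = charVal S y
      q = charVal R y
      z = ζ y
      Z = z ^ k
      c = z + + 4 * T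
      w = z + (+ 4 * T + + 2)
      -- Subtracting the relation at -y from that at y leaves 2q; putting this back into the
      -- relation at y isolates 2p.
      eliminate : ∀ y p q → + 2 * p ≡ (1ℤ + y) * (((1ℤ + y) * q + - p) + - ((1ℤ + - y) * - q + - p)) + - (+ 2 * ((1ℤ + y) * q + - p))
      eliminate = solve-∀
      collect : ∀ y Z c z w → (1ℤ + y) * (Z * ((1ℤ + y) * y * c + - (z * w)) + - (Z * ((1ℤ + - y) * - y * c + - (z * w)))) + - (+ 2 * (Z * ((1ℤ + y) * y * c + - (z * w))))
                ≡ + 2 * (z * Z * w)
      collect = solve-∀
      -- The reflection of x in -1/2 is integral, so the relation is available at -y too.
      y-reflected : double+1 (- 1ℤ + - x) ≡ - y
      y-reflected = reflect x
        where
        reflect : ∀ x → + 2 * (- 1ℤ + - x) + 1ℤ ≡ - (+ 2 * x + 1ℤ)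
        reflect = solve-∀
      ζ-even : ζ (- y) ≡ z
      ζ-even = cong (_+ (+ 4 * T + - 1ℤ)) (even y)
        where
        even : ∀ y → - y * - y ≡ y * y
        even = solve-∀
      q-odd : charVal R (- y) ≡ - q
      q-odd = trans (charVal-parity R-skew y) (trans (cong (_* q) minus-one-power) (-1*i≡-i q))
      p-even : charVal S (- y) ≡ p
      p-even = trans (charVal-parity S-skew y) (trans (cong (λ s → - 1ℤ * s * p) minus-one-power) (*-identityˡ p))
      reflected : (1ℤ + - y) * - q + - p ≡ Z * ((1ℤ + - y) * - y * c + - (z * w))
      reflected = begin
        (1ℤ + - y) * - q + - p
          ≡⟨ cong₂ (λ a b → (1ℤ + - y) * a + - b) q-odd p-even ⟨
        (1ℤ + - y) * charVal R (- y) + - charVal S (- y)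
          ≡⟨ subst (λ y → (1ℤ + y) * charVal R y + - charVal S y ≡ ζ y ^ k * ((1ℤ + y) * y * (ζ y + + 4 * T) + - (ζ y * (ζ y + (+ 4 * T + + 2)))))
               y-reflected (charVal-relation (- 1ℤ + - x)) ⟩
        ζ (- y) ^ k * ((1ℤ + - y) * - y * (ζ (- y) + + 4 * T) + - (ζ (- y) * (ζ (- y) + (+ 4 * T + + 2))))
          ≡⟨ cong (λ z → z ^ k * ((1ℤ + - y) * - y * (z + + 4 * T) + - (z * (z + (+ 4 * T + + 2))))) ζ-even ⟩
        Z * ((1ℤ + - y) * - y * c + - (z * w)) ∎

    S-diagonal : ∀ i → S i i ≡ 0ℤ
    S-diagonal i = i≡-i⇒i≡0 (S i i) (S-skew i i)

    S-unit : ∀ {i j} → i ≢ j → S i j * S i j ≡ 1ℤ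
    S-unit {zero}  {zero}  i≢j = contradiction refl i≢j
    S-unit {zero}  {suc j} i≢j = refl
    S-unit {suc i} {zero}  i≢j = refl
    S-unit {suc i} {suc j} i≢j = cases (A i j) (A j i) (proj₁ tournament i j) (proj₁ tournament j i)
        (trans (A+Aᵀ i j) (cong (λ d → 1ℤ + - d) (δ-off {i = suc i} {suc j} i≢j)))
      where
      cases : ∀ x y → x ≡ 0ℤ ⊎ x ≡ 1ℤ → y ≡ 0ℤ ⊎ y ≡ 1ℤ → x + y ≡ 1ℤ → (x + - y) * (x + - y) ≡ 1ℤ
      cases _ _ (inj₁ refl) (inj₁ refl) ()
      cases _ _ (inj₁ refl) (inj₂ refl) _ = refl
      cases _ _ (inj₂ refl) (inj₁ refl) _ = refl
      cases _ _ (inj₂ refl) (inj₂ refl) ()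

    S≤1 : ∀ i j → ∣ S i j ∣ ℕ.≤ 1
    S≤1 i j with i ≟ j
    ... | yes refl = subst (λ s → ∣ s ∣ ℕ.≤ 1) (sym (S-diagonal i)) z≤n
    ... | no i≢j with square-±1 (S i j) (S-unit i≢j)
    ... | inj₁ e = subst (λ s → ∣ s ∣ ℕ.≤ 1) (sym e) ℕ.≤-refl
    ... | inj₂ e = subst (λ s → ∣ s ∣ ℕ.≤ 1) (sym e) ℕ.≤-refl

    open Reduction t t≥1 S S-skew S≤1 charVal-S using (W; W⊗W; W-symmetric)

    pos-order : + suc n ≡ + 4 * T + + 2
    pos-order = trans (cong (λ m → + suc m) order) (trans (cong (λ x → + 4 + x) (trans (pos-* k 2) (cong (_* + 2) pos-k))) (collect T))
      where
      collect : ∀ T → + 4 + (+ 2 * T + - 1ℤ) * + 2 ≡ + 4 * T + + 2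
      collect = solve-∀

    -- The 0/1 matrix marking the entries -1 of S, so that S = (J - I) - 2P.
    P : Mat ℤ (suc n)
    P = bordered 0ℤ (λ _ → 0ℤ) (λ _ → 1ℤ) (transpose A)

    S-mod-2 : ∀ i j → S i j ≡ (1ℤ + - δ i j) + - (+ 2) * P i j
    S-mod-2 zero    zero    = refl
    S-mod-2 zero    (suc j) = refl
    S-mod-2 (suc i) zero    = refl
    S-mod-2 (suc i) (suc j) = trans (split (A i j) (A j i)) (cong (_+ - (+ 2) * A j i) (A+Aᵀ i j))
      where
      split : ∀ x y → x + - y ≡ x + y + - (+ 2) * y
      split = solve-∀

    -- For E = J - I and S = E - 2P the product S Sᵀ is E Eᵀ + 2C, with C = -P Eᵀ - E Pᵀ + 2 P Pᵀ
    -- being `correction`. As E Eᵀ = 4t J + I, this writes half of W as an explicit integer matrix.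
    correction K : Mat ℤ (suc n)
    correction i j = sum (λ l → - (P i l * (1ℤ + - δ j l)) + - ((1ℤ + - δ i l) * P j l) + + 2 * (P i l * P j l))
    K i j = + 2 * T + correction i j + (1ℤ + - (+ 2 * T)) * δ i j

    -- Off the diagonal S ≡ J - I (mod 2), so the off-diagonal entries of S Sᵀ are even.
    W≐2K : ∀ i j → W i j ≡ + 2 * K i j
    W≐2K i j = begin
      - a * δ i j + - 1ℤ * (S ⊗ S) i j
        ≡⟨ cong (λ q → - a * δ i j + - 1ℤ * q) (trans (sum-cong-≗ factors) (sum-linear (- 1ℤ) (- (+ 2)) (λ l → E i l * E j l)
             (λ l → - (P i l * E j l) + - (E i l * P j l) + + 2 * (P i l * P j l)))) ⟩
      - a * δ i j + - 1ℤ * (- 1ℤ * sum (λ l → E i l * E j l) + - (+ 2) * correction i j)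
        ≡⟨ cong (λ s → - a * δ i j + - 1ℤ * (- 1ℤ * s + - (+ 2) * correction i j)) (trans (sum-except i (E j)) (cong₂ (λ s d → s + - (1ℤ + - d)) total (δ-sym j i))) ⟩
      - a * δ i j + - 1ℤ * (- 1ℤ * (+ 4 * T + + 2 + - 1ℤ + - (1ℤ + - δ i j)) + - (+ 2) * correction i j)
        ≡⟨ collect T (δ i j) (correction i j) ⟩
      + 2 * K i j ∎
      where
      a : ℤ
      a = + 4 * T + - 1ℤ
      E : Mat ℤ (suc n)
      E i l = 1ℤ + - δ i l
      total : sum (E j) ≡ + 4 * T + + 2 + - 1ℤ
      total = trans (sum-cong-≗ (λ l → sym (*-identityʳ (E j l)))) (trans (sum-except j (λ _ → 1ℤ)) (cong (_+ - 1ℤ) (trans (sum-one (suc n)) pos-order)))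
      expand : ∀ e p f r → (e + - (+ 2) * p) * - (f + - (+ 2) * r) ≡ - 1ℤ * (e * f) + - (+ 2) * (- (p * f) + - (e * r) + + 2 * (p * r))
      expand = solve-∀
      factors : ∀ l → S i l * S l j ≡ - 1ℤ * (E i l * E j l) + - (+ 2) * (- (P i l * E j l) + - (E i l * P j l) + + 2 * (P i l * P j l))
      factors l = trans (cong₂ _*_ (S-mod-2 i l) (trans (S-skew j l) (cong -_ (S-mod-2 j l)))) (expand (E i l) (P i l) (E j l) (P j l))
      collect : ∀ T d v → - (+ 4 * T + - 1ℤ) * d + - 1ℤ * (- 1ℤ * (+ 4 * T + + 2 + - 1ℤ + - (1ℤ + - d)) + - (+ 2) * v)
                ≡ + 2 * (+ 2 * T + v + (1ℤ + - (+ 2 * T)) * d)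
      collect = solve-∀

    K-symmetric : Symmetric K
    K-symmetric i j = cancelˡ {+ 2} (λ ()) (K i j) (K j i) (trans (sym (W≐2K i j)) (trans (W-symmetric i j) (W≐2K j i)))

    -- Each row of S has 4t + 1 entries ±1, so W has diagonal (4t + 1) - (4t - 1) = 2.
    K-diagonal : ∀ i → K i i ≡ 1ℤ
    K-diagonal i = cancelˡ {+ 2} (λ ()) (K i i) 1ℤ (begin
      + 2 * K i i                                ≡⟨ W≐2K i i ⟨
      - a * δ i i + - 1ℤ * (S ⊗ S) i i           ≡⟨ cong₂ (λ d q → - a * d + - 1ℤ * q) (δ-diag i) row-square ⟩
      - a * 1ℤ + - 1ℤ * (- 1ℤ * (+ 4 * T + + 2 + - 1ℤ)) ≡⟨ collect T ⟩
      + 2 * 1ℤ                                   ∎)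
      where
      a : ℤ
      a = + 4 * T + - 1ℤ
      entry : ∀ l → S i l * S l i ≡ - 1ℤ * ((1ℤ + - δ i l) * 1ℤ)
      entry l with i ≟ l
      ... | yes refl rewrite S-diagonal i | δ-diag i = refl
      ... | no i≢l = trans (cong (λ s → S i l * s) (S-skew i l)) (trans (sym (neg-distribʳ-* (S i l) (S i l)))
        (trans (cong -_ (S-unit i≢l)) (cong (λ d → - 1ℤ * ((1ℤ + - d) * 1ℤ)) (sym (δ-off i≢l)))))
      row-square : (S ⊗ S) i i ≡ - 1ℤ * (+ 4 * T + + 2 + - 1ℤ)
      row-square = trans (sum-cong-≗ entry) (trans (sym (*-distribˡ-sum (- 1ℤ) (λ l → (1ℤ + - δ i l) * 1ℤ)))
        (cong (λ s → - 1ℤ * s) (trans (sum-except i (λ _ → 1ℤ)) (cong (_+ - 1ℤ) (trans (sum-one (suc n)) pos-order)))))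
      collect : ∀ T → - (+ 4 * T + - 1ℤ) * 1ℤ + - 1ℤ * (- 1ℤ * (+ 4 * T + + 2 + - 1ℤ)) ≡ + 2 * 1ℤ
      collect = solve-∀

    pos-half : + suc (2 ℕ.* t) ≡ + 2 * T + 1ℤ
    pos-half = trans (+-comm 1ℤ (+ (2 ℕ.* t))) (cong (_+ 1ℤ) (pos-* 2 t))

    K⊗K : ∀ i j → (K ⊗ K) i j ≡ + suc (2 ℕ.* t) * K i j
    K⊗K i j = cancelˡ {+ 4} (λ ()) ((K ⊗ K) i j) (+ suc (2 ℕ.* t) * K i j) (begin
      + 4 * (K ⊗ K) i j                          ≡⟨ *-distribˡ-sum (+ 4) (λ l → K i l * K l j) ⟩
      sum (λ l → + 4 * (K i l * K l j))          ≡⟨ sum-cong-≗ (λ l → trans (quadruple (K i l) (K l j)) (cong₂ _*_ (sym (W≐2K i l)) (sym (W≐2K l j)))) ⟩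
      (W ⊗ W) i j                                ≡⟨ W⊗W i j ⟩
      (+ 4 * T + + 2) * W i j                    ≡⟨ cong (λ x → (+ 4 * T + + 2) * x) (W≐2K i j) ⟩
      (+ 4 * T + + 2) * (+ 2 * K i j)            ≡⟨ collect T (K i j) ⟩
      + 4 * ((+ 2 * T + 1ℤ) * K i j)             ≡⟨ cong (λ h → + 4 * (h * K i j)) pos-half ⟨
      + 4 * (+ suc (2 ℕ.* t) * K i j)            ∎)
      where
      quadruple : ∀ x y → + 4 * (x * y) ≡ (+ 2 * x) * (+ 2 * y)
      quadruple = solve-∀
      collect : ∀ T x → (+ 4 * T + + 2) * (+ 2 * x) ≡ + 4 * ((+ 2 * T + 1ℤ) * x)
      collect = solve-∀

    private
      twice : + suc n ≡ + 2 * + suc (2 ℕ.* t)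
      twice = trans pos-order (trans (collect T) (cong (λ h → + 2 * h) (sym pos-half)))
        where
        collect : ∀ T → + 4 * T + + 2 ≡ + 2 * (+ 2 * T + 1ℤ)
        collect = solve-∀
      module G = UnitGram (2 ℕ.* t) twice K K-symmetric K-diagonal K⊗K

    -- Row zero of K and a row orthogonal to it serve as u and v.
    blockSquare : BlockSquare t (suc n)
    blockSquare = record
      { S = S ; skew = S-skew ; unit = S-unit ; u = G.u zero ; v = G.v zero
      ; disjoint = G.disjoint zero ; cover = G.cover zero
      ; uu = trans (G.row-norm zero) pos-half
      ; vv = trans (G.row-norm (proj₁ (G.zero-entry zero))) pos-half
      ; square = λ i j → trans (isolate (- (+ 4 * T + - 1ℤ) * δ i j) ((S ⊗ S) i j))
          (trans (cong (λ w → - (+ 4 * T + - 1ℤ) * δ i j + - w) (W≐2K i j)) (cong (λ x → - (+ 4 * T + - 1ℤ) * δ i j + x)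
            (trans (neg-distribˡ-* (+ 2) (K i j)) (cong (λ x → - (+ 2) * x) (G.K-blocks zero i j))))) }
      where
      isolate : ∀ x q → q ≡ x + - (x + - 1ℤ * q)
      isolate = solve-∀

open Tournaments

-- Sorting the two classes into the block form of an EW matrix

module Sorting where
  open import Data.Integer using (+_; _+_; _*_; -_)
  open ≡-Reasoning

  -- Deleting position p does not change which indices lie before p; this keeps the insertion in
  -- `sorting` sorted.
  punchOut-<ᵇ : ∀ {n} {p j : Fin (suc n)} (p≢j : p ≢ j) → (toℕ (punchOut p≢j) <ᵇ toℕ p) ≡ (toℕ j <ᵇ toℕ p)
  punchOut-<ᵇ {p = zero}  {zero}  p≢j = contradiction refl p≢j
  punchOut-<ᵇ {p = zero}  {suc j} p≢j = refl
  punchOut-<ᵇ {suc n} {suc p} {zero}  p≢j = refl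
  punchOut-<ᵇ {suc n} {suc p} {suc j} p≢j = punchOut-<ᵇ {p = p} {j} (p≢j ∘ cong suc)

  <ᵇ-irrefl : ∀ m → (m <ᵇ m) ≡ false
  <ᵇ-irrefl zero    = refl
  <ᵇ-irrefl (suc m) = <ᵇ-irrefl m

  -- Insertion of the head: a true head stays in front, a false one goes to position c, right behind
  -- the c true entries. The bound c ≤ n makes that position available.
  sorting : ∀ {n} (b : Fin n → Bool) → Σ ℕ λ c → c ℕ.≤ n × sum (indicator ∘ b) ≡ + c ×
            Σ (Permutation′ n) λ π → ∀ i → b (π ⟨$⟩ʳ i) ≡ (toℕ i <ᵇ c)
  sorting {zero}  b = 0 , z≤n , refl , idₚ , λ ()
  sorting {suc n} b with sorting (b ∘ suc)
  ... | c , c≤n , total , π , sorted with b zero in b₀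
  ... | true  = suc c , s≤s c≤n , cong (λ s → 1ℤ + s) total , lift₀ π , λ { zero → b₀ ; (suc i) → sorted i }
  ... | false = c , ℕ.m≤n⇒m≤1+n c≤n , trans (+-identityˡ (sum (indicator ∘ b ∘ suc))) total , insert p zero π , inserted
    where
    p : Fin (suc n)
    p = fromℕ< (s≤s c≤n)
    inserted : ∀ i → b (insert p zero π ⟨$⟩ʳ i) ≡ (toℕ i <ᵇ c)
    inserted i with p ≟ i
    ... | yes refl = trans b₀ (sym (trans (cong (_<ᵇ c) (toℕ-fromℕ< (s≤s c≤n))) (<ᵇ-irrefl c)))
    ... | no p≢i   = trans (sorted (punchOut p≢i))
      (subst (λ m → (toℕ (punchOut p≢i) <ᵇ m) ≡ (toℕ i <ᵇ m)) (toℕ-fromℕ< (s≤s c≤n)) (punchOut-<ᵇ p≢i))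

  ⟨$⟩ʳ-injective : ∀ {n} (π : Permutation′ n) {i j} → π ⟨$⟩ʳ i ≡ π ⟨$⟩ʳ j → i ≡ j
  ⟨$⟩ʳ-injective π e = trans (sym (inverseˡ π)) (trans (cong (π ⟨$⟩ˡ_) e) (inverseˡ π))

  permute : ∀ {t N} → BlockSquare t N → Permutation′ N → BlockSquare t N
  permute {t} {N} D π = record
    { S = λ i j → S (f i) (f j)
    ; skew = λ i j → skew (f i) (f j)
    ; unit = λ i≢j → unit (i≢j ∘ ⟨$⟩ʳ-injective π)
    ; u = u ∘ f ; v = v ∘ f
    ; disjoint = disjoint ∘ f ; cover = cover ∘ f
    ; uu = trans (sym (sum-permute (λ i → u i * u i) π)) uu
    ; vv = trans (sym (sum-permute (λ i → v i * v i) π)) vv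
    ; square = λ i j → trans (sym (sum-permute (λ l → S (f i) l * S l (f j)) π))
        (trans (square (f i) (f j)) (cong (λ d → - (+ 4 * + t + - 1ℤ) * d + - (+ 2) * (outer u u (f i) (f j) + outer v v (f i) (f j))) (δ-permute i j))) }
    where
    open BlockSquare D
    f : Fin N → Fin N
    f = π ⟨$⟩ʳ_
    δ-permute : ∀ i j → δ (f i) (f j) ≡ δ i j
    δ-permute i j with i ≟ j
    ... | yes refl = trans (δ-diag (f i)) (sym (δ-diag i))
    ... | no i≢j   = trans (δ-off (i≢j ∘ ⟨$⟩ʳ-injective π)) (sym (δ-off i≢j))

  -- B = I + S and Bᵀ = I - S, so both products in the definition are I - S².
  sorted⇒EW : ∀ t → let h = 2 ℕ.* t ℕ.+ 1 in (D : BlockSquare t (h ℕ.+ h)) →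
              (∀ i → BlockSquare.u D i ≡ indicator (toℕ i <ᵇ h)) → (∀ i → BlockSquare.v D i ≡ indicator (not (toℕ i <ᵇ h))) →
              Σ (Mat ℤ (h ℕ.+ h)) λ B → IsEWMatrix h B × IsSkewSymmetric B
  sorted⇒EW t D u-sorted v-sorted = B , (pm1 , gram , gramᵀ) , skewB
    where
    open BlockSquare D
    h : ℕ
    h = 2 ℕ.* t ℕ.+ 1
    B : Mat ℤ (h ℕ.+ h)
    B i j = δ i j + S i j
    S-diagonal : ∀ i → S i i ≡ 0ℤ
    S-diagonal i = i≡-i⇒i≡0 (S i i) (skew i i)
    pm1 : IsPM1Matrix B
    pm1 i j with i ≟ j
    ... | yes refl = inj₁ (cong₂ _+_ (δ-diag i) (S-diagonal i))
    ... | no i≢j with square-±1 (S i j) (unit i≢j)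
    ... | inj₁ e = inj₁ (cong₂ _+_ (δ-off i≢j) e)
    ... | inj₂ e = inj₂ (cong₂ _+_ (δ-off i≢j) e)
    skewB : IsSkewSymmetric B
    skewB i j = trans (cong₂ (λ d s → δ i j + S i j + (d + s)) (δ-sym j i) (skew i j)) (trans (collect (δ i j) (S i j)) (sym (==-δ (+ 2) i j)))
      where
      collect : ∀ d s → d + s + (d + - s) ≡ + 2 * d
      collect = solve-∀
    plus : ∀ i j → B i j ≡ (1ℤ •1+ 1ℤ • S) i j
    plus i j = sym (cong₂ _+_ (*-identityˡ (δ i j)) (*-identityˡ (S i j)))
    minus : ∀ i j → B j i ≡ (1ℤ •1+ - 1ℤ • S) i j
    minus i j = trans (cong₂ _+_ (δ-sym j i) (skew i j)) (sym (cong₂ _+_ (*-identityˡ (δ i j)) (-1*i≡-i (S i j))))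
    identified : ∀ b c → b * c ≡ - 1ℤ → b + c ≡ 0ℤ → ∀ i j → ((1ℤ •1+ b • S) ⊗ (1ℤ •1+ c • S)) i j ≡ ewGram h i j
    identified b c bc b+c i j = begin
      ((1ℤ •1+ b • S) ⊗ (1ℤ •1+ c • S)) i j
        ≡⟨ shifts-⊗ b c 1ℤ S i j b+c ⟩
      1ℤ * 1ℤ * δ i j + b * c * (S ⊗ S) i j
        ≡⟨ cong₂ (λ e q → 1ℤ * 1ℤ * δ i j + e * q) bc (square i j) ⟩
      1ℤ * 1ℤ * δ i j + - 1ℤ * (- (+ 4 * + t + - 1ℤ) * δ i j + - (+ 2) * (outer u u i j + outer v v i j))
        ≡⟨ collect (+ t) (δ i j) (outer u u i j + outer v v i j) ⟩
      + 4 * + t * δ i j + + 2 * (outer u u i j + outer v v i j)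
        ≡⟨ cong₂ (λ x y → + 4 * + t * δ i j + + 2 * (x + y)) (cong₂ _*_ (u-sorted i) (u-sorted j)) (cong₂ _*_ (v-sorted i) (v-sorted j)) ⟩
      + 4 * + t * δ i j + + 2 * (indicator (toℕ i <ᵇ h) * indicator (toℕ j <ᵇ h) + indicator (not (toℕ i <ᵇ h)) * indicator (not (toℕ j <ᵇ h)))
        ≡⟨ ewGram-blocks t i j ⟨
      ewGram h i j ∎
      where
      collect : ∀ T d x → 1ℤ * 1ℤ * d + - 1ℤ * (- (+ 4 * T + - 1ℤ) * d + - (+ 2) * x) ≡ + 4 * T * d + + 2 * x
      collect = solve-∀
    gram : ∀ i j → (B · transpose B) i j ≡ ewGram h i j
    gram i j = trans (ΣF≡sum (λ l → B i l * B j l)) (trans (sum-cong-≗ (λ l → cong₂ _*_ (plus i l) (minus l j))) (identified 1ℤ (- 1ℤ) refl refl i j))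
    gramᵀ : ∀ i j → (transpose B · B) i j ≡ ewGram h i j
    gramᵀ i j = trans (ΣF≡sum (λ l → B l i * B l j)) (trans (sum-cong-≗ (λ l → cong₂ _*_ (minus i l) (plus l j))) (identified (- 1ℤ) 1ℤ refl refl i j))

  BlockSquare⇒EW : ∀ t → let h = 2 ℕ.* t ℕ.+ 1 in BlockSquare t (h ℕ.+ h) →
                   Σ (Mat ℤ (h ℕ.+ h)) λ B → IsEWMatrix h B × IsSkewSymmetric B
  BlockSquare⇒EW t D = sorted⇒EW t (permute switched π) u-sorted v-sorted
    where
    open BlockSquare D
    h : ℕ
    h = 2 ℕ.* t ℕ.+ 1
    -- u + v is ±1 everywhere, and multiplying by it turns u and v into the indicators of their
    -- supports.
    d : Fin (h ℕ.+ h) → ℤ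
    d i = u i + v i
    d² : ∀ i → d i * d i ≡ 1ℤ
    d² i = trans (expand (u i) (v i)) (trans (cong₂ (λ x y → x + + 2 * y) (cover i) (disjoint i)) refl)
      where
      expand : ∀ x y → (x + y) * (x + y) ≡ (x * x + y * y) + + 2 * (x * y)
      expand = solve-∀
    switched : BlockSquare t (h ℕ.+ h)
    switched = switch D d d²
    support : ∀ i → Σ Bool λ b → d i * u i ≡ indicator b × d i * v i ≡ indicator (not b)
    support i = from (u i) (v i) (cover i) (i*j≡0⇒i≡0∨j≡0 (u i) (disjoint i))
      where
      from : ∀ x y → x * x + y * y ≡ 1ℤ → x ≡ 0ℤ ⊎ y ≡ 0ℤ → Σ Bool λ b → (x + y) * x ≡ indicator b × (x + y) * y ≡ indicator (not b)
      from x y e (inj₁ refl) = false , *-zeroʳ (0ℤ + y) , trans (cong (_* y) (+-identityˡ y)) (trans (sym (+-identityˡ (y * y))) e)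
      from x y e (inj₂ refl) = true , trans (cong (_* x) (+-identityʳ x)) (trans (sym (+-identityʳ (x * x))) e) , *-zeroʳ (x + 0ℤ)
    b : Fin (h ℕ.+ h) → Bool
    b i = proj₁ (support i)
    c : ℕ
    c = proj₁ (sorting b)
    π : Permutation′ (h ℕ.+ h)
    π = proj₁ (proj₂ (proj₂ (proj₂ (sorting b))))
    c≡h : c ≡ h
    c≡h = +-injective (begin
      + c                                         ≡⟨ proj₁ (proj₂ (proj₂ (sorting b))) ⟨
      sum (indicator ∘ b)                         ≡⟨ sum-cong-≗ (λ i → trans (sym (indicator-idem (b i))) (sym (cong₂ _*_ (proj₁ (proj₂ (support i))) (proj₁ (proj₂ (support i)))))) ⟩
      dot (BlockSquare.u switched) (BlockSquare.u switched) ≡⟨ BlockSquare.uu switched ⟩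
      + 2 * + t + 1ℤ                              ≡⟨ cong (_+ 1ℤ) (pos-* 2 t) ⟨
      + h                                         ∎)
    sorted : ∀ i → b (π ⟨$⟩ʳ i) ≡ (toℕ i <ᵇ h)
    sorted i = subst (λ m → b (π ⟨$⟩ʳ i) ≡ (toℕ i <ᵇ m)) c≡h (proj₂ (proj₂ (proj₂ (proj₂ (sorting b)))) i)
    u-sorted : ∀ i → BlockSquare.u (permute switched π) i ≡ indicator (toℕ i <ᵇ h)
    u-sorted i = trans (proj₁ (proj₂ (support (π ⟨$⟩ʳ i)))) (cong indicator (sorted i))
    v-sorted : ∀ i → BlockSquare.v (permute switched π) i ≡ indicator (not (toℕ i <ᵇ h))
    v-sorted i = trans (proj₂ (proj₂ (support (π ⟨$⟩ʳ i)))) (cong (indicator ∘ not) (sorted i))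

open Sorting

-- Two forms of 4t + 2; the right one is the degree of the target polynomial plus one for the
-- border.
order-split : ∀ t → t ℕ.≥ 1 → (2 ℕ.* t ℕ.+ 1) ℕ.+ (2 ℕ.* t ℕ.+ 1) ≡ suc (3 ℕ.+ (2 ℕ.* t ∸ 1) ℕ.* 2)
order-split t t≥1 = trans (cong (λ m → (m ℕ.+ 1) ℕ.+ (m ℕ.+ 1)) (sym (Parameters.suc-k t t≥1))) (collect (2 ℕ.* t ∸ 1))
  where
  collect : ∀ k → (suc k ℕ.+ 1) ℕ.+ (suc k ℕ.+ 1) ≡ suc (3 ℕ.+ k ℕ.* 2)
  collect = ℕ-Solver.solve-∀

open import Data.Nat using (_+_; _*_; _≥_)
open import Data.Integer using (+_)

theorem1p1 : (t : ℕ) → t ≥ 1 →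
    (Σ (Mat _ ((2 * t + 1) + (2 * t + 1))) λ B →
    IsEWMatrix (2 * t + 1) B × IsSkewSymmetric B)
    ⇔
    (Σ ℕ λ n → Σ (Mat _ n) λ A →
    IsTournamentMatrix A ×
    (charPoly A ≈ₚ
    (((xP ^ₚ 3) -ₚ (constP (+ (2 * t ∸ 1)) *ₚ (xP ^ₚ 2)) -ₚ constP (+ (t * (4 * t ∸ 1))))
    *ₚ (((xP ^ₚ 2) +ₚ xP +ₚ constP (+ t)) ^ₚ (2 * t ∸ 1)))))
theorem1p1 t t≥1 = mk⇔
  (λ { (B , ew , skewB) →
    let open ToTournament t t≥1 (3 + (2 * t ∸ 1) * 2) refl (subst (BlockSquare t) (order-split t t≥1) (EW⇒BlockSquare t B ew skewB))
    in 3 + (2 * t ∸ 1) * 2 , A , tournament , charPoly-A })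
  -- The order n is free here; the degree of the characteristic polynomial forces it to be 4t + 1.
  (λ { (n , A , tournament , charPoly-A) →
    let open FromTournament t t≥1 A tournament charPoly-A
    in BlockSquare⇒EW t (subst (BlockSquare t) (trans (cong suc order) (sym (order-split t t≥1))) blockSquare) })
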